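{- Let $q$ be a prime power, $\ell\ge1$, and let $\mathcal{A}$ be a central hyperplane arrangement in $\mathbb{F}_q^\ell$. If $\chi(\mathcal{A},q^{\ell-2})=0$, then $\mathcal{A}$ is free with exponents $(1, q, q^2, \dots, q^{\ell-2}, |\mathcal{A}|-1-q-\cdots-q^{\ell-2})$.
   Context: A central hyperplane arrangement $\mathcal{A}$ in $V=\mathbb{F}_q^\ell$ is a finite set of linear subspaces of codimension one. Characteristic polynomial: with $L(\mathcal{A})$ the set of intersections of subsets of $\mathcal{A}$ (including $V$) ordered by reverse inclusion, and Möbius function $\mu(V)=1$, $\mu(X)=-\sum_{Y<X}\mu(Y)$, set $\chi(\mathcal{A},t)=\sum_{X\in L(\mathcal{A})}\mu(X)t^{\dim X}$. Freeness: let $S=\mathbb{F}_q[x_1,\dots,x_\ell]$, fix for each $H$ a nonzero linear form $\alpha_H$ vanishing on $H$, and let $D(\mathcal{A})=\{\delta=\sum_i f_i\partial/\partial x_i,\ f_i\in S : \delta(\alpha_H)\in\alpha_HS\ \forall H\in\mathcal{A}\}$. $\mathcal{A}$ is free if $D(\mathcal{A})$ is a free $S$-module; its exponents are then the multiset of polynomial degrees of a homogeneous basis (the Euler field $\sum x_i\partial/\partial x_i$ has degree 1). -}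

module Defs where

open import Level using (0ℓ)
open import Data.Nat as ℕ using (ℕ; zero; suc; _∸_; _⊔_)
open import Data.Integer as ℤ using (ℤ; +_)
open import Data.Rational.Unnormalised as Q using (ℚᵘ; mkℚᵘ)
open import Data.Fin using (Fin)
open import Data.Fin.Properties using () renaming (_≟_ to _≟F_)
open import Data.Bool using () renaming (_≟_ to _B≟_)
open import Data.Bool using (Bool; true; false; if_then_else_; not; _∧_; _∨_)
open import Data.List as L using (List; []; _∷_; _++_; map; foldr; filter; concatMap; allFin; upTo; length)
open import Data.List.Relation.Binary.Permutation.Propositional using (_↭_)
open import Data.Vec as V using (Vec; []; _∷_; lookup; tabulate; zipWith; toList)
open import Data.Vec.Properties using (≡-dec)
open import Data.Product using (Σ; Σ-syntax; _×_; _,_; ∃)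
open import Relation.Nullary using (¬_; does)
open import Relation.Binary.Definitions using (DecidableEquality)
open import Relation.Binary.PropositionalEquality using (_≡_)
open import Algebra.Structures using (IsCommutativeRing)
open import Function.Bundles using (_↔_)

-- A finite field with q elements (q is then automatically a prime power).

record FiniteField (q : ℕ) : Set₁ where
  infixl 7 _*_
  infixl 6 _+_
  field
    Carrier : Set
    _+_ _*_ : Carrier → Carrier → Carrier
    -_ : Carrier → Carrier
    0# 1# : Carrier
    isCommutativeRing : IsCommutativeRing _≡_ _+_ _*_ -_ 0# 1#
    0≢1 : ¬ (0# ≡ 1#)
    inverse : ∀ x → ¬ (x ≡ 0#) → ∃ λ y → x * y ≡ 1#
    enumeration : Fin q ↔ Carrier
    -- (derivable from the enumeration; included for convenience)
    _≟_ : DecidableEquality Carrier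

module Over {q : ℕ} (𝔽 : FiniteField q) where
  open FiniteField 𝔽
  open Function.Bundles.Inverse enumeration using (to)

  isZero : Carrier → Bool
  isZero x = does (x ≟ 0#)

  elems : List Carrier
  elems = map to (allFin q)

  vecsOver : {A : Set} → List A → (k : ℕ) → List (Vec A k)
  vecsOver xs zero    = [] ∷ []
  vecsOver xs (suc k) = concatMap (λ x → map (x ∷_) (vecsOver xs k)) xs

  allB : {A : Set} → (A → Bool) → List A → Bool
  allB p = foldr (λ a b → p a ∧ b) true

  filterB : {A : Set} → (A → Bool) → List A → List A
  filterB p []       = []
  filterB p (x ∷ xs) = if p x then x ∷ filterB p xs else filterB p xs

  anyB : {A : Set} → (A → Bool) → List A → Bool
  anyB p = foldr (λ a b → p a ∨ b) false

  Vect : ℕ → Set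
  Vect ℓ = Vec Carrier ℓ

  allVecs : (ℓ : ℕ) → List (Vect ℓ)
  allVecs = vecsOver elems

  zeroV : ∀ {ℓ} → Vect ℓ
  zeroV = V.replicate _ 0#

  addV : ∀ {ℓ} → Vect ℓ → Vect ℓ → Vect ℓ
  addV = zipWith _+_

  scaleV : ∀ {ℓ} → Carrier → Vect ℓ → Vect ℓ
  scaleV c = V.map (c *_)

  isZeroV : ∀ {ℓ} → Vect ℓ → Bool
  isZeroV v = allB isZero (toList v)

  eval : ∀ {ℓ} → Vect ℓ → Vect ℓ → Carrier
  eval α v = V.foldr _ _+_ 0# (zipWith _*_ α v)

  lincomb : ∀ {ℓ k} → Vect k → Vec (Vect ℓ) k → Vect ℓ
  lincomb c ws = V.foldr _ addV zeroV (zipWith scaleV c ws)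

  independent : ∀ {ℓ k} → Vec (Vect ℓ) k → Bool
  independent {k = k} ws =
    allB (λ c → isZeroV c ∨ not (isZeroV (lincomb c ws))) (allVecs k)

  dimOf : ∀ {ℓ} → List (Vect ℓ) → ℕ
  dimOf {ℓ} pts =
    foldr _⊔_ 0 (map (λ k → if anyB independent (vecsOver pts k) then k else 0)
                     (upTo (suc ℓ)))

  -- Arrangements: hyperplane H_i = ker α_i for nonzero linear forms α_i.

  module Arrangement {ℓ n : ℕ} (A : Fin n → Vect ℓ) where

    Subset : Set
    Subset = Vec Bool n

    allSubsets : List Subset
    allSubsets = vecsOver (true ∷ false ∷ []) n

    inFlat : Subset → Vect ℓ → Bool
    inFlat S v = allB (λ i → if lookup S i then isZero (eval (A i) v) else true)
                      (allFin n)

    points : Subset → List (Vect ℓ)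
    points S = filterB (inFlat S) (allVecs ℓ)

    dim : Subset → ℕ
    dim S = dimOf (points S)

    sameFlat : Subset → Subset → Bool
    sameFlat S T = allB (λ v → does (inFlat S v B≟ inFlat T v)) (allVecs ℓ)

    flatSub : Subset → Subset → Bool
    flatSub S T = allB (λ v → not (inFlat S v) ∨ inFlat T v) (allVecs ℓ)

    -- Y < X in L(A) (reverse inclusion): X ⊊ Y
    below : Subset → Subset → Bool
    below Y X = flatSub X Y ∧ not (sameFlat X Y)

    emptySubset : Subset
    emptySubset = V.replicate n false

    isWhole : Subset → Bool
    isWhole S = sameFlat S emptySubset

    -- one representative subset for each distinct element of L(A)
    dedup : List Subset → List Subset → List Subset
    dedup acc []       = acc
    dedup acc (S ∷ Ss) = if anyB (sameFlat S) acc then dedup acc Ss else dedup (S ∷ acc) Ss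

    latticeL : List Subset
    latticeL = dedup [] allSubsets

    sumℤ : List ℤ → ℤ
    sumℤ = foldr ℤ._+_ (+ 0)

    -- Möbius function by the recursion μ(V)=1, μ(X) = -Σ_{Y<X} μ(Y);
    -- the fuel (|L(A)|+1) exceeds the length of any strict chain in L(A).
    μ-fuel : ℕ → Subset → ℤ
    μ-fuel zero    X = + 0
    μ-fuel (suc k) X =
      if isWhole X then + 1
      else ℤ.- sumℤ (map (μ-fuel k) (filterB (λ Y → below Y X) latticeL))

    μ : Subset → ℤ
    μ = μ-fuel (suc (length latticeL))

    powQ : ℚᵘ → ℕ → ℚᵘ
    powQ t zero    = Q.1ℚᵘ
    powQ t (suc k) = t Q.* powQ t k

    χ : ℚᵘ → ℚᵘ
    χ t = foldr Q._+_ Q.0ℚᵘ (map (λ X → mkℚᵘ (μ X) 0 Q.* powQ t (dim X)) latticeL)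

    IsArrangement : Set
    IsArrangement =
      (∀ i → ¬ (∀ j → lookup (A i) j ≡ 0#)) ×
      (∀ i j → ¬ (i ≡ j) →
         ¬ (∀ (v : Vect ℓ) → (eval (A i) v ≡ 0# → eval (A j) v ≡ 0#) ×
                              (eval (A j) v ≡ 0# → eval (A i) v ≡ 0#)))

    -- The polynomial ring S = F_q[x_1..x_ℓ] as formal sums of terms.

    Monomial : Set
    Monomial = Vec ℕ ℓ

    Poly : Set
    Poly = List (Carrier × Monomial)

    coeff : Poly → Monomial → Carrier
    coeff p m = foldr (λ { (c , m') acc → if does (≡-dec ℕ._≟_ m m') then c + acc else acc }) 0# p

    infix 4 _≈ₚ_
    _≈ₚ_ : Poly → Poly → Set
    p ≈ₚ p' = ∀ m → coeff p m ≡ coeff p' m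

    infixl 7 _*ₚ_
    _*ₚ_ : Poly → Poly → Poly
    p *ₚ p' = concatMap (λ { (c , m) → map (λ { (d , m') → (c * d , zipWith ℕ._+_ m m') }) p' }) p

    sumₚ : ∀ {k} → (Fin k → Poly) → Poly
    sumₚ f = concatMap f (allFin _)

    constₚ : Carrier → Poly
    constₚ c = (c , V.replicate ℓ 0) ∷ []

    linPoly : Vect ℓ → Poly
    linPoly α = map (λ i → (lookup α i , tabulate (λ j → if does (i ≟F j) then 1 else 0)))
                    (allFin ℓ)

    HomogP : ℕ → Poly → Set
    HomogP d p = ∀ m → ¬ (coeff p m ≡ 0#) → V.sum m ≡ d

    -- derivations δ = Σ f_i ∂/∂x_i, given by (f_1 .. f_ℓ)
    Der : Set
    Der = Fin ℓ → Poly

    applyDer : Der → Vect ℓ → Poly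
    applyDer δ α = sumₚ (λ i → constₚ (lookup α i) *ₚ δ i)

    InD : Der → Set
    InD δ = ∀ H → Σ[ g ∈ Poly ] (linPoly (A H) *ₚ g ≈ₚ applyDer δ (A H))

    HomogD : ℕ → Der → Set
    HomogD d δ = ∀ i → HomogP d (δ i)

    combo : ∀ {m} → (Fin m → Poly) → (Fin m → Der) → Der
    combo f θ i = sumₚ (λ j → f j *ₚ θ j i)

    FreeWithExponents : List ℤ → Set
    FreeWithExponents es =
      Σ[ m ∈ ℕ ] Σ[ θ ∈ (Fin m → Der) ] Σ[ d ∈ (Fin m → ℕ) ]
        (∀ j → InD (θ j)) ×
        (∀ j → HomogD (d j) (θ j)) ×
        (∀ δ → InD δ → Σ[ f ∈ (Fin m → Poly) ] (∀ i → δ i ≈ₚ combo f θ i)) ×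
        (∀ f f' → (∀ i → combo f θ i ≈ₚ combo f' θ i) → ∀ j → f j ≈ₚ f' j) ×
        (map (λ j → + d j) (allFin m) ↭ es)

-- t = q^(ℓ-2) as a rational (for ℓ = 1 this is 1/q; q ≥ 2 for a field)

tval : ℕ → ℕ → ℚᵘ
tval q zero          = mkℚᵘ (+ 1) (q ℕ.* q ∸ 1)   -- ℓ = 0: unused (ℓ ≥ 1)
tval q (suc zero)    = mkℚᵘ (+ 1) (q ∸ 1)
tval q (suc (suc k)) = mkℚᵘ (+ (q ℕ.^ k)) 0

expList : ℕ → ℕ → ℕ → List ℤ
expList q ℓ n =
  map (λ i → + (q ℕ.^ i)) (upTo (ℓ ∸ 1)) ++
  (+ n ℤ.- foldr ℤ._+_ (+ 0) (map (λ i → + (q ℕ.^ i)) (upTo (ℓ ∸ 1)))) ∷ []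

{-# OPTIONS --safe #-}
-- Write θⱼ = Σᵢ xᵢ^(q^j) ∂ᵢ, so that θⱼ(v) = v^(q^j) for every linear form v. For the arrangement of all
-- hyperplanes, a derivation η is a linear map v ↦ η(v) with v ∣ η(v), and Newton interpolation writes it
-- uniquely as Σ gⱼ θⱼ with j < ℓ: after subtracting an interpolant on a subspace W, the value at u ∉ W is
-- divisible by the pairwise coprime forms u - w with w ∈ W, and ∏_w (T - w) is an additive polynomial in T.
-- By the theorem of Crapo and Rota, χ(q^(ℓ-2)) = 0 says that every subspace of codimension two lies in a
-- hyperplane of the arrangement. So the missing hyperplanes ker α can be deleted one at a time while the
-- restriction to ker α stays the arrangement of all its hyperplanes. Interpolation on ker α makes the last
-- basis element δ congruent to Σ gⱼ θⱼ (j < ℓ-1) modulo α, and (δ - Σ gⱼ θⱼ) / α replaces δ.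

module Submission where

open import Defs
open import Level using (0ℓ)
open import Algebra.Bundles using (CommutativeRing; CommutativeMonoid)
import Algebra.Properties.AbelianGroup
import Algebra.Properties.CommutativeSemigroup
import Algebra.Properties.CommutativeSemiring.Exp
import Algebra.Properties.Ring
import Algebra.Properties.Semiring.Exp
import Algebra.Properties.Semiring.Mult.TCOptimised
import Algebra.Solver.Ring
open import Algebra.Solver.Ring.AlmostCommutativeRing
  using (fromCommutativeRing; _-Raw-AlmostCommutative⟶_; Induced-equivalence)
open import Data.Bool using (Bool; true; false; if_then_else_; not; _∧_; _∨_) renaming (_≟_ to _B≟_)
open import Data.Empty using (⊥; ⊥-elim)
open import Data.Fin using (Fin; zero; suc; punchIn; punchOut)
import Data.Fin.Properties as Finₚ
open import Data.Fin.Properties using () renaming (_≟_ to _≟F_)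
open import Data.Integer as ℤ using (ℤ; +_; -[1+_]; _⊖_)
import Data.Integer.Properties as ℤₚ
open import Data.List as L
  using (List; []; _∷_; _++_; map; foldr; filter; concatMap; allFin; upTo; length; replicate)
import Data.List.Properties as Lₚ
open import Data.List.Membership.Propositional using (_∈_; _∉_)
import Data.List.Membership.Propositional.Properties as ∈ₚ
open import Data.List.Membership.Propositional.Properties.WithK using (unique∧set⇒bag)
open import Data.List.Relation.Binary.BagAndSetEquality using (∼bag⇒↭)
open import Data.List.Relation.Binary.Permutation.Propositional as ↭ using (_↭_)
import Data.List.Relation.Binary.Permutation.Propositional.Properties as ↭ₚ
open import Data.List.Relation.Unary.All as All using (All; []; _∷_)
import Data.List.Relation.Unary.All.Properties as Allₚ
open import Data.List.Relation.Unary.AllPairs as AllPairs using (AllPairs; []; _∷_)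
import Data.List.Relation.Unary.AllPairs.Properties as AllPairsₚ
open import Data.List.Relation.Unary.Any using (here; there)
import Data.List.Relation.Unary.Unique.DecPropositional.Properties as DecUₚ
open import Data.List.Relation.Unary.Unique.Propositional using (Unique)
import Data.List.Relation.Unary.Unique.Propositional.Properties as Uₚ
open import Data.Maybe using (just; nothing)
open import Data.Nat as ℕ using (ℕ; zero; suc; _≤_; _<_; z≤n; s≤s; _∸_; _⊔_)
import Data.Nat.Properties as ℕₚ
open import Data.Product using (Σ-syntax; _×_; _,_; proj₁; proj₂)
open import Data.Rational.Unnormalised as Q using (mkℚᵘ; *≡*; _≃_; 0ℚᵘ)
open import Data.Sum using (_⊎_; inj₁; inj₂)
open import Data.Vec as V using (Vec; []; _∷_; lookup; tabulate; zipWith)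
import Data.Vec.Properties as Vₚ
open import Function using (_∘_; id)
open import Function.Bundles using (mk⇔; Inverse)
open import Relation.Binary.Definitions using (DecidableEquality; WeaklyDecidable)
open import Relation.Binary.PropositionalEquality as ≡ using (_≡_; _≢_; cong; cong₂; subst; subst₂)
import Relation.Binary.Reasoning.Setoid
open import Relation.Nullary using (¬_; yes; no; does; Dec; ¬?)
open import Relation.Nullary.Decidable using (decidable-stable)

-- Restriction to ker α is carried out on the dual side. Modulo α every form has a unique
-- representative without x_p, where α_p ≠ 0, and the codimension two condition says that the span
-- of any two independent forms contains a form of the arrangement. This condition survives adding
-- hyperplanes, so it holds at every stage between the full arrangement and the given one. The θⱼ
-- with j < ℓ-1 lie in D of every arrangement because v divides v^(q^j). Only δ changes, and each
-- deletion lowers its degree by one, which produces the last exponent. That the new family still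
-- generates rests on uniqueness of interpolation on ker α: if Σ kⱼ θⱼ (j < ℓ-1) is divisible by α,
-- so is each kⱼ. Unique factorisation is avoided. The substitution that solves α = 0 for x_p has
-- exactly the multiples of α as its kernel, so divisibility by linear forms and their coprimality
-- become equations. `LinearForms` collects these facts together with the grading.

-- Coefficients in ℤ have a decidable zero, which the solver needs in order to cancel terms.
module IntegerSolver (R : CommutativeRing 0ℓ 0ℓ) where
  open CommutativeRing R
  open Algebra.Properties.Ring ring using (-‿distribˡ-*; -‿distribʳ-*; -0#≈0#; -‿involutive)
  open Algebra.Properties.AbelianGroup +-abelianGroup using (⁻¹-∙-comm)
  open Algebra.Properties.Semiring.Mult.TCOptimised semiring using (1+×; ×-homo-+; ×1-homo-*) renaming (_×_ to _×′_)
  open Relation.Binary.Reasoning.Setoid setoid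

  ⟦_⟧ᶻ : ℤ → Carrier
  ⟦ + n ⟧ᶻ = n ×′ 1#
  ⟦ -[1+ n ] ⟧ᶻ = - (suc n ×′ 1#)

  ⟦⟧-⊖ : ∀ m n → ⟦ m ⊖ n ⟧ᶻ ≈ m ×′ 1# + - (n ×′ 1#)
  ⟦⟧-⊖ zero zero = sym (trans (+-identityˡ _) -0#≈0#)
  ⟦⟧-⊖ zero (suc n) = sym (+-identityˡ _)
  ⟦⟧-⊖ (suc m) zero = sym (trans (+-congˡ -0#≈0#) (+-identityʳ _))
  ⟦⟧-⊖ (suc m) (suc n) = begin
    ⟦ suc m ⊖ suc n ⟧ᶻ ≡⟨ cong ⟦_⟧ᶻ (ℤₚ.[1+m]⊖[1+n]≡m⊖n m n) ⟩
    ⟦ m ⊖ n ⟧ᶻ ≈⟨ ⟦⟧-⊖ m n ⟩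
    m ×′ 1# + - (n ×′ 1#) ≈⟨ +-congˡ (+-identityˡ _) ⟨
    m ×′ 1# + (0# + - (n ×′ 1#)) ≈⟨ +-congˡ (+-congʳ (-‿inverseʳ 1#)) ⟨
    m ×′ 1# + (1# + - 1# + - (n ×′ 1#)) ≈⟨ +-congˡ (+-assoc _ _ _) ⟩
    m ×′ 1# + (1# + (- 1# + - (n ×′ 1#))) ≈⟨ +-assoc _ _ _ ⟨
    (m ×′ 1# + 1#) + (- 1# + - (n ×′ 1#)) ≈⟨ +-cong (+-comm _ _) (⁻¹-∙-comm _ _) ⟩
    (1# + m ×′ 1#) + - (1# + n ×′ 1#) ≈⟨ +-cong (1+× m 1#) (-‿cong (1+× n 1#)) ⟨
    suc m ×′ 1# + - (suc n ×′ 1#) ∎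

  ⟦⟧-+ : ∀ i j → ⟦ i ℤ.+ j ⟧ᶻ ≈ ⟦ i ⟧ᶻ + ⟦ j ⟧ᶻ
  ⟦⟧-+ (+ m) (+ n) = ×-homo-+ 1# m n
  ⟦⟧-+ (+ m) -[1+ n ] = ⟦⟧-⊖ m (suc n)
  ⟦⟧-+ -[1+ m ] (+ n) = trans (⟦⟧-⊖ n (suc m)) (+-comm _ _)
  ⟦⟧-+ -[1+ m ] -[1+ n ] = begin
    - (suc (suc (m ℕ.+ n)) ×′ 1#) ≡⟨ cong (λ k → - (k ×′ 1#)) (cong suc (ℕₚ.+-suc m n)) ⟨
    - ((suc m ℕ.+ suc n) ×′ 1#) ≈⟨ -‿cong (×-homo-+ 1# (suc m) (suc n)) ⟩
    - (suc m ×′ 1# + suc n ×′ 1#) ≈⟨ ⁻¹-∙-comm _ _ ⟨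
    - (suc m ×′ 1#) + - (suc n ×′ 1#) ∎

  ⟦⟧-neg : ∀ i → ⟦ ℤ.- i ⟧ᶻ ≈ - ⟦ i ⟧ᶻ
  ⟦⟧-neg (+ zero) = sym -0#≈0#
  ⟦⟧-neg (+ suc n) = refl
  ⟦⟧-neg -[1+ n ] = sym (-‿involutive _)

  ⟦⟧-*⁺ : ∀ m j → ⟦ (+ m) ℤ.* j ⟧ᶻ ≈ (m ×′ 1#) * ⟦ j ⟧ᶻ
  ⟦⟧-*⁺ m (+ n) = trans (reflexive (cong ⟦_⟧ᶻ (ℤₚ.+◃n≡+n (m ℕ.* n)))) (×1-homo-* m n)
  ⟦⟧-*⁺ m -[1+ n ] = begin
    ⟦ (+ m) ℤ.* -[1+ n ] ⟧ᶻ ≡⟨ cong ⟦_⟧ᶻ (ℤₚ.-◃n≡-n (m ℕ.* suc n)) ⟩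
    ⟦ ℤ.- (+ (m ℕ.* suc n)) ⟧ᶻ ≈⟨ ⟦⟧-neg (+ (m ℕ.* suc n)) ⟩
    - ((m ℕ.* suc n) ×′ 1#) ≈⟨ -‿cong (×1-homo-* m (suc n)) ⟩
    - ((m ×′ 1#) * (suc n ×′ 1#)) ≈⟨ -‿distribʳ-* _ _ ⟩
    (m ×′ 1#) * - (suc n ×′ 1#) ∎

  ⟦⟧-* : ∀ i j → ⟦ i ℤ.* j ⟧ᶻ ≈ ⟦ i ⟧ᶻ * ⟦ j ⟧ᶻ
  ⟦⟧-* (+ m) j = ⟦⟧-*⁺ m j
  ⟦⟧-* -[1+ m ] j = begin
    ⟦ -[1+ m ] ℤ.* j ⟧ᶻ ≡⟨ cong ⟦_⟧ᶻ (ℤₚ.neg-distribˡ-* (+ suc m) j) ⟨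
    ⟦ ℤ.- ((+ suc m) ℤ.* j) ⟧ᶻ ≈⟨ ⟦⟧-neg ((+ suc m) ℤ.* j) ⟩
    - ⟦ (+ suc m) ℤ.* j ⟧ᶻ ≈⟨ -‿cong (⟦⟧-*⁺ (suc m) j) ⟩
    - ((suc m ×′ 1#) * ⟦ j ⟧ᶻ) ≈⟨ -‿distribˡ-* _ _ ⟩
    - (suc m ×′ 1#) * ⟦ j ⟧ᶻ ∎

  morphism : ℤ.+-*-rawRing -Raw-AlmostCommutative⟶ fromCommutativeRing R
  morphism = record
    { ⟦_⟧ = ⟦_⟧ᶻ ; +-homo = ⟦⟧-+ ; *-homo = ⟦⟧-* ; -‿homo = ⟦⟧-neg
    ; 0-homo = refl ; 1-homo = refl }

  weaklyDecidable : WeaklyDecidable (Induced-equivalence morphism)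
  weaklyDecidable i j with i ℤ.≟ j
  ... | yes eq = just (reflexive (cong ⟦_⟧ᶻ eq))
  ... | no _ = nothing

  open Algebra.Solver.Ring ℤ.+-*-rawRing (fromCommutativeRing R) morphism weaklyDecidable public
    using (solve; _:=_; _:+_; _:*_; _:-_; :-_; con)

-- Finite lists, and sums and products over them.

unique-↭ : {A : Set} {xs ys : List A} → Unique xs → Unique ys →
  (∀ {x} → x ∈ xs → x ∈ ys) → (∀ {x} → x ∈ ys → x ∈ xs) → xs ↭ ys
unique-↭ u v f g = ∼bag⇒↭ (unique∧set⇒bag u v (mk⇔ f g))

unique-⊆-length : {A : Set} → DecidableEquality A → {xs ys : List A} → Unique xs → Unique ys →
  (∀ {x} → x ∈ xs → x ∈ ys) → length xs ≤ length ys
unique-⊆-length _≟_ {xs} {ys} u v xs⊆ys = subst (_≤ length ys)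
  (≡.sym (↭ₚ.↭-length (unique-↭ u (Uₚ.filter⁺ (_∈? xs) v)
    (λ x∈ → ∈ₚ.∈-filter⁺ (_∈? xs) (xs⊆ys x∈) x∈) (λ x∈ → proj₂ (∈ₚ.∈-filter⁻ (_∈? xs) {xs = ys} x∈)))))
  (Lₚ.length-filter (_∈? xs) ys)
  where open import Data.List.Membership.DecPropositional _≟_ using (_∈?_)

module BigOp (M : CommutativeMonoid 0ℓ 0ℓ) where
  open CommutativeMonoid M
  open Algebra.Properties.CommutativeSemigroup commutativeSemigroup using (interchange; x∙yz≈y∙xz)

  module _ {A : Set} where
    ⨁ : List A → (A → Carrier) → Carrier
    ⨁ xs f = foldr (λ x acc → f x ∙ acc) ε xs

    ⨁-cong-∈ : ∀ xs {f g : A → Carrier} → (∀ x → x ∈ xs → f x ≈ g x) → ⨁ xs f ≈ ⨁ xs g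
    ⨁-cong-∈ [] h = refl
    ⨁-cong-∈ (x ∷ xs) h = ∙-cong (h x (here ≡.refl)) (⨁-cong-∈ xs λ y y∈ → h y (there y∈))

    ⨁-cong : ∀ xs {f g : A → Carrier} → (∀ x → f x ≈ g x) → ⨁ xs f ≈ ⨁ xs g
    ⨁-cong xs h = ⨁-cong-∈ xs λ x _ → h x

    ⨁-ε : ∀ xs → ⨁ xs (λ _ → ε) ≈ ε
    ⨁-ε [] = refl
    ⨁-ε (x ∷ xs) = trans (identityˡ _) (⨁-ε xs)

    ⨁-++ : ∀ xs ys (f : A → Carrier) → ⨁ (xs ++ ys) f ≈ ⨁ xs f ∙ ⨁ ys f
    ⨁-++ [] ys f = sym (identityˡ _)
    ⨁-++ (x ∷ xs) ys f = trans (∙-congˡ (⨁-++ xs ys f)) (sym (assoc _ _ _))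

    ⨁-∙ : ∀ xs (f g : A → Carrier) → ⨁ xs (λ x → f x ∙ g x) ≈ ⨁ xs f ∙ ⨁ xs g
    ⨁-∙ [] f g = sym (identityˡ _)
    ⨁-∙ (x ∷ xs) f g = trans (∙-congˡ (⨁-∙ xs f g)) (interchange _ _ _ _)

    ⨁-↭ : ∀ {xs ys} → xs ↭ ys → (f : A → Carrier) → ⨁ xs f ≈ ⨁ ys f
    ⨁-↭ ↭.refl f = refl
    ⨁-↭ (↭.prep x p) f = ∙-congˡ (⨁-↭ p f)
    ⨁-↭ (↭.swap x y p) f = trans (∙-congˡ (∙-congˡ (⨁-↭ p f))) (x∙yz≈y∙xz _ _ _)
    ⨁-↭ (↭.trans p p′) f = trans (⨁-↭ p f) (⨁-↭ p′ f)

  ⨁-map : ∀ {A B : Set} (h : A → B) xs (f : B → Carrier) → ⨁ (map h xs) f ≡ ⨁ xs (f ∘ h)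
  ⨁-map h [] f = ≡.refl
  ⨁-map h (x ∷ xs) f = cong (f (h x) ∙_) (⨁-map h xs f)

  ⨁-suc : ∀ {k} (f : Fin (suc k) → Carrier) → ⨁ (L.tabulate suc) f ≈ ⨁ (allFin k) (f ∘ suc)
  ⨁-suc {k} f = reflexive (≡.trans (cong (λ xs → ⨁ xs f) (≡.sym (Lₚ.map-tabulate id suc))) (⨁-map suc (allFin k) f))

  ⨁-concatMap : ∀ {A B : Set} (h : A → List B) xs (f : B → Carrier) →
    ⨁ (concatMap h xs) f ≈ ⨁ xs (λ x → ⨁ (h x) f)
  ⨁-concatMap h [] f = refl
  ⨁-concatMap h (x ∷ xs) f = trans (⨁-++ (h x) (concatMap h xs) f) (∙-congˡ (⨁-concatMap h xs f))

  ⨁-swap : ∀ {A B : Set} (xs : List A) (ys : List B) (f : A → B → Carrier) →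
    ⨁ xs (λ x → ⨁ ys (f x)) ≈ ⨁ ys (λ y → ⨁ xs (λ x → f x y))
  ⨁-swap [] ys f = sym (⨁-ε ys)
  ⨁-swap (x ∷ xs) ys f = trans (∙-congˡ (⨁-swap xs ys f)) (sym (⨁-∙ ys (f x) _))

module BigSum (R : CommutativeRing 0ℓ 0ℓ) where
  open CommutativeRing R
  open BigOp +-commutativeMonoid public

  ⨁-distribˡ : ∀ {A : Set} (xs : List A) c (f : A → Carrier) → c * ⨁ xs f ≈ ⨁ xs (λ x → c * f x)
  ⨁-distribˡ [] c f = zeroʳ c
  ⨁-distribˡ (x ∷ xs) c f = trans (distribˡ _ _ _) (+-congˡ (⨁-distribˡ xs c f))

  ⨁-distribʳ : ∀ {A : Set} (xs : List A) c (f : A → Carrier) → ⨁ xs f * c ≈ ⨁ xs (λ x → f x * c)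
  ⨁-distribʳ xs c f = trans (*-comm _ _) (trans (⨁-distribˡ xs c f) (⨁-cong xs λ x → *-comm _ _))

  module _ {A : Set} (_≟_ : DecidableEquality A) where
    ⨁-kronecker : ∀ {U} → Unique U → ∀ {x} → x ∈ U → (f : A → Carrier) →
      ⨁ U (λ y → if does (y ≟ x) then f y else 0#) ≈ f x
    ⨁-kronecker {y ∷ U} (y∉ ∷ u) {x} x∈ f with y ≟ x
    ... | yes ≡.refl = trans (+-congˡ (trans (⨁-cong-∈ U vanish) (⨁-ε U))) (+-identityʳ _)
      where
        vanish : ∀ z → z ∈ U → (if does (z ≟ y) then f z else 0#) ≈ 0#
        vanish z z∈ with z ≟ y
        ... | yes e = ⊥-elim (All.lookup y∉ z∈ (≡.sym e))
        ... | no _ = refl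
    ⨁-kronecker {y ∷ U} (y∉ ∷ u) (here e) f | no ne = ⊥-elim (ne (≡.sym e))
    ⨁-kronecker {y ∷ U} (y∉ ∷ u) (there x∈) f | no ne = trans (+-identityˡ _) (⨁-kronecker u x∈ f)

-- Arithmetic and enumeration of the finite field.

module Field {q : ℕ} (𝔽 : FiniteField q) where
  open FiniteField 𝔽 public
  open Over 𝔽 public

  fieldRing : CommutativeRing 0ℓ 0ℓ
  fieldRing = record { isCommutativeRing = isCommutativeRing }

  open CommutativeRing fieldRing public
    using (+-assoc; +-comm; +-identityˡ; +-identityʳ; -‿inverseʳ; -‿inverseˡ; *-assoc; *-comm;
           *-identityˡ; *-identityʳ; distribˡ; distribʳ; zeroˡ; zeroʳ; semiring; commutativeSemiring;
           *-commutativeMonoid)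
  module F-Solver = IntegerSolver fieldRing
  open Algebra.Properties.Semiring.Exp semiring public using (_^_)

  inv : ∀ x → x ≢ 0# → Carrier
  inv x x≢0 = proj₁ (inverse x x≢0)

  x*inv : ∀ x (x≢0 : x ≢ 0#) → x * inv x x≢0 ≡ 1#
  x*inv x x≢0 = proj₂ (inverse x x≢0)

  *-cancel-0 : ∀ {x y} → x ≢ 0# → x * y ≡ 0# → y ≡ 0#
  *-cancel-0 {x} {y} x≢0 xy≡0 = begin
    y ≡⟨ *-identityˡ y ⟨
    1# * y ≡⟨ cong (_* y) (x*inv x x≢0) ⟨
    x * inv x x≢0 * y ≡⟨ solve 3 (λ x i y → x :* i :* y := i :* (x :* y)) ≡.refl x (inv x x≢0) y ⟩
    inv x x≢0 * (x * y) ≡⟨ cong (inv x x≢0 *_) xy≡0 ⟩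
    inv x x≢0 * 0# ≡⟨ zeroʳ _ ⟩
    0# ∎
    where open ≡.≡-Reasoning
          open F-Solver

  *-≢0 : ∀ {x y} → x ≢ 0# → y ≢ 0# → x * y ≢ 0#
  *-≢0 x≢0 y≢0 xy≡0 = y≢0 (*-cancel-0 x≢0 xy≡0)

  inv≢0 : ∀ x (x≢0 : x ≢ 0#) → inv x x≢0 ≢ 0#
  inv≢0 x x≢0 i≡0 = 0≢1 (≡.trans (≡.sym (zeroʳ x)) (≡.trans (cong (x *_) (≡.sym i≡0)) (x*inv x x≢0)))

  -‿cancel : ∀ {x y} → x + - y ≡ 0# → x ≡ y
  -‿cancel {x} {y} e = begin
    x ≡⟨ solve 2 (λ x y → x := (x :+ :- y) :+ y) ≡.refl x y ⟩
    (x + - y) + y ≡⟨ cong (_+ y) e ⟩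
    0# + y ≡⟨ +-identityˡ y ⟩
    y ∎
    where open ≡.≡-Reasoning
          open F-Solver

  *-cancelˡ : ∀ {x y z} → x ≢ 0# → x * y ≡ x * z → y ≡ z
  *-cancelˡ {x} {y} {z} x≢0 e = -‿cancel (*-cancel-0 x≢0 (≡.trans
    (solve 3 (λ x y z → x :* (y :+ :- z) := x :* y :+ :- (x :* z)) ≡.refl x y z)
    (≡.trans (cong (_+ - (x * z)) e) (-‿inverseʳ _))))
    where open F-Solver

  open Inverse enumeration using (to; from; strictlyInverseˡ; strictlyInverseʳ)

  elems-complete : ∀ x → x ∈ elems
  elems-complete x = subst (_∈ elems) (strictlyInverseˡ x) (∈ₚ.∈-map⁺ to (∈ₚ.∈-allFin (from x)))

  elems-unique : Unique elems
  elems-unique = Uₚ.map⁺ (λ {x} {y} e → ≡.trans (≡.sym (strictlyInverseʳ x)) (≡.trans (cong from e) (strictlyInverseʳ y)))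
                   (Uₚ.allFin⁺ q)

  length-elems : length elems ≡ q
  length-elems = ≡.trans (Lₚ.length-map to (allFin q)) (Lₚ.length-tabulate id)

  elems-↭ : (f g : Carrier → Carrier) → (∀ x → f (g x) ≡ x) → (∀ x → g (f x) ≡ x) → map f elems ↭ elems
  elems-↭ f g fg gf = unique-↭ (Uₚ.map⁺ (λ {x} {y} e → ≡.trans (≡.sym (gf x)) (≡.trans (cong g e) (gf y))) elems-unique)
    elems-unique (λ _ → elems-complete _)
    (λ {x} _ → subst (_∈ map f elems) (fg x) (∈ₚ.∈-map⁺ f (elems-complete (g x))))

  private
    ≢0? : (x : Carrier) → Dec (x ≢ 0#)
    ≢0? x = ¬? (x ≟ 0#)

    E′ : List Carrier
    E′ = filter ≢0? elems

    ∈E′⇒≢0 : ∀ {x} → x ∈ E′ → x ≢ 0#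
    ∈E′⇒≢0 x∈ = proj₂ (∈ₚ.∈-filter⁻ ≢0? {xs = elems} x∈)

    ≢0⇒∈E′ : ∀ {x} → x ≢ 0# → x ∈ E′
    ≢0⇒∈E′ x≢0 = ∈ₚ.∈-filter⁺ ≢0? (elems-complete _) x≢0

    E′-unique : Unique E′
    E′-unique = Uₚ.filter⁺ ≢0? elems-unique

    split : ∀ x → x ∈ 0# ∷ E′
    split x with x ≟ 0#
    ... | yes e = here e
    ... | no ne = there (≢0⇒∈E′ ne)

    0∷E′-unique : Unique (0# ∷ E′)
    0∷E′-unique = All.tabulate (λ x∈ e → ∈E′⇒≢0 x∈ (≡.sym e)) ∷ E′-unique

    1+length-E′ : suc (length E′) ≡ q
    1+length-E′ = ≡.trans (≡.sym (↭ₚ.↭-length (unique-↭ elems-unique 0∷E′-unique (λ _ → split _) (λ _ → elems-complete _)))) length-elems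

    module Prod = BigOp *-commutativeMonoid
    open Prod using (⨁; ⨁-↭; ⨁-map)

    scale-↭ : ∀ c → c ≢ 0# → map (c *_) E′ ↭ E′
    scale-↭ c c≢0 = unique-↭ (Uₚ.map⁺ (*-cancelˡ c≢0) E′-unique) E′-unique to′ from′
      where
        to′ : ∀ {x} → x ∈ map (c *_) E′ → x ∈ E′
        to′ x∈ with ∈ₚ.∈-map⁻ (c *_) x∈
        ... | y , y∈ , ≡.refl = ≢0⇒∈E′ (*-≢0 c≢0 (∈E′⇒≢0 y∈))
        from′ : ∀ {x} → x ∈ E′ → x ∈ map (c *_) E′
        from′ {x} x∈ = subst (_∈ map (c *_) E′)
          (≡.trans (≡.sym (*-assoc _ _ _)) (≡.trans (cong (_* x) (x*inv c c≢0)) (*-identityˡ x)))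
          (∈ₚ.∈-map⁺ (c *_) (≢0⇒∈E′ (*-≢0 (inv≢0 c c≢0) (∈E′⇒≢0 x∈))))

    ⨁-scale : ∀ c xs → ⨁ xs (c *_) ≡ c ^ length xs * ⨁ xs id
    ⨁-scale c [] = ≡.sym (*-identityˡ 1#)
    ⨁-scale c (x ∷ xs) = ≡.trans (cong (c * x *_) (⨁-scale c xs))
      (solve 4 (λ c x p s → c :* x :* (p :* s) := c :* p :* (x :* s)) ≡.refl c x _ _)
      where open F-Solver

    ⨁≢0 : ∀ xs → (∀ {x} → x ∈ xs → x ≢ 0#) → ⨁ xs id ≢ 0#
    ⨁≢0 [] h e = 0≢1 (≡.sym e)
    ⨁≢0 (x ∷ xs) h = *-≢0 (h (here ≡.refl)) (⨁≢0 xs (h ∘ there))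

    -- Multiplication by `c` permutes the nonzero elements, so it leaves their product unchanged
    -- while contributing one factor `c` for each of them; the product is nonzero and cancels.
    c^|E′| : ∀ c → c ≢ 0# → c ^ length E′ ≡ 1#
    c^|E′| c c≢0 = *-cancelˡ (⨁≢0 E′ ∈E′⇒≢0) (begin
      ⨁ E′ id * c ^ length E′ ≡⟨ *-comm _ _ ⟩
      c ^ length E′ * ⨁ E′ id ≡⟨ ⨁-scale c E′ ⟨
      ⨁ E′ (c *_) ≡⟨ ⨁-map (c *_) E′ id ⟨
      ⨁ (map (c *_) E′) id ≡⟨ ⨁-↭ (scale-↭ c c≢0) id ⟩
      ⨁ E′ id ≡⟨ *-identityʳ _ ⟨
      ⨁ E′ id * 1# ∎)
      where open ≡.≡-Reasoning

  fermat : ∀ c → c ^ q ≡ c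
  fermat c with c ≟ 0#
  ... | yes ≡.refl = ≡.trans (cong (0# ^_) (≡.sym 1+length-E′)) (zeroˡ _)
  ... | no c≢0 = ≡.trans (cong (c ^_) (≡.sym 1+length-E′)) (≡.trans (cong (c *_) (c^|E′| c c≢0)) (*-identityʳ c))

  -- `E′` contains `1#` and is therefore nonempty. The shape `suc (suc m)` is what T^q - T needs:
  -- its lower coefficients are 0, -1 and then m zeros.
  2≤q : Σ[ m ∈ ℕ ] q ≡ suc (suc m)
  2≤q with E′ | ≢0⇒∈E′ (λ e → 0≢1 (≡.sym e)) | 1+length-E′
  ... | _ ∷ xs | _ | e = length xs , ≡.sym e

  -- 1 + q + ... + q^(k-1), which is both the number of hyperplanes of F_q^k and the sum of the
  -- degrees of the first k derivations θⱼ.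
  geometric : ℕ → ℕ
  geometric zero = 0
  geometric (suc k) = geometric k ℕ.+ q ℕ.^ k

  0<q : 0 < q
  0<q = subst (0 <_) (≡.sym (proj₂ 2≤q)) (s≤s z≤n)

  vecsOver-product : ∀ {A : Set} (xs : List A) k → vecsOver xs (suc k) ≡ L.cartesianProductWith _∷_ xs (vecsOver xs k)
  vecsOver-product {A} xs k = go xs
    where
      go : ∀ ys → concatMap (λ x → map (x ∷_) (vecsOver xs k)) ys ≡ L.cartesianProductWith _∷_ ys (vecsOver xs k)
      go [] = ≡.refl
      go (y ∷ ys) = cong (map (y ∷_) (vecsOver xs k) ++_) (go ys)

  vecsOver-unique : ∀ {A : Set} {xs : List A} → Unique xs → ∀ k → Unique (vecsOver xs k)
  vecsOver-unique u zero = [] ∷ []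
  vecsOver-unique {xs = xs} u (suc k) = subst Unique (≡.sym (vecsOver-product xs k))
    (Uₚ.cartesianProductWith⁺ _∷_ (λ e → Vₚ.∷-injectiveˡ e , Vₚ.∷-injectiveʳ e) u (vecsOver-unique u k))

  vecsOver-complete : ∀ {A : Set} {xs : List A} {k} (v : Vec A k) → (∀ i → lookup v i ∈ xs) → v ∈ vecsOver xs k
  vecsOver-complete [] h = here ≡.refl
  vecsOver-complete {xs = xs} {suc k} (x ∷ v) h = subst (x ∷ v ∈_) (≡.sym (vecsOver-product xs k))
    (∈ₚ.∈-cartesianProductWith⁺ _∷_ (h zero) (vecsOver-complete v (h ∘ suc)))

  allVecs-unique : ∀ k → Unique (allVecs k)
  allVecs-unique = vecsOver-unique elems-unique

  allVecs-complete : ∀ {k} (v : Vect k) → v ∈ allVecs k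
  allVecs-complete v = vecsOver-complete v (λ i → elems-complete _)

-- Algebras over the field, and additivity of the Frobenius map.

-- The structure map of an algebra over the field. The polynomial ring and the field itself are both
-- instances, so functionals and substitutions are developed once for values in either.
record Scalars {q : ℕ} (𝔽 : FiniteField q) (R : CommutativeRing 0ℓ 0ℓ) : Set where
  private
    module F = FiniteField 𝔽
    module R = CommutativeRing R
  open R using (_≈_)
  field
    C : F.Carrier → R.Carrier
    C-+ : ∀ x y → C (x F.+ y) ≈ C x R.+ C y
    C-* : ∀ x y → C (x F.* y) ≈ C x R.* C y
    C-0 : C F.0# ≈ R.0#
    C-1 : C F.1# ≈ R.1#

  C-neg : ∀ x → C (F.- x) ≈ R.- C x
  C-neg x = uniqueˡ-⁻¹ (C (F.- x)) (C x)
    (R.trans (R.sym (C-+ _ _)) (R.trans (R.reflexive (cong C (-‿inverseˡ x))) C-0))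
    where open Algebra.Properties.AbelianGroup R.+-abelianGroup renaming (inverseˡ-unique to uniqueˡ-⁻¹)
          open Field 𝔽 using (-‿inverseˡ)

module Frobenius {q : ℕ} (𝔽 : FiniteField q) (R : CommutativeRing 0ℓ 0ℓ) (scalars : Scalars 𝔽 R) where
  open Scalars scalars
  open CommutativeRing R
  open IntegerSolver R
  open Algebra.Properties.Semiring.Exp (CommutativeRing.semiring R)
  open Algebra.Properties.CommutativeSemiring.Exp (CommutativeRing.commutativeSemiring R) using (^-distrib-*)
  open Relation.Binary.Reasoning.Setoid setoid
  private module F = Field 𝔽
  open BigOp *-commutativeMonoid renaming (⨁ to ∏; ⨁-cong to ∏-cong; ⨁-↭ to ∏-↭; ⨁-map to ∏-map)

  -- The monic form X^d + Σ pᵢ X^i Y^(d-i), where p lists the d lower coefficients, constant one first.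
  form : List F.Carrier → Carrier → Carrier → Carrier
  form [] X Y = 1#
  form (a ∷ p) X Y = X * form p X Y + C a * Y ^ suc (length p)

  value : List F.Carrier → F.Carrier → F.Carrier
  value [] r = F.1#
  value (a ∷ p) r = r F.* value p r F.+ a

  -- Synthetic division of p by T - r; the head of the result is the value p(r).
  quotient : F.Carrier → List F.Carrier → List F.Carrier
  quotient r [] = []
  quotient r (a ∷ []) = []
  quotient r (a ∷ p@(_ ∷ _)) = value p r ∷ quotient r p

  length-quotient : ∀ r a p → length (quotient r (a ∷ p)) ≡ length p
  length-quotient r a [] = ≡.refl
  length-quotient r a (b ∷ p) = cong suc (length-quotient r b p)

  form-quotient : ∀ r a p X Y → form (a ∷ p) X Y ≈
    (X - C r * Y) * form (quotient r (a ∷ p)) X Y + C (value (a ∷ p) r) * Y ^ suc (length p)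
  form-quotient r a [] X Y = begin
    X * 1# + C a * (Y * 1#)
      ≈⟨ solve 4 (λ X Y a r → X :* con (+ 1) :+ a :* (Y :* con (+ 1)) := (X :- r :* Y) :* con (+ 1) :+ (r :* con (+ 1) :+ a) :* (Y :* con (+ 1))) refl X Y (C a) (C r) ⟩
    (X - C r * Y) * 1# + (C r * 1# + C a) * (Y * 1#)
      ≈⟨ +-congˡ (*-congʳ (trans (C-+ _ _) (+-congʳ (trans (C-* _ _) (*-congˡ C-1))))) ⟨
    (X - C r * Y) * 1# + C (r F.* F.1# F.+ a) * (Y * 1#) ∎
  form-quotient r a p@(b ∷ p′) X Y = begin
    X * form p X Y + C a * (Y * Y ^ length p)
      ≈⟨ +-congʳ (*-congˡ (form-quotient r b p′ X Y)) ⟩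
    X * ((X - C r * Y) * Q + v * Z) + C a * (Y * Z)
      ≈⟨ solve 7 (λ X Y Z Q v a r → X :* ((X :- r :* Y) :* Q :+ v :* Z) :+ a :* (Y :* Z)
            := (X :- r :* Y) :* (X :* Q :+ v :* Z) :+ (r :* v :+ a) :* (Y :* Z)) refl X Y Z Q v (C a) (C r) ⟩
    (X - C r * Y) * (X * Q + v * Z) + (C r * v + C a) * (Y * Z)
      ≈⟨ +-cong (*-congˡ (+-congˡ (*-congˡ (reflexive (cong (λ n → Y ^ suc n) (≡.sym (length-quotient r b p′)))))))
                (*-congʳ (sym (trans (C-+ _ _) (+-congʳ (C-* _ _))))) ⟩
    (X - C r * Y) * form (quotient r (a ∷ p)) X Y + C (value (a ∷ p) r) * Y ^ suc (length p) ∎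
    where Q = form (quotient r p) X Y
          v = C (value p r)
          Z = Y ^ length p

  form-replicate-0 : ∀ m X Y → form (replicate m F.0#) X Y ≈ X ^ m
  form-replicate-0 zero X Y = refl
  form-replicate-0 (suc m) X Y = begin
    X * form (replicate m F.0#) X Y + C F.0# * Y ^ suc (length (replicate m F.0#))
      ≈⟨ +-cong (*-congˡ (form-replicate-0 m X Y)) (trans (*-congʳ C-0) (zeroˡ _)) ⟩
    X * X ^ m + 0# ≈⟨ +-identityʳ _ ⟩
    X * X ^ m ∎

  value-quotient : ∀ r a p x → value (a ∷ p) x ≡ (x F.+ F.- r) F.* value (quotient r (a ∷ p)) x F.+ value (a ∷ p) r
  value-quotient r a [] x = S.solve 3 (λ r a x → x S.:* S.con (+ 1) S.:+ a S.:= (x S.:- r) S.:* S.con (+ 1) S.:+ (r S.:* S.con (+ 1) S.:+ a)) ≡.refl r a x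
    where module S = F.F-Solver
  value-quotient r a p@(b ∷ p′) x = ≡.trans (cong (λ z → x F.* z F.+ a) (value-quotient r b p′ x))
    (S.solve 5 (λ r a x Q v → x S.:* ((x S.:- r) S.:* Q S.:+ v) S.:+ a
       S.:= (x S.:- r) S.:* (x S.:* Q S.:+ v) S.:+ (r S.:* v S.:+ a)) ≡.refl r a x (value (quotient r p) x) (value p r))
    where module S = F.F-Solver

  -- The factor theorem, one root at a time: division by T - c leaves the remainder p(c) = 0, and
  -- the other elements of `cs` remain roots of the quotient since c′ - c is invertible. The
  -- cancellation happens among coefficients in the field, so R may have zero divisors.
  form-roots : ∀ cs p → length p ≡ length cs → Unique cs → (∀ {c} → c ∈ cs → value p c ≡ F.0#) →
    ∀ X Y → form p X Y ≈ ∏ cs (λ c → X - C c * Y)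
  form-roots [] [] _ _ _ X Y = refl
  form-roots (c ∷ cs) (a ∷ p) len (c∉ ∷ u) roots X Y = begin
    form (a ∷ p) X Y
      ≈⟨ form-quotient c a p X Y ⟩
    (X - C c * Y) * form (quotient c (a ∷ p)) X Y + C (value (a ∷ p) c) * Y ^ suc (length p)
      ≈⟨ +-cong (*-congˡ (form-roots cs (quotient c (a ∷ p)) (≡.trans (length-quotient c a p) (ℕₚ.suc-injective len)) u roots′ X Y))
                (trans (*-congʳ (trans (reflexive (cong C (roots (here ≡.refl)))) C-0)) (zeroˡ _)) ⟩
    (X - C c * Y) * ∏ cs (λ c → X - C c * Y) + 0#
      ≈⟨ +-identityʳ _ ⟩
    (X - C c * Y) * ∏ cs (λ c → X - C c * Y) ∎
    where
      roots′ : ∀ {x} → x ∈ cs → value (quotient c (a ∷ p)) x ≡ F.0#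
      roots′ {x} x∈ = F.*-cancel-0 (λ e → All.lookup c∉ x∈ (≡.sym (F.-‿cancel e)))
        (≡.trans (≡.sym (F.+-identityʳ _)) (≡.trans (cong ((x F.+ F.- c) F.* value (quotient c (a ∷ p)) x F.+_) (≡.sym (roots (here ≡.refl))))
          (≡.trans (≡.sym (value-quotient c a p x)) (roots (there x∈)))))

  -- The homogenised factorisation of T^q - T, which has every field element as a root by `fermat`;
  -- `p` in the proof lists its lower coefficients.
  ∏-elems : ∀ X Y → ∏ F.elems (λ c → X - C c * Y) ≈ X ^ q - X * Y ^ (q ∸ 1)
  ∏-elems X Y with F.2≤q
  ... | m , q≡ = begin
    ∏ F.elems (λ c → X - C c * Y)
      ≈⟨ form-roots F.elems p (≡.trans (cong (λ n → suc (suc n)) (Lₚ.length-replicate m)) (≡.trans (≡.sym q≡) (≡.sym F.length-elems))) F.elems-unique (λ {c} _ → root c) X Y ⟨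
    X * (X * form (replicate m F.0#) X Y + C (F.- F.1#) * Y ^ suc (length (replicate m F.0#))) + C F.0# * Y ^ suc (suc (length (replicate m F.0#)))
      ≈⟨ +-cong (*-congˡ (+-cong (*-congˡ (form-replicate-0 m X Y)) (*-cong (trans (C-neg _) (-‿cong C-1)) (reflexive (cong (λ n → Y ^ suc n) (Lₚ.length-replicate m)))))) (trans (*-congʳ C-0) (zeroˡ _)) ⟩
    X * (X * X ^ m + - 1# * Y ^ suc m) + 0#
      ≈⟨ solve 3 (λ X A B → X :* (A :+ (:- con (+ 1)) :* B) :+ con (+ 0) := X :* A :- X :* B) refl X (X ^ suc m) (Y ^ suc m) ⟩
    X ^ suc (suc m) - X * Y ^ suc m
      ≡⟨ cong (λ n → X ^ n - X * Y ^ (n ∸ 1)) q≡ ⟨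
    X ^ q - X * Y ^ (q ∸ 1) ∎
    where
      p = F.0# ∷ (F.- F.1#) ∷ replicate m F.0#
      value-replicate : ∀ m c → value (replicate m F.0#) c ≡ c F.^ m
      value-replicate zero c = ≡.refl
      value-replicate (suc m) c = ≡.trans (F.+-identityʳ _) (cong (c F.*_) (value-replicate m c))
      root : ∀ c → value p c ≡ F.0#
      root c = ≡.trans (cong (λ v → c F.* (c F.* v F.+ F.- F.1#) F.+ F.0#) (value-replicate m c))
        (≡.trans (S.solve 2 (λ c v → c S.:* (c S.:* v S.:+ S.:- S.con (+ 1)) S.:+ S.con (+ 0) S.:= c S.:* (c S.:* v) S.:+ S.:- c) ≡.refl c (c F.^ m))
          (≡.trans (cong (F._+ F.- c) (≡.trans (cong (c F.^_) (≡.sym q≡)) (F.fermat c))) (F.-‿inverseʳ c)))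
        where module S = F.F-Solver

  -- Both sides come from ∏_c (X + Y - c Y) = ∏_c (X - c Y).
  frobenius-+ : ∀ X Y → (X + Y) ^ q ≈ X ^ q + Y ^ q
  frobenius-+ X Y = begin
    (X + Y) ^ q ≈⟨ solve 3 (λ A X Yq → A := (A :- Yq) :+ Yq) refl _ X _ ⟩
    (X + Y) ^ q - (X + Y) * Y ^ (q ∸ 1) + (X + Y) * Y ^ (q ∸ 1) ≈⟨ +-congʳ (∏-elems (X + Y) Y) ⟨
    ∏ F.elems (λ c → X + Y - C c * Y) + (X + Y) * Y ^ (q ∸ 1) ≈⟨ +-congʳ shift ⟩
    ∏ F.elems (λ c → X - C c * Y) + (X + Y) * Y ^ (q ∸ 1) ≈⟨ +-congʳ (∏-elems X Y) ⟩
    X ^ q - X * Y ^ (q ∸ 1) + (X + Y) * Y ^ (q ∸ 1) ≈⟨ solve 4 (λ A X Y B → A :- X :* B :+ (X :+ Y) :* B := A :+ Y :* B) refl (X ^ q) X Y (Y ^ (q ∸ 1)) ⟩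
    X ^ q + Y * Y ^ (q ∸ 1) ≡⟨ cong (λ n → X ^ q + Y ^ n) (ℕₚ.m+[n∸m]≡n F.0<q) ⟩
    X ^ q + Y ^ q ∎
    where
      module S = F.F-Solver
      shift : ∏ F.elems (λ c → X + Y - C c * Y) ≈ ∏ F.elems (λ c → X - C c * Y)
      shift = begin
        ∏ F.elems (λ c → X + Y - C c * Y)
          ≈⟨ ∏-↭ (F.elems-↭ (F._+ F.1#) (F._+ F.- F.1#)
               (λ x → S.solve 1 (λ x → x S.:+ S.:- S.con (+ 1) S.:+ S.con (+ 1) S.:= x) ≡.refl x)
               (λ x → S.solve 1 (λ x → x S.:+ S.con (+ 1) S.:+ S.:- S.con (+ 1) S.:= x) ≡.refl x)) _ ⟨
        ∏ (map (F._+ F.1#) F.elems) (λ c → X + Y - C c * Y)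
          ≡⟨ ∏-map (F._+ F.1#) F.elems _ ⟩
        ∏ F.elems (λ c → X + Y - C (c F.+ F.1#) * Y)
          ≈⟨ ∏-cong F.elems (λ c → trans (+-congˡ (-‿cong (*-congʳ (trans (C-+ _ _) (+-congˡ C-1)))))
               (solve 3 (λ X Y c → X :+ Y :- (c :+ con (+ 1)) :* Y := X :- c :* Y) refl X Y (C c))) ⟩
        ∏ F.elems (λ c → X - C c * Y) ∎

  C-^ : ∀ c n → C (c F.^ n) ≈ C c ^ n
  C-^ c zero = C-1
  C-^ c (suc n) = trans (C-* _ _) (*-congˡ (C-^ c n))

  frobenius-* : ∀ c X → (C c * X) ^ q ≈ C c * X ^ q
  frobenius-* c X = trans (^-distrib-* _ _ q) (*-congʳ (trans (sym (C-^ c q)) (reflexive (cong C (F.fermat c)))))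

fieldScalars : ∀ {q} (𝔽 : FiniteField q) → Scalars 𝔽 (Field.fieldRing 𝔽)
fieldScalars 𝔽 = record { C = id ; C-+ = λ _ _ → ≡.refl ; C-* = λ _ _ → ≡.refl ; C-0 = ≡.refl ; C-1 = ≡.refl }

-- The polynomial ring.

module Polynomials {q : ℕ} (𝔽 : FiniteField q) {ℓ n : ℕ} (A : Fin n → Over.Vect 𝔽 ℓ) where
  open Field 𝔽 hiding (_^_)
  open Arrangement A

  _≟ₘ_ : (m m′ : Monomial) → Dec (m ≡ m′)
  _≟ₘ_ = Vₚ.≡-dec ℕ._≟_

  infixl 6 _+ₘ_
  _+ₘ_ : ∀ {k} → Vec ℕ k → Vec ℕ k → Vec ℕ k
  _+ₘ_ = zipWith ℕ._+_

  0ₘ : ∀ {k} → Vec ℕ k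
  0ₘ = V.replicate _ 0

  -- The record keeps both polynomials visible to unification, which could not recover them from the
  -- unfolded `_≈ₚ_`.
  record _≋_ (p r : Poly) : Set where
    constructor wrap
    field unwrap : p ≈ₚ r
  open _≋_ public
  infix 4 _≋_

  -- Opaque, so that unification does not unfold sums and products of polynomials.
  infixl 6 _⊞_
  infixl 7 _⊠_
  opaque
    _⊞_ _⊠_ : Poly → Poly → Poly
    _⊞_ = _++_
    _⊠_ = _*ₚ_

    ⊞-def : ∀ p r → p ⊞ r ≡ p ++ r
    ⊞-def p r = ≡.refl

    ⊠-def : ∀ p r → p ⊠ r ≡ p *ₚ r
    ⊠-def p r = ≡.refl

  -- Polynomials are equal when all linear functionals ⟪_, ψ⟫ agree on them; this turns the ring
  -- laws into identities between sums in F.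
  module Functional (R : CommutativeRing 0ℓ 0ℓ) (scalars : Scalars 𝔽 R) where
    private module R = CommutativeRing R
    open R using (_≈_)
    open Scalars scalars
    open BigSum R
    open Relation.Binary.Reasoning.Setoid R.setoid

    δ : Monomial → Monomial → R.Carrier
    δ m m′ = if does (m ≟ₘ m′) then R.1# else R.0#

    ⟪_,_⟫ : Poly → (Monomial → R.Carrier) → R.Carrier
    ⟪ p , ψ ⟫ = ⨁ p (λ t → C (proj₁ t) R.* ψ (proj₂ t))

    ⟪⟫-congʳ : ∀ p {ψ ψ′} → (∀ m → ψ m ≈ ψ′ m) → ⟪ p , ψ ⟫ ≈ ⟪ p , ψ′ ⟫
    ⟪⟫-congʳ p h = ⨁-cong p λ t → R.*-congˡ (h (proj₂ t))

    ⟪⟫-⊞ : ∀ p r ψ → ⟪ p ⊞ r , ψ ⟫ ≈ ⟪ p , ψ ⟫ R.+ ⟪ r , ψ ⟫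
    ⟪⟫-⊞ p r ψ = R.trans (R.reflexive (cong (λ z → ⟪ z , ψ ⟫) (⊞-def p r))) (⨁-++ p r _)

    ⟪⟫-⊠ : ∀ p r (ψ : Monomial → R.Carrier) → ⟪ p ⊠ r , ψ ⟫ ≈ ⟪ p , (λ m → ⟪ r , (λ m′ → ψ (m +ₘ m′)) ⟫) ⟫
    ⟪⟫-⊠ p r ψ = R.trans (R.reflexive (cong (λ z → ⟪ z , ψ ⟫) (⊠-def p r))) (R.trans (⨁-concatMap _ p _) (⨁-cong p λ t → R.trans (R.reflexive (⨁-map _ r _))
      (R.trans (⨁-cong r λ u → R.trans (R.*-congʳ (C-* _ _)) (R.*-assoc _ _ _)) (R.sym (⨁-distribˡ r _ _)))))

    ⟪⟫-*ʳ : ∀ p c ψ → ⟪ p , (λ m → c R.* ψ m) ⟫ ≈ c R.* ⟪ p , ψ ⟫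
    ⟪⟫-*ʳ p c ψ = R.trans (⨁-cong p λ t → x∙yz≈y∙xz _ _ _) (R.sym (⨁-distribˡ p c _))
      where open import Algebra.Properties.CommutativeSemigroup R.*-commutativeSemigroup using (x∙yz≈y∙xz)

    ⟪⟫-0ʳ : ∀ p {ψ} → (∀ m → ψ m ≈ R.0#) → ⟪ p , ψ ⟫ ≈ R.0#
    ⟪⟫-0ʳ p h = R.trans (⨁-cong p λ t → R.trans (R.*-congˡ (h _)) (R.zeroʳ _)) (⨁-ε p)

    ⟪⟫-swap : ∀ p r (ψ : Monomial → Monomial → R.Carrier) → ⟪ p , (λ m → ⟪ r , ψ m ⟫) ⟫ ≈ ⟪ r , (λ m′ → ⟪ p , (λ m → ψ m m′) ⟫) ⟫
    ⟪⟫-swap p r ψ = R.trans (⨁-cong p λ t → ⨁-distribˡ r _ _) (R.trans (⨁-swap p r _)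
      (⨁-cong r λ u → R.trans (⨁-cong p λ t → x∙yz≈y∙xz _ _ _) (R.sym (⨁-distribˡ p _ _))))
      where open import Algebra.Properties.CommutativeSemigroup R.*-commutativeSemigroup using (x∙yz≈y∙xz)

    C-coeff : ∀ p m → C (coeff p m) ≈ ⟪ p , δ m ⟫
    C-coeff [] m = C-0
    C-coeff ((c , m′) ∷ p) m with does (m ≟ₘ m′)
    ... | true = R.trans (C-+ _ _) (R.+-cong (R.sym (R.*-identityʳ _)) (C-coeff p m))
    ... | false = R.trans (C-coeff p m) (R.sym (R.trans (R.+-congʳ (R.zeroʳ _)) (R.+-identityˡ _)))

    expand : ∀ U → Unique U → ∀ {m} → m ∈ U → ∀ (ψ : Monomial → R.Carrier) → ⨁ U (λ m′ → δ m′ m R.* ψ m′) ≈ ψ m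
    expand U u {m} m∈ ψ = R.trans (⨁-cong U δ-*) (⨁-kronecker _≟ₘ_ u m∈ ψ)
      where
        δ-* : ∀ m′ → δ m′ m R.* ψ m′ ≈ (if does (m′ ≟ₘ m) then ψ m′ else R.0#)
        δ-* m′ with does (m′ ≟ₘ m)
        ... | true = R.*-identityˡ _
        ... | false = R.zeroˡ _

    ⟪⟫-coeff : ∀ p U → Unique U → (∀ {t} → t ∈ p → proj₂ t ∈ U) → ∀ (ψ : Monomial → R.Carrier) → ⟪ p , ψ ⟫ ≈ ⨁ U (λ m → C (coeff p m) R.* ψ m)
    ⟪⟫-coeff p U u p⊆U ψ = begin
      ⟪ p , ψ ⟫
        ≈⟨ ⨁-cong-∈ p (λ t t∈ → R.*-congˡ (expand U u (p⊆U t∈) ψ)) ⟨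
      ⨁ p (λ t → C (proj₁ t) R.* ⨁ U (λ m → δ m (proj₂ t) R.* ψ m))
        ≈⟨ ⨁-cong p (λ t → ⨁-distribˡ U _ _) ⟩
      ⨁ p (λ t → ⨁ U (λ m → C (proj₁ t) R.* (δ m (proj₂ t) R.* ψ m)))
        ≈⟨ ⨁-swap p U _ ⟩
      ⨁ U (λ m → ⨁ p (λ t → C (proj₁ t) R.* (δ m (proj₂ t) R.* ψ m)))
        ≈⟨ ⨁-cong U (λ m → R.trans (⨁-cong p λ t → R.sym (R.*-assoc _ _ _)) (R.sym (⨁-distribʳ p _ _))) ⟩
      ⨁ U (λ m → ⟪ p , δ m ⟫ R.* ψ m)
        ≈⟨ ⨁-cong U (λ m → R.*-congʳ (C-coeff p m)) ⟨
      ⨁ U (λ m → C (coeff p m) R.* ψ m) ∎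

    -- A polynomial is a list in which monomials may repeat, while `_≋_` compares coefficients.
    -- Collecting both lists over a common duplicate-free list of monomials shows that a functional
    -- sees only the coefficients.
    ⟪⟫-congˡ : ∀ {p r} → p ≋ r → ∀ (ψ : Monomial → R.Carrier) → ⟪ p , ψ ⟫ ≈ ⟪ r , ψ ⟫
    ⟪⟫-congˡ {p} {r} (wrap p≈r) ψ = begin
      ⟪ p , ψ ⟫ ≈⟨ ⟪⟫-coeff p U u (λ t∈ → ∈ₚ.∈-deduplicate⁺ _≟ₘ_ (∈ₚ.∈-++⁺ˡ (∈ₚ.∈-map⁺ proj₂ t∈))) ψ ⟩
      ⨁ U (λ m → C (coeff p m) R.* ψ m) ≈⟨ ⨁-cong U (λ m → R.*-congʳ (R.reflexive (cong C (p≈r m)))) ⟩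
      ⨁ U (λ m → C (coeff r m) R.* ψ m) ≈⟨ ⟪⟫-coeff r U u (λ t∈ → ∈ₚ.∈-deduplicate⁺ _≟ₘ_ (∈ₚ.∈-++⁺ʳ (map proj₂ p) (∈ₚ.∈-map⁺ proj₂ t∈))) ψ ⟨
      ⟪ r , ψ ⟫ ∎
      where
        U = L.deduplicate _≟ₘ_ (map proj₂ p ++ map proj₂ r)
        u = DecUₚ.deduplicate-! _≟ₘ_ (map proj₂ p ++ map proj₂ r)

  module FF = Functional fieldRing (fieldScalars 𝔽)
  open FF using (⟪_,_⟫)

  -- The functionals given by `δ m` read off the coefficients.
  ≋-ext : ∀ {p r} → (∀ (ψ : Monomial → Carrier) → ⟪ p , ψ ⟫ ≡ ⟪ r , ψ ⟫) → p ≋ r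
  ≋-ext {p} {r} h = wrap λ m → ≡.trans (FF.C-coeff p m) (≡.trans (h (FF.δ m)) (≡.sym (FF.C-coeff r m)))

  +ₘ-comm : ∀ {k} (m m′ : Vec ℕ k) → m +ₘ m′ ≡ m′ +ₘ m
  +ₘ-comm = Vₚ.zipWith-comm ℕₚ.+-comm

  +ₘ-identityˡ : ∀ {k} (m : Vec ℕ k) → 0ₘ +ₘ m ≡ m
  +ₘ-identityˡ = Vₚ.zipWith-identityˡ ℕₚ.+-identityˡ

  negₚ : Poly → Poly
  negₚ = map (λ t → (- proj₁ t , proj₂ t))

  private
    ≋-refl : ∀ {p} → p ≋ p
    ≋-refl = wrap λ m → ≡.refl

    ≋-sym : ∀ {p r} → p ≋ r → r ≋ p
    ≋-sym (wrap e) = wrap λ m → ≡.sym (e m)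

    ≋-trans : ∀ {p r s} → p ≋ r → r ≋ s → p ≋ s
    ≋-trans (wrap e) (wrap e′) = wrap λ m → ≡.trans (e m) (e′ m)

    ≡⇒≋ : ∀ {p r} → p ≡ r → p ≋ r
    ≡⇒≋ ≡.refl = ≋-refl

    module _ where
      open BigSum fieldRing
      open ≡.≡-Reasoning

      ⊠-cong : ∀ {p p′ r r′} → p ≋ p′ → r ≋ r′ → p ⊠ r ≋ p′ ⊠ r′
      ⊠-cong {p} {p′} {r} {r′} e e′ = ≋-ext λ ψ → begin
        ⟪ p ⊠ r , ψ ⟫ ≡⟨ FF.⟪⟫-⊠ p r ψ ⟩
        ⟪ p , (λ m → ⟪ r , (λ m′ → ψ (m +ₘ m′)) ⟫) ⟫ ≡⟨ FF.⟪⟫-congˡ e _ ⟩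
        ⟪ p′ , (λ m → ⟪ r , (λ m′ → ψ (m +ₘ m′)) ⟫) ⟫ ≡⟨ FF.⟪⟫-congʳ p′ (λ m → FF.⟪⟫-congˡ e′ _) ⟩
        ⟪ p′ , (λ m → ⟪ r′ , (λ m′ → ψ (m +ₘ m′)) ⟫) ⟫ ≡⟨ FF.⟪⟫-⊠ p′ r′ ψ ⟨
        ⟪ p′ ⊠ r′ , ψ ⟫ ∎

      ⊠-assoc : ∀ p r s → (p ⊠ r) ⊠ s ≋ p ⊠ (r ⊠ s)
      ⊠-assoc p r s = ≋-ext λ ψ → begin
        ⟪ (p ⊠ r) ⊠ s , ψ ⟫
          ≡⟨ FF.⟪⟫-⊠ (p ⊠ r) s ψ ⟩
        ⟪ p ⊠ r , (λ m → ⟪ s , (λ m″ → ψ (m +ₘ m″)) ⟫) ⟫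
          ≡⟨ FF.⟪⟫-⊠ p r _ ⟩
        ⟪ p , (λ m → ⟪ r , (λ m′ → ⟪ s , (λ m″ → ψ (m +ₘ m′ +ₘ m″)) ⟫) ⟫) ⟫
          ≡⟨ FF.⟪⟫-congʳ p (λ m → FF.⟪⟫-congʳ r λ m′ → FF.⟪⟫-congʳ s λ m″ → cong ψ (Vₚ.zipWith-assoc ℕₚ.+-assoc m m′ m″)) ⟩
        ⟪ p , (λ m → ⟪ r , (λ m′ → ⟪ s , (λ m″ → ψ (m +ₘ (m′ +ₘ m″))) ⟫) ⟫) ⟫
          ≡⟨ FF.⟪⟫-congʳ p (λ m → FF.⟪⟫-⊠ r s (λ m′ → ψ (m +ₘ m′))) ⟨
        ⟪ p , (λ m → ⟪ r ⊠ s , (λ m′ → ψ (m +ₘ m′)) ⟫) ⟫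
          ≡⟨ FF.⟪⟫-⊠ p (r ⊠ s) ψ ⟨
        ⟪ p ⊠ (r ⊠ s) , ψ ⟫ ∎

      ⊠-comm : ∀ p r → p ⊠ r ≋ r ⊠ p
      ⊠-comm p r = ≋-ext λ ψ → begin
        ⟪ p ⊠ r , ψ ⟫ ≡⟨ FF.⟪⟫-⊠ p r ψ ⟩
        ⟪ p , (λ m → ⟪ r , (λ m′ → ψ (m +ₘ m′)) ⟫) ⟫ ≡⟨ FF.⟪⟫-swap p r (λ m m′ → ψ (m +ₘ m′)) ⟩
        ⟪ r , (λ m′ → ⟪ p , (λ m → ψ (m +ₘ m′)) ⟫) ⟫ ≡⟨ FF.⟪⟫-congʳ r (λ m′ → FF.⟪⟫-congʳ p λ m → cong ψ (+ₘ-comm m m′)) ⟩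
        ⟪ r , (λ m′ → ⟪ p , (λ m → ψ (m′ +ₘ m)) ⟫) ⟫ ≡⟨ FF.⟪⟫-⊠ r p ψ ⟨
        ⟪ r ⊠ p , ψ ⟫ ∎

      ⊠-identityˡ : ∀ p → constₚ 1# ⊠ p ≋ p
      ⊠-identityˡ p = ≋-ext λ ψ → begin
        ⟪ constₚ 1# ⊠ p , ψ ⟫ ≡⟨ FF.⟪⟫-⊠ (constₚ 1#) p ψ ⟩
        1# * ⟪ p , (λ m → ψ (0ₘ +ₘ m)) ⟫ + 0# ≡⟨ ≡.trans (+-identityʳ _) (*-identityˡ _) ⟩
        ⟪ p , (λ m → ψ (0ₘ +ₘ m)) ⟫ ≡⟨ FF.⟪⟫-congʳ p (λ m → cong ψ (+ₘ-identityˡ m)) ⟩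
        ⟪ p , ψ ⟫ ∎

      ⊞-comm : ∀ p r → p ⊞ r ≋ r ⊞ p
      ⊞-comm p r = ≋-ext λ ψ → ≡.trans (FF.⟪⟫-⊞ p r ψ) (≡.trans (+-comm _ _) (≡.sym (FF.⟪⟫-⊞ r p ψ)))

      ⊞-assoc : ∀ p r s → (p ⊞ r) ⊞ s ≋ p ⊞ (r ⊞ s)
      ⊞-assoc p r s = ≡⇒≋ (≡.trans (⊞-def (p ⊞ r) s) (≡.trans (cong (_++ s) (⊞-def p r)) (≡.trans (Lₚ.++-assoc p r s)
        (≡.sym (≡.trans (⊞-def p (r ⊞ s)) (cong (p ++_) (⊞-def r s)))))))

      ⊞-identityˡ : ∀ p → [] ⊞ p ≋ p
      ⊞-identityˡ p = ≡⇒≋ (⊞-def [] p)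

      ⊞-cong : ∀ {p p′ r r′} → p ≋ p′ → r ≋ r′ → p ⊞ r ≋ p′ ⊞ r′
      ⊞-cong {p} {p′} {r} {r′} e e′ = ≋-ext λ ψ → ≡.trans (FF.⟪⟫-⊞ p r ψ)
        (≡.trans (cong₂ _+_ (FF.⟪⟫-congˡ e ψ) (FF.⟪⟫-congˡ e′ ψ)) (≡.sym (FF.⟪⟫-⊞ p′ r′ ψ)))

      ⟪⟫-neg : ∀ p ψ → ⟪ negₚ p , ψ ⟫ ≡ (- 1#) * ⟪ p , ψ ⟫
      ⟪⟫-neg p ψ = ≡.trans (⨁-map _ p _) (≡.trans (⨁-cong p λ t →
        solve 2 (λ a b → (:- a) :* b := :- con (+ 1) :* (a :* b)) ≡.refl (proj₁ t) (ψ (proj₂ t))) (≡.sym (⨁-distribˡ p (- 1#) _)))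
        where open F-Solver

      negₚ-cong : ∀ {p p′} → p ≋ p′ → negₚ p ≋ negₚ p′
      negₚ-cong {p} {p′} e = ≋-ext λ ψ → ≡.trans (⟪⟫-neg p ψ) (≡.trans (cong ((- 1#) *_) (FF.⟪⟫-congˡ e ψ)) (≡.sym (⟪⟫-neg p′ ψ)))

      negₚ-inverseˡ : ∀ p → negₚ p ⊞ p ≋ []
      negₚ-inverseˡ p = ≋-ext λ ψ → ≡.trans (FF.⟪⟫-⊞ (negₚ p) p ψ) (≡.trans (cong (_+ ⟪ p , ψ ⟫) (⟪⟫-neg p ψ))
        (solve 1 (λ x → :- con (+ 1) :* x :+ x := con (+ 0)) ≡.refl ⟪ p , ψ ⟫))
        where open F-Solver

      ⊠-distribʳ : ∀ s p r → (p ⊞ r) ⊠ s ≋ p ⊠ s ⊞ r ⊠ s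
      ⊠-distribʳ s p r = ≋-ext λ ψ → begin
        ⟪ (p ⊞ r) ⊠ s , ψ ⟫ ≡⟨ FF.⟪⟫-⊠ (p ⊞ r) s ψ ⟩
        ⟪ p ⊞ r , _ ⟫ ≡⟨ FF.⟪⟫-⊞ p r _ ⟩
        ⟪ p , _ ⟫ + ⟪ r , _ ⟫ ≡⟨ cong₂ _+_ (FF.⟪⟫-⊠ p s ψ) (FF.⟪⟫-⊠ r s ψ) ⟨
        ⟪ p ⊠ s , ψ ⟫ + ⟪ r ⊠ s , ψ ⟫ ≡⟨ FF.⟪⟫-⊞ (p ⊠ s) (r ⊠ s) ψ ⟨
        ⟪ p ⊠ s ⊞ r ⊠ s , ψ ⟫ ∎

  polyRing : CommutativeRing 0ℓ 0ℓ
  polyRing = record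
    { Carrier = Poly ; _≈_ = _≋_ ; _+_ = _⊞_ ; _*_ = _⊠_ ; -_ = negₚ ; 0# = [] ; 1# = constₚ 1#
    ; isCommutativeRing = record
      { isRing = record
        { +-isAbelianGroup = record
          { isGroup = record
            { isMonoid = record
              { isSemigroup = record
                { isMagma = record
                  { isEquivalence = record { refl = ≋-refl ; sym = ≋-sym ; trans = ≋-trans }
                  ; ∙-cong = ⊞-cong }
                ; assoc = ⊞-assoc }
              ; identity = ⊞-identityˡ , (λ p → ≋-trans (⊞-comm p []) (⊞-identityˡ p)) }
            ; inverse = negₚ-inverseˡ , (λ p → ≋-trans (⊞-comm p (negₚ p)) (negₚ-inverseˡ p))
            ; ⁻¹-cong = negₚ-cong }
          ; comm = ⊞-comm }
        ; *-cong = ⊠-cong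
        ; *-assoc = ⊠-assoc
        ; *-identity = ⊠-identityˡ , (λ p → ≋-trans (⊠-comm p (constₚ 1#)) (⊠-identityˡ p))
        ; distrib = (λ s p r → ≋-trans (⊠-comm s (p ⊞ r))
                      (≋-trans (⊠-distribʳ s p r) (⊞-cong (⊠-comm p s) (⊠-comm r s))))
                  , ⊠-distribʳ }
      ; *-comm = ⊠-comm } }

  polyScalars : Scalars 𝔽 polyRing
  polyScalars = record
    { C = constₚ
    ; C-+ = λ x y → ≋-ext {constₚ (x + y)} {constₚ x ⊞ constₚ y} λ ψ → ≡.trans
        (solve 3 (λ x y z → (x :+ y) :* z :+ con (+ 0) := (x :* z :+ con (+ 0)) :+ (y :* z :+ con (+ 0))) ≡.refl x y (ψ 0ₘ))
        (≡.sym (FF.⟪⟫-⊞ (constₚ x) (constₚ y) ψ))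
    ; C-* = λ x y → ≡⇒≋ (≡.sym (≡.trans (⊠-def (constₚ x) (constₚ y)) (cong (λ z → (x * y , z) ∷ []) (+ₘ-identityˡ 0ₘ))))
    ; C-0 = ≋-ext {constₚ 0#} {[]} λ ψ → solve 1 (λ z → con (+ 0) :* z :+ con (+ 0) := con (+ 0)) ≡.refl (ψ 0ₘ)
    ; C-1 = wrap λ m → ≡.refl }
    where open F-Solver

-- Coordinate vectors, proportionality and reduction modulo a vector.

module Vectors {q : ℕ} (𝔽 : FiniteField q) where
  open Field 𝔽 hiding (_^_)

  module _ {k : ℕ} where
    vec-ext : {v w : Vect k} → (∀ i → lookup v i ≡ lookup w i) → v ≡ w
    vec-ext {v} {w} h = ≡.trans (≡.sym (Vₚ.tabulate∘lookup v)) (≡.trans (Vₚ.tabulate-cong h) (Vₚ.tabulate∘lookup w))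

    lookup-addV : ∀ (v w : Vect k) i → lookup (addV v w) i ≡ lookup v i + lookup w i
    lookup-addV v w i = Vₚ.lookup-zipWith _+_ i v w

    lookup-scaleV : ∀ c (v : Vect k) i → lookup (scaleV c v) i ≡ c * lookup v i
    lookup-scaleV c v i = Vₚ.lookup-map i (c *_) v

    lookup-zeroV : ∀ (i : Fin k) → lookup zeroV i ≡ 0#
    lookup-zeroV i = Vₚ.lookup-replicate i 0#

    nonzero-coordinate : ∀ (v : Vect k) → v ≢ zeroV → Σ[ p ∈ Fin k ] lookup v p ≢ 0#
    nonzero-coordinate v v≢0 with Finₚ.any? (λ p → ¬? (lookup v p ≟ 0#))
    ... | yes r = r
    ... | no none = ⊥-elim (v≢0 (vec-ext λ i → ≡.trans (decidable-stable (lookup v i ≟ 0#) (λ ne → none (i , ne))) (≡.sym (lookup-zeroV i))))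

  _∈⟨_⟩ : ∀ {k} → Vect k → Vect k → Set
  w ∈⟨ v ⟩ = Σ[ c ∈ Carrier ] w ≡ scaleV c v

  -- The multiple of `α` is the one that clears coordinate `p`, so the result is the representative
  -- of `v` modulo `α` with p-th coordinate 0.
  reduce : ∀ {k} (α : Vect k) (p : Fin k) → lookup α p ≢ 0# → Vect k → Vect k
  reduce α p nz v = addV v (scaleV (- (lookup v p * inv (lookup α p) nz)) α)

  module _ {k} (α : Vect k) (p : Fin k) (nz : lookup α p ≢ 0#) where
    private β = inv (lookup α p) nz
    open F-Solver

    lookup-reduce : ∀ v i → lookup (reduce α p nz v) i ≡ lookup v i + (- (lookup v p * β)) * lookup α i
    lookup-reduce v i = ≡.trans (lookup-addV v _ i) (cong (λ z → lookup v i + z) (lookup-scaleV _ α i))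

    reduce-at : ∀ v → lookup (reduce α p nz v) p ≡ 0#
    reduce-at v = ≡.trans (lookup-reduce v p) (≡.trans
      (solve 3 (λ v b a → v :+ (:- (v :* b)) :* a := v :+ :- (v :* (a :* b))) ≡.refl (lookup v p) β (lookup α p))
      (≡.trans (cong (λ z → lookup v p + - (lookup v p * z)) (x*inv _ nz))
        (solve 1 (λ v → v :+ :- (v :* con (+ 1)) := con (+ 0)) ≡.refl (lookup v p))))

    reduce-fixed : ∀ v → lookup v p ≡ 0# → reduce α p nz v ≡ v
    reduce-fixed v e = vec-ext λ i → ≡.trans (lookup-reduce v i) (≡.trans
      (cong (λ z → lookup v i + (- (z * β)) * lookup α i) e)
      (solve 3 (λ v b a → v :+ (:- (con (+ 0) :* b)) :* a := v) ≡.refl (lookup v i) β (lookup α i)))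

    reduce≡0 : ∀ v → reduce α p nz v ≡ zeroV → v ∈⟨ α ⟩
    reduce≡0 v e = lookup v p * β , vec-ext λ i → ≡.trans
      (solve 2 (λ v x → v := (v :+ (:- x)) :+ x) ≡.refl (lookup v i) (lookup v p * β * lookup α i))
      (≡.trans (cong (_+ lookup v p * β * lookup α i) (≡.trans
        (solve 3 (λ v x a → v :+ :- (x :* a) := v :+ (:- x) :* a) ≡.refl (lookup v i) (lookup v p * β) (lookup α i))
        (≡.trans (≡.sym (lookup-reduce v i)) (≡.trans (cong (λ z → lookup z i) e) (lookup-zeroV i)))))
      (≡.trans (+-identityˡ _) (≡.sym (lookup-scaleV _ α i))))

  infixl 6 _-ᵛ_
  _-ᵛ_ : ∀ {k} → Vect k → Vect k → Vect k
  v -ᵛ w = addV v (scaleV (- 1#) w)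

  module _ {k : ℕ} where
    open F-Solver

    lookup-sub : ∀ (v w : Vect k) i → lookup (v -ᵛ w) i ≡ lookup v i + (- 1#) * lookup w i
    lookup-sub v w i = ≡.trans (lookup-addV v _ i) (cong (λ z → lookup v i + z) (lookup-scaleV _ w i))

    scaleV-0# : ∀ (v : Vect k) → scaleV 0# v ≡ zeroV
    scaleV-0# v = vec-ext λ i → ≡.trans (lookup-scaleV 0# v i) (≡.trans (zeroˡ _) (≡.sym (lookup-zeroV i)))

    scaleV-zeroV : ∀ c → scaleV c (zeroV {k}) ≡ zeroV
    scaleV-zeroV c = vec-ext λ i → ≡.trans (lookup-scaleV c zeroV i)
      (≡.trans (cong (c *_) (lookup-zeroV i)) (≡.trans (zeroʳ c) (≡.sym (lookup-zeroV i))))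

    scaleV-assoc : ∀ a b (v : Vect k) → scaleV a (scaleV b v) ≡ scaleV (a * b) v
    scaleV-assoc a b v = vec-ext λ i → ≡.trans (lookup-scaleV a (scaleV b v) i)
      (≡.trans (cong (a *_) (lookup-scaleV b v i)) (≡.trans (≡.sym (*-assoc a b _)) (≡.sym (lookup-scaleV (a * b) v i))))

    scaleV-1# : ∀ (v : Vect k) → scaleV 1# v ≡ v
    scaleV-1# v = vec-ext λ i → ≡.trans (lookup-scaleV 1# v i) (*-identityˡ _)

    addV-zeroˡ : ∀ (v : Vect k) → addV zeroV v ≡ v
    addV-zeroˡ v = vec-ext λ i → ≡.trans (lookup-addV zeroV v i)
      (≡.trans (cong (λ z → z + lookup v i) (lookup-zeroV i)) (+-identityˡ _))

    sub-self : ∀ (v : Vect k) → v -ᵛ v ≡ zeroV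
    sub-self v = vec-ext λ i → ≡.trans (lookup-sub v v i)
      (≡.trans (solve 1 (λ x → x :+ (:- con (+ 1)) :* x := con (+ 0)) ≡.refl (lookup v i)) (≡.sym (lookup-zeroV i)))

    sub-addV : ∀ (v u w : Vect k) → v -ᵛ addV u w ≡ v -ᵛ u -ᵛ w
    sub-addV v u w = vec-ext λ i → ≡.trans (lookup-sub v (addV u w) i) (≡.trans (cong (λ z → lookup v i + (- 1#) * z) (lookup-addV u w i))
      (≡.trans (solve 3 (λ v u w → v :+ (:- con (+ 1)) :* (u :+ w) := v :+ (:- con (+ 1)) :* u :+ (:- con (+ 1)) :* w) ≡.refl (lookup v i) (lookup u i) (lookup w i))
        (≡.sym (≡.trans (lookup-sub (v -ᵛ u) w i) (cong (λ z → z + (- 1#) * lookup w i) (lookup-sub v u i))))))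

    sub≡0 : ∀ {v w : Vect k} → v -ᵛ w ≡ zeroV → v ≡ w
    sub≡0 {v} {w} e = vec-ext λ i → ≡.trans
      (solve 2 (λ v w → v := (v :+ (:- con (+ 1)) :* w) :+ w) ≡.refl (lookup v i) (lookup w i))
      (≡.trans (cong (λ z → z + lookup w i) (≡.trans (≡.sym (lookup-sub v w i)) (≡.trans (cong (λ z → lookup z i) e) (lookup-zeroV i))))
        (+-identityˡ _))

    ∈⟨⟩-sym : ∀ {v w : Vect k} → v ≢ zeroV → v ∈⟨ w ⟩ → w ∈⟨ v ⟩
    ∈⟨⟩-sym {v} {w} v≢0 (c , e) = inv c c≢0 , ≡.sym (≡.trans (cong (scaleV (inv c c≢0)) e)
      (≡.trans (scaleV-assoc _ c w) (≡.trans (cong (λ z → scaleV z w) (≡.trans (*-comm _ _) (x*inv c c≢0))) (scaleV-1# w))))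
      where
        c≢0 : c ≢ 0#
        c≢0 c≡0 = v≢0 (≡.trans e (≡.trans (cong (λ z → scaleV z w) c≡0) (scaleV-0# w)))

  record Linear {k l} (E : Vect k → Vect l) : Set where
    field
      E-add : ∀ v w → E (addV v w) ≡ addV (E v) (E w)
      E-scale : ∀ c v → E (scaleV c v) ≡ scaleV c (E v)

    E-zero : E zeroV ≡ zeroV
    E-zero = ≡.trans (cong E (≡.sym (scaleV-0# zeroV))) (≡.trans (E-scale 0# zeroV) (scaleV-0# _))

    E-sub : ∀ v w → E (v -ᵛ w) ≡ E v -ᵛ E w
    E-sub v w = ≡.trans (E-add v _) (cong (addV (E v)) (E-scale (- 1#) w))

  HasZeroKernel : ∀ {k l} → (Vect k → Vect l) → Set
  HasZeroKernel E = ∀ c → E c ≡ zeroV → c ≡ zeroV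

  id-linear : ∀ {k} → Linear {k} {k} id
  id-linear = record { E-add = λ _ _ → ≡.refl ; E-scale = λ _ _ → ≡.refl }

  module _ {k l} {E : Vect (suc k) → Vect l} (linear : Linear E) where
    open Linear linear

    tail-linear : Linear (λ c → E (0# ∷ c))
    tail-linear = record
      { E-add = λ v w → ≡.trans (cong (λ z → E (z ∷ addV v w)) (≡.sym (+-identityˡ 0#))) (E-add (0# ∷ v) (0# ∷ w))
      ; E-scale = λ c v → ≡.trans (cong (λ z → E (z ∷ scaleV c v)) (≡.sym (zeroʳ c))) (E-scale c (0# ∷ v)) }

    tail-kernel : HasZeroKernel E → HasZeroKernel (λ c → E (0# ∷ c))
    tail-kernel inj c e = Vₚ.∷-injectiveʳ (inj (0# ∷ c) e)

    E-∷ : ∀ x c → E (x ∷ c) ≡ addV (scaleV x (E (1# ∷ zeroV))) (E (0# ∷ c))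
    E-∷ x c = ≡.trans (cong E (cong₂ _∷_ (≡.sym (≡.trans (+-identityʳ _) (*-identityʳ x)))
        (≡.sym (≡.trans (cong (λ z → addV z c) (scaleV-zeroV x)) (addV-zeroˡ c)))))
      (≡.trans (E-add (scaleV x (1# ∷ zeroV)) (0# ∷ c)) (cong (λ z → addV z (E (0# ∷ c))) (E-scale x _)))

  module _ {k} (α : Vect k) (p : Fin k) (nz : lookup α p ≢ 0#) where
    open F-Solver

    reduce-self : reduce α p nz α ≡ zeroV
    reduce-self = vec-ext λ i → ≡.trans (lookup-reduce α p nz α i) (≡.trans
      (cong (λ z → lookup α i + (- z) * lookup α i) (x*inv _ nz))
      (≡.trans (solve 1 (λ a → a :+ (:- con (+ 1)) :* a := con (+ 0)) ≡.refl (lookup α i)) (≡.sym (lookup-zeroV i))))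

-- Congruences, monomials and substitution homomorphisms.

module Congruence (R : CommutativeRing 0ℓ 0ℓ) (a : CommutativeRing.Carrier R) where
  open CommutativeRing R hiding (zero)
  open IntegerSolver R
  open Algebra.Properties.Semiring.Exp semiring

  _∼_ : Carrier → Carrier → Set
  x ∼ y = Σ[ g ∈ Carrier ] x ≈ y + a * g

  ∼-reflexive : ∀ {x y} → x ≈ y → x ∼ y
  ∼-reflexive e = 0# , trans e (sym (trans (+-congˡ (zeroʳ a)) (+-identityʳ _)))

  ∼-+ : ∀ {x y x′ y′} → x ∼ y → x′ ∼ y′ → (x + x′) ∼ (y + y′)
  ∼-+ {x} {y} {x′} {y′} (g , e) (g′ , e′) = g + g′ , trans (+-cong e e′)
    (solve 5 (λ y y′ a g g′ → (y :+ a :* g) :+ (y′ :+ a :* g′) := (y :+ y′) :+ a :* (g :+ g′)) refl y y′ a g g′)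

  ∼-* : ∀ {x y x′ y′} → x ∼ y → x′ ∼ y′ → (x * x′) ∼ (y * y′)
  ∼-* {x} {y} {x′} {y′} (g , e) (g′ , e′) = g * y′ + y * g′ + a * g * g′ , trans (*-cong e e′)
    (solve 5 (λ y y′ a g g′ → (y :+ a :* g) :* (y′ :+ a :* g′) := (y :* y′) :+ a :* (g :* y′ :+ y :* g′ :+ a :* g :* g′)) refl y y′ a g g′)

  ∼-^ : ∀ {x y} n → x ∼ y → (x ^ n) ∼ (y ^ n)
  ∼-^ zero h = ∼-reflexive refl
  ∼-^ (suc n) h = ∼-* h (∼-^ n h)

-- The exponent vector of a variable, spelled as in `linPoly` so that the two agree definitionally.
unitₘ : ∀ {k} → Fin k → Vec ℕ k
unitₘ i = tabulate (λ j → if does (i ≟F j) then 1 else 0)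

module _ where
  private
    _+ₘ_ : ∀ {k} → Vec ℕ k → Vec ℕ k → Vec ℕ k
    _+ₘ_ = zipWith ℕ._+_

  tabulate-0 : ∀ k → tabulate {n = k} (λ _ → 0) ≡ V.replicate k 0
  tabulate-0 zero = ≡.refl
  tabulate-0 (suc k) = cong (0 ∷_) (tabulate-0 k)

  unitₘ-zero : ∀ {k} → unitₘ {suc k} zero ≡ 1 ∷ V.replicate k 0
  unitₘ-zero {k} = cong (1 ∷_) (tabulate-0 k)

  sum-unitₘ+ : ∀ {k} (i : Fin k) m → V.sum (unitₘ i +ₘ m) ≡ suc (V.sum m)
  sum-unitₘ+ zero (x ∷ m) = cong suc (cong (x ℕ.+_) (cong V.sum
    (≡.trans (cong (_+ₘ m) (tabulate-0 _)) (Vₚ.zipWith-identityˡ ℕₚ.+-identityˡ m))))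
  sum-unitₘ+ (suc i) (x ∷ m) = ≡.trans (cong (x ℕ.+_) (sum-unitₘ+ i m)) (ℕₚ.+-suc x _)

  lookup-unitₘ+-same : ∀ {k} (i : Fin k) m → lookup (unitₘ i +ₘ m) i ≡ suc (lookup m i)
  lookup-unitₘ+-same zero (x ∷ m) = ≡.refl
  lookup-unitₘ+-same (suc i) (x ∷ m) = lookup-unitₘ+-same i m

  lookup-unitₘ+-other : ∀ {k} (i j : Fin k) m → i ≢ j → lookup (unitₘ i +ₘ m) j ≡ lookup m j
  lookup-unitₘ+-other zero zero m i≢j = ⊥-elim (i≢j ≡.refl)
  lookup-unitₘ+-other zero (suc j) (x ∷ m) i≢j = cong (λ z → lookup z j)
    (≡.trans (cong (_+ₘ m) (tabulate-0 _)) (Vₚ.zipWith-identityˡ ℕₚ.+-identityˡ m))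
  lookup-unitₘ+-other (suc i) zero (x ∷ m) i≢j = ≡.refl
  lookup-unitₘ+-other (suc i) (suc j) (x ∷ m) i≢j = lookup-unitₘ+-other i j m (λ e → i≢j (cong suc e))

  lookup≤sum : ∀ {k} (m : Vec ℕ k) i → lookup m i ≤ V.sum m
  lookup≤sum (x ∷ m) zero = ℕₚ.m≤m+n x _
  lookup≤sum (x ∷ m) (suc i) = ℕₚ.≤-trans (lookup≤sum m i) (ℕₚ.m≤n+m _ x)

  subtract-unitₘ : ∀ {k} (i : Fin k) w → (Σ[ m ∈ Vec ℕ k ] unitₘ i +ₘ m ≡ w) ⊎ (∀ m → unitₘ i +ₘ m ≢ w)
  subtract-unitₘ i w with lookup w i in e
  ... | zero = inj₂ λ m e′ → ℕₚ.1+n≢0 (≡.trans (≡.sym (lookup-unitₘ+-same i m)) (≡.trans (cong (λ z → lookup z i) e′) e))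
  ... | suc x = inj₁ (go i w e)
    where
      go : ∀ {k} (i : Fin k) w → lookup w i ≡ suc x → Σ[ m ∈ Vec ℕ k ] unitₘ i +ₘ m ≡ w
      go zero (y ∷ w) ≡.refl = x ∷ w , cong (suc x ∷_) (≡.trans (cong (_+ₘ w) (tabulate-0 _)) (Vₚ.zipWith-identityˡ ℕₚ.+-identityˡ w))
      go (suc i) (y ∷ w) e with go i w e
      ... | m , e′ = y ∷ m , cong (y ∷_) e′

  +ₘ-cancelˡ : ∀ {k} (u m m′ : Vec ℕ k) → u +ₘ m ≡ u +ₘ m′ → m ≡ m′
  +ₘ-cancelˡ [] [] [] e = ≡.refl
  +ₘ-cancelˡ (x ∷ u) (y ∷ m) (z ∷ m′) e =
    cong₂ _∷_ (ℕₚ.+-cancelˡ-≡ x y z (Vₚ.∷-injectiveˡ e)) (+ₘ-cancelˡ u m m′ (Vₚ.∷-injectiveʳ e))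

  -- The exponents of a monomial after its i-th variable has been replaced by the monomial with
  -- exponents `es i`.
  weightedSum : ∀ {k l} → Vec ℕ k → (Fin k → Vec ℕ l) → Vec ℕ l
  weightedSum [] es = V.replicate _ 0
  weightedSum (m ∷ ms) es = V.map (m ℕ.*_) (es zero) +ₘ weightedSum ms (es ∘ suc)

  weightedSum-unitₘ : ∀ {k} (m : Vec ℕ k) → weightedSum m unitₘ ≡ m
  weightedSum-unitₘ [] = ≡.refl
  weightedSum-unitₘ {suc k} (m ∷ ms) = cong₂ _+ₘ_ head (shift ms unitₘ) ⟨ ≡.trans ⟩
      cong₂ _∷_ (ℕₚ.+-identityʳ m) (≡.trans (Vₚ.zipWith-identityˡ ℕₚ.+-identityˡ _) (weightedSum-unitₘ ms))
    where
      open import Function using (_⟨_⟩_)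
      head : V.map (m ℕ.*_) (unitₘ {suc k} zero) ≡ m ∷ V.replicate k 0
      head = ≡.trans (cong (V.map (m ℕ.*_)) (unitₘ-zero {k})) (cong₂ _∷_ (ℕₚ.*-identityʳ m)
        (≡.trans (Vₚ.map-replicate (m ℕ.*_) 0 k) (cong (V.replicate k) (ℕₚ.*-zeroʳ m))))
      shift : ∀ {l j} (ms : Vec ℕ l) (es : Fin l → Vec ℕ j) → weightedSum ms (λ i → 0 ∷ es i) ≡ 0 ∷ weightedSum ms es
      shift [] es = ≡.refl
      shift (x ∷ ms) es = cong₂ _+ₘ_ (cong (_∷ V.map (x ℕ.*_) (es zero)) (ℕₚ.*-zeroʳ x)) (shift ms (es ∘ suc))

module Substitution {q : ℕ} (𝔽 : FiniteField q) {ℓ n : ℕ} (A : Fin n → Over.Vect 𝔽 ℓ)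
    (R : CommutativeRing 0ℓ 0ℓ) (scalars : Scalars 𝔽 R) where
  open Over 𝔽
  open Arrangement A
  open Polynomials 𝔽 A
  open CommutativeRing R hiding (zero)
  open Scalars scalars
  open Functional R scalars
  open BigSum R
  open IntegerSolver R
  open Algebra.Properties.Semiring.Exp semiring
  open Relation.Binary.Reasoning.Setoid setoid

  mon : ∀ {k} → (Fin k → Carrier) → Vec ℕ k → Carrier
  mon s [] = 1#
  mon s (m ∷ ms) = s zero ^ m * mon (s ∘ suc) ms

  mon-+ : ∀ {k} (s : Fin k → Carrier) m m′ → mon s (m +ₘ m′) ≈ mon s m * mon s m′
  mon-+ s [] [] = sym (*-identityʳ 1#)
  mon-+ s (x ∷ m) (y ∷ m′) = trans (*-cong (^-homo-* (s zero) x y) (mon-+ (s ∘ suc) m m′))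
    (solve 4 (λ a b c d → (a :* b) :* (c :* d) := (a :* c) :* (b :* d)) refl (s zero ^ x) (s zero ^ y) _ _)

  mon-0 : ∀ {k} (s : Fin k → Carrier) → mon s (0ₘ {k}) ≈ 1#
  mon-0 {zero} s = refl
  mon-0 {suc k} s = trans (*-identityˡ _) (mon-0 (s ∘ suc))

  mon-unitₘ : ∀ {k} (s : Fin k → Carrier) i → mon s (unitₘ i) ≈ s i
  mon-unitₘ {suc k} s zero = trans (reflexive (cong (mon s) (unitₘ-zero {k})))
    (trans (*-cong (*-identityʳ _) (mon-0 (s ∘ suc))) (*-identityʳ _))
  mon-unitₘ s (suc i) = trans (*-identityˡ _) (mon-unitₘ (s ∘ suc) i)

  ⟪linPoly⟫ : ∀ v (ψ : Monomial → Carrier) → ⟪ linPoly v , ψ ⟫ ≈ ⨁ (allFin ℓ) (λ i → C (lookup v i) * ψ (unitₘ i))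
  ⟪linPoly⟫ v ψ = reflexive (⨁-map _ (allFin ℓ) _)

  module _ (s : Fin ℓ → Carrier) where
    subs : Poly → Carrier
    subs p = ⟪ p , mon s ⟫

    subs-cong : ∀ {p r} → p ≋ r → subs p ≈ subs r
    subs-cong e = ⟪⟫-congˡ e (mon s)

    subs-+ : ∀ p r → subs (p ⊞ r) ≈ subs p + subs r
    subs-+ p r = ⟪⟫-⊞ p r (mon s)

    subs-* : ∀ p r → subs (p ⊠ r) ≈ subs p * subs r
    subs-* p r = begin
      ⟪ p ⊠ r , mon s ⟫ ≈⟨ ⟪⟫-⊠ p r (mon s) ⟩
      ⟪ p , (λ m → ⟪ r , (λ m′ → mon s (m +ₘ m′)) ⟫) ⟫ ≈⟨ ⟪⟫-congʳ p (λ m → trans (⟪⟫-congʳ r (mon-+ s m)) (trans (⟪⟫-*ʳ r _ _) (*-comm _ _))) ⟩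
      ⟪ p , (λ m → ⟪ r , mon s ⟫ * mon s m) ⟫ ≈⟨ trans (⟪⟫-*ʳ p _ _) (*-comm _ _) ⟩
      ⟪ p , mon s ⟫ * ⟪ r , mon s ⟫ ∎

    subs-const : ∀ c → subs (constₚ c) ≈ C c
    subs-const c = trans (+-identityʳ _) (trans (*-congˡ (mon-0 s)) (*-identityʳ _))

    subs-linPoly : ∀ v → subs (linPoly v) ≈ ⨁ (allFin ℓ) (λ i → C (lookup v i) * s i)
    subs-linPoly v = trans (⟪linPoly⟫ v (mon s)) (⨁-cong (allFin ℓ) λ i → *-congˡ (mon-unitₘ s i))

  module _ (a : Carrier) where
    open Congruence R a

    mon-∼ : ∀ {k} {s s′ : Fin k → Carrier} → (∀ i → s i ∼ s′ i) → ∀ m → mon s m ∼ mon s′ m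
    mon-∼ h [] = ∼-reflexive refl
    mon-∼ h (x ∷ m) = ∼-* (∼-^ x (h zero)) (mon-∼ (h ∘ suc) m)

    subs-∼ : ∀ {s s′ : Fin ℓ → Carrier} → (∀ i → s i ∼ s′ i) → ∀ p → subs s p ∼ subs s′ p
    subs-∼ h [] = ∼-reflexive refl
    subs-∼ h ((c , m) ∷ p) = ∼-+ (∼-* (∼-reflexive refl) (mon-∼ h m)) (subs-∼ h p)

module LinearCombinations {q : ℕ} (𝔽 : FiniteField q) {ℓ : ℕ} (R : CommutativeRing 0ℓ 0ℓ) (scalars : Scalars 𝔽 R) where
  private module F = Field 𝔽
  open F using (Vect; addV; scaleV; 0#)
  open Vectors 𝔽
  open CommutativeRing R hiding (zero; 0#; Carrier)
  private module R = CommutativeRing R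
  open Scalars scalars
  open BigSum R
  private module FB = BigSum F.fieldRing
  open IntegerSolver R
  open Relation.Binary.Reasoning.Setoid setoid

  fins : List (Fin ℓ)
  fins = allFin ℓ

  -- If X holds the components of a derivation δ, this is the value δ(v) on the linear form v; if X
  -- holds the variables, it is v itself as a polynomial.
  lin : Vect ℓ → (Fin ℓ → R.Carrier) → R.Carrier
  lin v X = ⨁ fins (λ i → C (lookup v i) * X i)

  lin-cong : ∀ v {X Y : Fin ℓ → R.Carrier} → (∀ i → X i ≈ Y i) → lin v X ≈ lin v Y
  lin-cong v h = ⨁-cong fins λ i → *-congˡ (h i)

  lin-add : ∀ v w X → lin (addV v w) X ≈ lin v X + lin w X
  lin-add v w X = trans (⨁-cong fins λ i → trans
      (*-congʳ (trans (reflexive (cong C (lookup-addV v w i))) (C-+ _ _))) (distribʳ _ _ _)) (⨁-∙ fins _ _)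

  lin-scale : ∀ c v X → lin (scaleV c v) X ≈ C c * lin v X
  lin-scale c v X = trans (⨁-cong fins λ i → trans
      (*-congʳ (trans (reflexive (cong C (lookup-scaleV c v i))) (C-* _ _))) (*-assoc _ _ _))
    (sym (⨁-distribˡ fins _ _))

  lin-+ : ∀ v X Y → lin v (λ i → X i + Y i) ≈ lin v X + lin v Y
  lin-+ v X Y = trans (⨁-cong fins λ i → distribˡ _ _ _) (⨁-∙ fins _ _)

  lin-* : ∀ v a X → lin v (λ i → a * X i) ≈ a * lin v X
  lin-* v a X = trans (⨁-cong fins λ i → solve 3 (λ c a x → c :* (a :* x) := a :* (c :* x)) refl (C (lookup v i)) a (X i))
    (sym (⨁-distribˡ fins _ _))

  at-coordinate : Fin ℓ → F.Carrier → Fin ℓ → F.Carrier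
  at-coordinate p b i = if does (i ≟F p) then b else 0#

  C-sum : ∀ {B : Set} (xs : List B) f → C (FB.⨁ xs f) ≈ ⨁ xs (λ x → C (f x))
  C-sum [] f = C-0
  C-sum (x ∷ xs) f = trans (C-+ _ _) (+-congˡ (C-sum xs f))

  lin-at-coordinate : ∀ v p b → lin v (λ i → C (at-coordinate p b i)) ≈ C (lookup v p F.* b)
  lin-at-coordinate v p b = trans (⨁-cong fins λ i → sym (C-* _ _)) (trans (sym (C-sum fins _)) (reflexive (cong C
      (≡.trans (FB.⨁-cong fins push) (FB.⨁-kronecker _≟F_ (Uₚ.allFin⁺ ℓ) (∈ₚ.∈-allFin p) (λ i → lookup v i F.* b))))))
    where
      push : ∀ i → lookup v i F.* at-coordinate p b i ≡ (if does (i ≟F p) then lookup v i F.* b else 0#)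
      push i with does (i ≟F p)
      ... | true = ≡.refl
      ... | false = F.zeroʳ _

  module _ (α : Vect ℓ) (p : Fin ℓ) (nz : lookup α p ≢ 0#) (X : Fin ℓ → R.Carrier) where
    -- The variable x_p becomes x_p - α / α_p, the value that α = 0 forces on it; the other
    -- variables stay. A form v thereby loses v_p α / α_p, which is what `reduce` subtracts.
    eliminated : Fin ℓ → R.Carrier
    eliminated i = X i + lin α X * - C (at-coordinate p (F.inv (lookup α p) nz) i)

    X≈eliminated : ∀ i → X i ≈ eliminated i + lin α X * C (at-coordinate p (F.inv (lookup α p) nz) i)
    X≈eliminated i = solve 3 (λ x a e → x := x :+ a :* (:- e) :+ a :* e) refl (X i) (lin α X) _

    lin-eliminated : ∀ v → lin v eliminated ≈ lin (reduce α p nz v) X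
    lin-eliminated v = begin
      lin v eliminated
        ≈⟨ lin-+ v X _ ⟩
      lin v X + lin v (λ i → lin α X * - C (at-coordinate p β i))
        ≈⟨ +-congˡ (lin-cong v λ i → solve 2 (λ a e → a :* (:- e) := (:- a) :* e) refl (lin α X) _) ⟩
      lin v X + lin v (λ i → (- lin α X) * C (at-coordinate p β i))
        ≈⟨ +-congˡ (trans (lin-* v _ _) (*-congˡ (lin-at-coordinate v p β))) ⟩
      lin v X + (- lin α X) * C (lookup v p F.* β)
        ≈⟨ +-congˡ (trans (solve 2 (λ a c → (:- a) :* c := (:- c) :* a) refl (lin α X) _) (*-congʳ (sym (C-neg _)))) ⟩
      lin v X + C (F.- (lookup v p F.* β)) * lin α X
        ≈⟨ +-congˡ (lin-scale _ α X) ⟨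
      lin v X + lin (scaleV (F.- (lookup v p F.* β)) α) X
        ≈⟨ lin-add v _ X ⟨
      lin (reduce α p nz v) X ∎
      where β = F.inv (lookup α p) nz

-- Linear forms in the polynomial ring: elimination, regularity, grading.

-- What the argument uses of the embedding of V* as the linear forms of the polynomial ring.
record LinearForms {q : ℕ} (𝔽 : FiniteField q) (ℓ : ℕ) (R : CommutativeRing 0ℓ 0ℓ) (scalars : Scalars 𝔽 R) : Set where
  open Field 𝔽 using (Vect; addV; scaleV; zeroV; 0#; Carrier)
  open Vectors 𝔽 using (reduce)
  private module R = CommutativeRing R
  open R using (_≈_)
  open Scalars scalars
  open LinearCombinations 𝔽 {ℓ} R scalars
  field
    1≉0 : ¬ (R.1# ≈ R.0#)
    X : Fin ℓ → R.Carrier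
    ι : Vect ℓ → R.Carrier
    ι-lin : ∀ v → ι v ≈ lin v X
    ι-regular : ∀ v f → v ≢ zeroV → ι v R.* f ≈ R.0# → f ≈ R.0#
    -- the substitution eliminating the p-th variable modulo α
    σ : (α : Vect ℓ) (p : Fin ℓ) → lookup α p ≢ 0# → R.Carrier → R.Carrier
    σ-cong : ∀ {α p nz f g} → f ≈ g → σ α p nz f ≈ σ α p nz g
    σ-+ : ∀ {α p nz} f g → σ α p nz (f R.+ g) ≈ σ α p nz f R.+ σ α p nz g
    σ-* : ∀ {α p nz} f g → σ α p nz (f R.* g) ≈ σ α p nz f R.* σ α p nz g
    σ-C : ∀ {α p nz} c → σ α p nz (C c) ≈ C c
    σ-ι : ∀ {α p nz} v → σ α p nz (ι v) ≈ ι (reduce α p nz v)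
    σ-residue : ∀ {α p nz} f → Σ[ g ∈ R.Carrier ] f ≈ σ α p nz f R.+ ι α R.* g
    -- homogeneous component of a given degree
    π : ℕ → R.Carrier → R.Carrier
    π-cong : ∀ {d f g} → f ≈ g → π d f ≈ π d g
    π-+ : ∀ d f g → π d (f R.+ g) ≈ π d f R.+ π d g
    π-idem : ∀ d f → π d (π d f) ≈ π d f
    π-1 : π 0 R.1# ≈ R.1#
    π-ι-suc : ∀ d v f → π (suc d) (ι v R.* f) ≈ ι v R.* π d f
    π-ι-zero : ∀ v f → π 0 (ι v R.* f) ≈ R.0#

  ι-add : ∀ v w → ι (addV v w) ≈ ι v R.+ ι w
  ι-add v w = R.trans (ι-lin _) (R.trans (lin-add v w X) (R.+-cong (R.sym (ι-lin v)) (R.sym (ι-lin w))))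

  ι-scale : ∀ c v → ι (scaleV c v) ≈ C c R.* ι v
  ι-scale c v = R.trans (ι-lin _) (R.trans (lin-scale c v X) (R.*-congˡ (R.sym (ι-lin v))))

module PolynomialForms {q : ℕ} (𝔽 : FiniteField q) {ℓ n : ℕ} (A : Fin n → Over.Vect 𝔽 ℓ) where
  open Field 𝔽 hiding (_^_)
  open Vectors 𝔽
  open Arrangement A
  open Polynomials 𝔽 A
  private
    module P = CommutativeRing polyRing
    module S = Substitution 𝔽 A polyRing polyScalars
    module T = Substitution 𝔽 A fieldRing (fieldScalars 𝔽)
    module PF = Functional polyRing polyScalars
    module FB = BigSum fieldRing
  open FF using (⟪_,_⟫; δ)
  open Algebra.Properties.Semiring.Exp P.semiring

  fins : List (Fin ℓ)
  fins = allFin ℓ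

  single : Monomial → Poly
  single m = (1# , m) ∷ []

  single-* : ∀ m m′ → single m ⊠ single m′ ≡ single (m +ₘ m′)
  single-* m m′ = ≡.trans (⊠-def _ _) (cong (λ c → (c , m +ₘ m′) ∷ []) (*-identityˡ 1#))

  single-^ : ∀ m k → single m ^ k ≋ single (V.map (k ℕ.*_) m)
  single-^ m zero = P.reflexive (cong single (≡.sym (≡.trans (Vₚ.map-cong (λ _ → ≡.refl) m) (Vₚ.map-const m 0))))
  single-^ m (suc k) = P.trans (P.*-congˡ (single-^ m k)) (P.reflexive (≡.trans (single-* m _) (cong single (split m))))
    where
      split : ∀ {j} (m : Vec ℕ j) → m +ₘ V.map (k ℕ.*_) m ≡ V.map (suc k ℕ.*_) m
      split [] = ≡.refl
      split (x ∷ m) = cong (_ ∷_) (split m)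

  mon-single : ∀ {k} (es : Fin k → Monomial) m → S.mon (single ∘ es) m ≋ single (weightedSum m es)
  mon-single es [] = P.refl
  mon-single es (x ∷ m) = P.trans (P.*-cong (single-^ (es zero) x) (mon-single (es ∘ suc) m)) (P.reflexive (single-* _ _))

  X : Fin ℓ → Poly
  X i = single (unitₘ i)

  mon-X : ∀ m → S.mon X m ≋ single m
  mon-X m = P.trans (mon-single unitₘ m) (P.reflexive (cong single (weightedSum-unitₘ m)))

  -- With `f` itself written as a substitution, the congruence of x_i with its eliminated value
  -- passes to `f` by `subs-∼`.
  subs-X : ∀ p → S.subs X p ≋ p
  subs-X p = P.trans (PF.⟪⟫-congʳ p mon-X) (terms p)
    where
      terms : ∀ p → PF.⟪ p , single ⟫ ≋ p
      terms [] = P.refl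
      terms ((c , m) ∷ p) = P.trans (P.+-cong
        (P.reflexive (≡.trans (⊠-def _ _) (cong (_∷ []) (cong₂ _,_ (*-identityʳ c) (+ₘ-identityˡ m))))) (terms p))
        (P.reflexive (⊞-def ((c , m) ∷ []) p))

  module LC = LinearCombinations 𝔽 {ℓ} polyRing polyScalars

  linPoly-lin : ∀ v → linPoly v ≋ LC.lin v X
  linPoly-lin v = P.trans (P.sym (subs-X (linPoly v))) (S.subs-linPoly X v)

  module Elimination (α : Vect ℓ) (p : Fin ℓ) (nz : lookup α p ≢ 0#) where
    elim : Poly → Poly
    elim = S.subs (LC.eliminated α p nz X)

    elim-linPoly : ∀ v → elim (linPoly v) ≋ linPoly (reduce α p nz v)
    elim-linPoly v = P.trans (S.subs-linPoly _ v) (P.trans (LC.lin-eliminated α p nz X v) (P.sym (linPoly-lin (reduce α p nz v))))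

    elim-residue : ∀ f → Σ[ g ∈ Poly ] f ≋ elim f ⊞ linPoly α ⊠ g
    elim-residue f = proj₁ residue ,
      P.trans (P.sym (subs-X f)) (P.trans (proj₂ residue) (P.+-congˡ {elim f} (P.*-congʳ {proj₁ residue} (P.sym (linPoly-lin α)))))
      where
        open Congruence polyRing (LC.lin α X)
        close : ∀ i → X i ∼ LC.eliminated α p nz X i
        close i = constₚ (LC.at-coordinate p (inv (lookup α p) nz) i) , LC.X≈eliminated α p nz X i
        residue : S.subs X f ∼ elim f
        residue = S.subs-∼ (LC.lin α X) {s = X} {s′ = LC.eliminated α p nz X} close f

  private
    ⟪⟫-linPoly-* : ∀ v f ψ → ⟪ linPoly v ⊠ f , ψ ⟫ ≡ FB.⨁ fins (λ i → lookup v i * ⟪ f , (λ m → ψ (unitₘ i +ₘ m)) ⟫)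
    ⟪⟫-linPoly-* v f ψ = ≡.trans (FF.⟪⟫-⊠ (linPoly v) f ψ) (T.⟪linPoly⟫ v _)

  δ-yes : ∀ {m m′} → m ≡ m′ → δ m m′ ≡ 1#
  δ-yes {m} {m′} e with m ≟ₘ m′
  ... | yes _ = ≡.refl
  ... | no ne = ⊥-elim (ne e)

  δ-no : ∀ {m m′} → m ≢ m′ → δ m m′ ≡ 0#
  δ-no {m} {m′} ne with m ≟ₘ m′
  ... | yes e = ⊥-elim (ne e)
  ... | no _ = ≡.refl

  -- If α f = 0 and α_p ≠ 0, the coefficient at x_p m of α f expresses f_m through coefficients
  -- of f at monomials of smaller degree in the variables other than x_p.
  linPoly-regular : ∀ α f → α ≢ zeroV → linPoly α ⊠ f ≋ [] → f ≋ []
  linPoly-regular α f α≢0 αf≋0 with nonzero-coordinate α α≢0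
  ... | p , nz = wrap λ m → vanish (V.sum m ∸ lookup m p) m (≡.sym (ℕₚ.m+[n∸m]≡n (lookup≤sum m p)))
    where
      δ-shift : ∀ u m m′ → δ (u +ₘ m) (u +ₘ m′) ≡ δ m m′
      δ-shift u m m′ with m ≟ₘ m′
      ... | yes e = δ-yes (cong (u +ₘ_) e)
      ... | no ne = δ-no (ne ∘ +ₘ-cancelˡ u m m′)

      coefficient : ∀ i m → ⟪ f , (λ m′ → δ (unitₘ i +ₘ m) (unitₘ i +ₘ m′)) ⟫ ≡ coeff f m
      coefficient i m = ≡.trans (FF.⟪⟫-congʳ f (λ m′ → δ-shift (unitₘ i) m m′)) (≡.sym (FF.C-coeff f m))

      vanish : ∀ k m → V.sum m ≡ lookup m p ℕ.+ k → coeff f m ≡ 0#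
      vanish k m sum≡ = *-cancel-0 nz (begin
        lookup α p * coeff f m
          ≡⟨ FB.⨁-kronecker _≟F_ (Uₚ.allFin⁺ ℓ) (∈ₚ.∈-allFin p) (λ i → lookup α i * coeff f m) ⟨
        FB.⨁ fins (λ i → if does (i ≟F p) then lookup α i * coeff f m else 0#)
          ≡⟨ FB.⨁-cong fins term ⟩
        FB.⨁ fins (λ i → lookup α i * ⟪ f , (λ m′ → δ (unitₘ p +ₘ m) (unitₘ i +ₘ m′)) ⟫)
          ≡⟨ ⟪⟫-linPoly-* α f (δ (unitₘ p +ₘ m)) ⟨
        ⟪ linPoly α ⊠ f , δ (unitₘ p +ₘ m) ⟫
          ≡⟨ FF.⟪⟫-congˡ αf≋0 _ ⟩
        0# ∎)
        where
          open ≡.≡-Reasoning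
          -- In x_i m₁ = x_p m with i ≠ p, `m₁` has the total degree of `m` and one more factor x_p.
          -- Its degree in the remaining variables is thus one less than the corresponding degree
          -- `k` of `m`, and `k` = 0 is impossible.
          smaller : ∀ k i m₁ → i ≢ p → unitₘ i +ₘ m₁ ≡ unitₘ p +ₘ m → V.sum m ≡ lookup m p ℕ.+ k → coeff f m₁ ≡ 0#
          smaller k i m₁ i≢p eq sum≡ = go k sum≡
            where
              sum₁ : V.sum m₁ ≡ V.sum m
              sum₁ = ℕₚ.suc-injective (≡.trans (≡.sym (sum-unitₘ+ i m₁)) (≡.trans (cong V.sum eq) (sum-unitₘ+ p m)))
              at-p : lookup m₁ p ≡ suc (lookup m p)
              at-p = ≡.trans (≡.sym (lookup-unitₘ+-other i p m₁ i≢p)) (≡.trans (cong (λ z → lookup z p) eq) (lookup-unitₘ+-same p m))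
              go : ∀ k → V.sum m ≡ lookup m p ℕ.+ k → coeff f m₁ ≡ 0#
              go zero e = ⊥-elim (ℕₚ.<-irrefl (≡.trans (≡.sym (ℕₚ.+-identityʳ _)) (≡.trans (≡.sym e) (≡.sym sum₁)))
                (subst (_≤ V.sum m₁) at-p (lookup≤sum m₁ p)))
              go (suc k) e = vanish k m₁ (≡.trans sum₁ (≡.trans e (≡.trans (ℕₚ.+-suc _ k) (cong (ℕ._+ k) (≡.sym at-p)))))

          term : ∀ i → (if does (i ≟F p) then lookup α i * coeff f m else 0#) ≡ lookup α i * ⟪ f , (λ m′ → δ (unitₘ p +ₘ m) (unitₘ i +ₘ m′)) ⟫
          term i with i ≟F p
          ... | yes ≡.refl = cong (lookup α i *_) (≡.sym (coefficient i m))
          ... | no i≢p with subtract-unitₘ i (unitₘ p +ₘ m)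
          ...   | inj₂ never = ≡.sym (≡.trans (cong (lookup α i *_) (FF.⟪⟫-0ʳ f λ m′ → δ-no (never m′ ∘ ≡.sym))) (zeroʳ _))
          ...   | inj₁ (m₁ , eq) = ≡.sym (≡.trans (cong (lookup α i *_) (≡.trans
                    (FF.⟪⟫-congʳ f (λ m′ → cong (λ w → δ w (unitₘ i +ₘ m′)) (≡.sym eq)))
                    (≡.trans (coefficient i m₁) (smaller k i m₁ i≢p eq sum≡)))) (zeroʳ _))

  component : ℕ → Poly → Poly
  component d = filter (λ t → V.sum (proj₂ t) ℕ.≟ d)

  private
    at : ℕ → (Monomial → Carrier) → Monomial → Carrier
    at d ψ m = if does (V.sum m ℕ.≟ d) then ψ m else 0#

  ⟪component⟫ : ∀ d p ψ → ⟪ component d p , ψ ⟫ ≡ ⟪ p , at d ψ ⟫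
  ⟪component⟫ d [] ψ = ≡.refl
  ⟪component⟫ d ((c , m) ∷ p) ψ with does (V.sum m ℕ.≟ d)
  ... | true = cong (λ z → c * ψ m + z) (⟪component⟫ d p ψ)
  ... | false = ≡.trans (⟪component⟫ d p ψ) (≡.sym (≡.trans (cong (_+ ⟪ p , at d ψ ⟫) (zeroʳ c)) (+-identityˡ _)))

  homogeneous : ∀ {d f} → component d f ≋ f → HomogP d f
  homogeneous {d} {f} e m ne with V.sum m ℕ.≟ d
  ... | yes sum≡ = sum≡
  ... | no sum≢ = ⊥-elim (ne (≡.trans (≡.sym (unwrap e m)) (≡.trans (FF.C-coeff (component d f) m)
          (≡.trans (⟪component⟫ d f (δ m)) (FF.⟪⟫-0ʳ f zero-at)))))
    where
      zero-at : ∀ m′ → at d (δ m) m′ ≡ 0#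
      zero-at m′ = if-dec (V.sum m′ ℕ.≟ d) (λ e′ → δ-no {m} {m′} λ m≡ → sum≢ (≡.trans (cong V.sum m≡) e′)) (λ _ → ≡.refl)
        where
          if-dec : ∀ {B : Set} (dec : Dec B) {x y z : Carrier} → (B → x ≡ z) → (¬ B → y ≡ z) → (if does dec then x else y) ≡ z
          if-dec (yes b) h _ = h b
          if-dec (no ¬b) _ h = h ¬b

  linearForms : LinearForms 𝔽 ℓ polyRing polyScalars
  linearForms = record
    -- The functional that sums all coefficients separates 1 from 0.
    { 1≉0 = λ e → 0≢1 (≡.sym (≡.trans (≡.sym (≡.trans (+-identityʳ _) (*-identityˡ 1#))) (FF.⟪⟫-congˡ e (λ _ → 1#))))
    ; ι = linPoly
    ; X = X
    ; ι-lin = linPoly-lin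
    ; ι-regular = linPoly-regular
    ; σ = Elimination.elim
    ; σ-cong = λ {α} {p} {nz} e → S.subs-cong (LC.eliminated α p nz X) e
    ; σ-+ = λ {α} {p} {nz} → S.subs-+ (LC.eliminated α p nz X)
    ; σ-* = λ {α} {p} {nz} → S.subs-* (LC.eliminated α p nz X)
    ; σ-C = λ {α} {p} {nz} → S.subs-const (LC.eliminated α p nz X)
    ; σ-ι = λ {α} {p} {nz} → Elimination.elim-linPoly α p nz
    ; σ-residue = λ {α} {p} {nz} → Elimination.elim-residue α p nz
    ; π = component
    ; π-cong = λ {d} {f} {g} e → ≋-ext λ ψ → ≡.trans (⟪component⟫ d f ψ) (≡.trans (FF.⟪⟫-congˡ e _) (≡.sym (⟪component⟫ d g ψ)))
    ; π-+ = λ d f g → P.reflexive (≡.trans (cong (component d) (⊞-def f g)) (≡.trans (Lₚ.filter-++ _ f g) (≡.sym (⊞-def (component d f) (component d g)))))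
    ; π-idem = λ d f → P.reflexive (Lₚ.filter-idem _ f)
    ; π-1 = P.reflexive (Lₚ.filter-accept (λ t → V.sum (proj₂ t) ℕ.≟ 0) {xs = []} (sum-0 ℓ))
    ; π-ι-suc = λ d v f → ≋-ext λ ψ → ≡.trans (⟪component⟫ (suc d) (linPoly v ⊠ f) ψ) (≡.trans (⟪⟫-linPoly-* v f _)
        (≡.trans (FB.⨁-cong fins λ i → cong (lookup v i *_) (≡.trans (FF.⟪⟫-congʳ f λ m → at-suc d ψ i m) (≡.sym (⟪component⟫ d f _))))
          (≡.sym (⟪⟫-linPoly-* v (component d f) ψ))))
    ; π-ι-zero = λ v f → ≋-ext λ ψ → ≡.trans (⟪component⟫ 0 (linPoly v ⊠ f) ψ) (≡.trans (⟪⟫-linPoly-* v f _)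
        (≡.trans (FB.⨁-cong fins λ i → ≡.trans (cong (lookup v i *_) (FF.⟪⟫-0ʳ f (at-zero ψ i))) (zeroʳ _)) (FB.⨁-ε fins)))
    }
    where
      sum-0 : ∀ k → V.sum (V.replicate k 0) ≡ 0
      sum-0 zero = ≡.refl
      sum-0 (suc k) = sum-0 k
      at-suc : ∀ d ψ i m → at (suc d) ψ (unitₘ i +ₘ m) ≡ at d (λ m′ → ψ (unitₘ i +ₘ m′)) m
      at-suc d ψ i m = ≡.trans (cong (λ k → if does (k ℕ.≟ suc d) then ψ (unitₘ i +ₘ m) else 0#) (sum-unitₘ+ i m)) ≡.refl
      at-zero : ∀ ψ i m → at 0 ψ (unitₘ i +ₘ m) ≡ 0#
      at-zero ψ i m = cong (λ k → if does (k ℕ.≟ 0) then ψ (unitₘ i +ₘ m) else 0#) (sum-unitₘ+ i m)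

-- Additive polynomials and Newton interpolation.

module Interpolation {q : ℕ} (𝔽 : FiniteField q) {ℓ : ℕ} (R : CommutativeRing 0ℓ 0ℓ) (scalars : Scalars 𝔽 R)
    (forms : LinearForms 𝔽 ℓ R scalars) where
  private module F = Field 𝔽
  open F using (Vect; addV; scaleV; zeroV; 0#; 1#; allVecs; elems)
  open Vectors 𝔽 public
  open CommutativeRing R hiding (zero; 0#; 1#; Carrier)
  private module R = CommutativeRing R
  open Scalars scalars
  open LinearCombinations 𝔽 {ℓ} R scalars
  open LinearForms forms
  open Frobenius 𝔽 R scalars
  open IntegerSolver R
  open Algebra.Properties.Semiring.Exp semiring
  open Algebra.Properties.CommutativeSemiring.Exp commutativeSemiring using (^-distrib-*)
  open Relation.Binary.Reasoning.Setoid setoid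
  open BigSum R using (⨁; ⨁-cong)
  private
    module Prod = BigOp *-commutativeMonoid
    module S = F.F-Solver
  open Prod using () renaming (⨁ to ∏)

  infix 4 _∣_
  _∣_ : R.Carrier → R.Carrier → Set
  a ∣ b = Σ[ g ∈ R.Carrier ] b ≈ a * g

  ∣-+ : ∀ {a b c} → a ∣ b → a ∣ c → a ∣ b + c
  ∣-+ (g , e) (h , e′) = g + h , trans (+-cong e e′) (sym (distribˡ _ _ _))

  ∣-* : ∀ {a b} c → a ∣ b → a ∣ c * b
  ∣-* {a} c (g , e) = c * g , trans (*-congˡ e) (solve 3 (λ c a g → c :* (a :* g) := a :* (c :* g)) refl c a g)

  ∣-resp : ∀ {a b c} → b ≈ c → a ∣ b → a ∣ c
  ∣-resp e (g , e′) = g , trans (sym e) e′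

  -- Values of the q-polynomial Σ cⱼ T^(q^j), leading coefficient first.
  ev : ∀ {k} → Vec R.Carrier k → R.Carrier → R.Carrier
  ev [] x = R.0#
  ev {suc k} (c ∷ cs) x = c * x ^ (q ℕ.^ k) + ev cs x

  ^-q^suc : ∀ k x → x ^ (q ℕ.^ suc k) ≈ (x ^ q) ^ (q ℕ.^ k)
  ^-q^suc k x = sym (^-assocʳ x q (q ℕ.^ k))

  ^q^-+ : ∀ k x y → (x + y) ^ (q ℕ.^ k) ≈ x ^ (q ℕ.^ k) + y ^ (q ℕ.^ k)
  ^q^-+ zero x y = trans (*-identityʳ _) (+-cong (sym (*-identityʳ _)) (sym (*-identityʳ _)))
  ^q^-+ (suc k) x y = begin
    (x + y) ^ (q ℕ.^ suc k) ≈⟨ ^-q^suc k _ ⟩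
    ((x + y) ^ q) ^ (q ℕ.^ k) ≈⟨ ^-congˡ (q ℕ.^ k) (frobenius-+ x y) ⟩
    (x ^ q + y ^ q) ^ (q ℕ.^ k) ≈⟨ ^q^-+ k _ _ ⟩
    (x ^ q) ^ (q ℕ.^ k) + (y ^ q) ^ (q ℕ.^ k) ≈⟨ +-cong (^-q^suc k x) (^-q^suc k y) ⟨
    x ^ (q ℕ.^ suc k) + y ^ (q ℕ.^ suc k) ∎

  ^q^-* : ∀ k c x → (C c * x) ^ (q ℕ.^ k) ≈ C c * x ^ (q ℕ.^ k)
  ^q^-* zero c x = trans (*-identityʳ _) (*-congˡ (sym (*-identityʳ _)))
  ^q^-* (suc k) c x = begin
    (C c * x) ^ (q ℕ.^ suc k) ≈⟨ ^-q^suc k _ ⟩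
    ((C c * x) ^ q) ^ (q ℕ.^ k) ≈⟨ ^-congˡ (q ℕ.^ k) (frobenius-* c x) ⟩
    (C c * x ^ q) ^ (q ℕ.^ k) ≈⟨ ^q^-* k c _ ⟩
    C c * (x ^ q) ^ (q ℕ.^ k) ≈⟨ *-congˡ (^-q^suc k x) ⟨
    C c * x ^ (q ℕ.^ suc k) ∎

  ev-cong : ∀ {k} (cs : Vec R.Carrier k) {x y} → x ≈ y → ev cs x ≈ ev cs y
  ev-cong [] e = refl
  ev-cong {suc k} (c ∷ cs) e = +-cong (*-congˡ (^-congˡ (q ℕ.^ k) e)) (ev-cong cs e)

  ev-+ : ∀ {k} (cs : Vec R.Carrier k) x y → ev cs (x + y) ≈ ev cs x + ev cs y
  ev-+ [] x y = sym (+-identityʳ _)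
  ev-+ {suc k} (c ∷ cs) x y = trans (+-cong (*-congˡ (^q^-+ k x y)) (ev-+ cs x y))
    (solve 5 (λ c a b d e → c :* (a :+ b) :+ (d :+ e) := (c :* a :+ d) :+ (c :* b :+ e)) refl c _ _ _ _)

  ev-* : ∀ {k} (cs : Vec R.Carrier k) a x → ev cs (C a * x) ≈ C a * ev cs x
  ev-* [] a x = sym (zeroʳ _)
  ev-* {suc k} (c ∷ cs) a x = trans (+-cong (*-congˡ (^q^-* k a x)) (ev-* cs a x))
    (solve 4 (λ c a x e → c :* (a :* x) :+ a :* e := a :* (c :* x :+ e)) refl c (C a) _ _)

  ev-0 : ∀ {k} (cs : Vec R.Carrier k) → ev cs R.0# ≈ R.0#
  ev-0 cs = begin
    ev cs R.0# ≈⟨ ev-cong cs (zeroʳ (C 0#)) ⟨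
    ev cs (C 0# * R.0#) ≈⟨ ev-* cs 0# _ ⟩
    C 0# * ev cs R.0# ≈⟨ trans (*-congʳ C-0) (zeroˡ _) ⟩
    R.0# ∎

  ev-sum : ∀ {k} (cs : Vec R.Carrier k) {B : Set} (xs : List B) (f : B → R.Carrier) → ev cs (⨁ xs f) ≈ ⨁ xs (λ x → ev cs (f x))
  ev-sum cs [] f = ev-0 cs
  ev-sum cs (x ∷ xs) f = trans (ev-+ cs _ _) (+-congˡ (ev-sum cs xs f))

  ev-lin : ∀ {k} (cs : Vec R.Carrier k) v → lin v (λ i → ev cs (X i)) ≈ ev cs (ι v)
  ev-lin cs v = sym (trans (ev-cong cs (ι-lin v)) (trans (ev-sum cs fins _) (⨁-cong fins λ i → ev-* cs _ _)))

  ev-zipWith-+ : ∀ {k} (cs ds : Vec R.Carrier k) x → ev (zipWith _+_ cs ds) x ≈ ev cs x + ev ds x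
  ev-zipWith-+ [] [] x = sym (+-identityʳ _)
  ev-zipWith-+ (c ∷ cs) (d ∷ ds) x = trans (+-congˡ (ev-zipWith-+ cs ds x))
    (solve 5 (λ c d y a b → (c :+ d) :* y :+ (a :+ b) := (c :* y :+ a) :+ (d :* y :+ b)) refl c d _ _ _)

  ev-map-* : ∀ {k} a (cs : Vec R.Carrier k) x → ev (V.map (a *_) cs) x ≈ a * ev cs x
  ev-map-* a [] x = sym (zeroʳ _)
  ev-map-* a (c ∷ cs) x = trans (+-congˡ (ev-map-* a cs x))
    (solve 4 (λ a c y e → (a :* c) :* y :+ a :* e := a :* (c :* y :+ e)) refl a c _ _)

  ev-zeros : ∀ {k} (cs : Vec R.Carrier k) → (∀ j → lookup cs j ≈ R.0#) → ∀ x → ev cs x ≈ R.0#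
  ev-zeros [] h x = refl
  ev-zeros (c ∷ cs) h x = trans (+-cong (trans (*-congʳ (h zero)) (zeroˡ _)) (ev-zeros cs (h ∘ suc) x)) (+-identityˡ _)

  -- Frobenius is additive, so the power is taken term by term: each coefficient is raised to the
  -- q-th power, each exponent q^j becomes q^(j+1), and the new last entry, the coefficient of T, is
  -- 0.
  ev-frobenius : ∀ {k} (cs : Vec R.Carrier k) → Σ[ ds ∈ Vec R.Carrier (suc k) ] (∀ x → ev ds x ≈ ev cs x ^ q)
  ev-frobenius [] = R.0# ∷ [] , λ x → trans (+-identityʳ _) (trans (zeroˡ _) (sym (trans (^-congʳ R.0# q≡) (zeroˡ _))))
    where q≡ = proj₂ F.2≤q
  ev-frobenius {suc k} (c ∷ cs) with ev-frobenius cs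
  ... | ds , ev-ds = c ^ q ∷ ds , λ x → begin
    c ^ q * x ^ (q ℕ.^ suc k) + ev ds x ≈⟨ +-cong (*-congˡ (trans (^-congʳ x (ℕₚ.*-comm q _)) (sym (^-assocʳ x (q ℕ.^ k) q)))) (ev-ds x) ⟩
    c ^ q * (x ^ (q ℕ.^ k)) ^ q + ev cs x ^ q ≈⟨ +-congʳ (^-distrib-* c _ q) ⟨
    (c * x ^ (q ℕ.^ k)) ^ q + ev cs x ^ q ≈⟨ frobenius-+ _ _ ⟨
    (c * x ^ (q ℕ.^ k) + ev cs x) ^ q ∎

  -- All exponents q^j are positive. At x = `ι h` this says that every combination of the θⱼ
  -- satisfies the divisibility condition at the hyperplane ker h.
  ∣-ev : ∀ {k} (cs : Vec R.Carrier k) x → x ∣ ev cs x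
  ∣-ev [] x = R.0# , sym (zeroʳ x)
  ∣-ev {suc k} (c ∷ cs) x = ∣-+ (∣-* c (x ^ (q ℕ.^ k ∸ 1) , ^-congʳ x (≡.sym (ℕₚ.m+[n∸m]≡n (ℕₚ.m^n>0 q ⦃ ℕ.>-nonZero F.0<q ⦄ k))))) (∣-ev cs x)

  record LinearMap (η : Vect ℓ → R.Carrier) : Set where
    field
      η-add : ∀ v w → η (addV v w) ≈ η v + η w
      η-scale : ∀ c v → η (scaleV c v) ≈ C c * η v

    η-zero : η zeroV ≈ R.0#
    η-zero = trans (reflexive (cong η (≡.sym (scaleV-0# zeroV)))) (trans (η-scale 0# zeroV) (trans (*-congʳ C-0) (zeroˡ _)))

    η-sub : ∀ v w → η (v -ᵛ w) ≈ η v - η w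
    η-sub v w = trans (η-add v _) (+-congˡ (trans (η-scale (F.- 1#) w) (trans (*-congʳ (trans (C-neg 1#) (-‿cong C-1)))
      (solve 1 (λ x → (:- con (+ 1)) :* x := :- x) refl (η w)))))

  ι-linear : LinearMap ι
  ι-linear = record { η-add = ι-add ; η-scale = ι-scale }

  lin-linear : ∀ δ → LinearMap (λ v → lin v δ)
  lin-linear δ = record { η-add = λ v w → lin-add v w δ ; η-scale = λ c v → lin-scale c v δ }

  ev-linear : ∀ {k} (cs : Vec R.Carrier k) {η} → LinearMap η → LinearMap (λ v → ev cs (η v))
  ev-linear cs linear = record
    { η-add = λ v w → trans (ev-cong cs (η-add v w)) (ev-+ cs _ _)
    ; η-scale = λ c v → trans (ev-cong cs (η-scale c v)) (ev-* cs c _) }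
    where open LinearMap linear

  -‿linear : ∀ {η θ} → LinearMap η → LinearMap θ → LinearMap (λ v → η v - θ v)
  -‿linear {η} {θ} l l′ = record
    { η-add = λ v w → trans (+-cong (M.η-add v w) (-‿cong (M′.η-add v w)))
        (solve 4 (λ a b c d → a :+ b :- (c :+ d) := (a :- c) :+ (b :- d)) refl (η v) (η w) (θ v) (θ w))
    ; η-scale = λ c v → trans (+-cong (M.η-scale c v) (-‿cong (M′.η-scale c v)))
        (solve 3 (λ a b c → a :* b :- a :* c := a :* (b :- c)) refl (C c) (η v) (θ v)) }
    where module M = LinearMap l
          module M′ = LinearMap l′

  σ-linear : ∀ {α p nz η} → LinearMap η → LinearMap (λ v → σ α p nz (η v))
  σ-linear linear = record
    { η-add = λ v w → trans (σ-cong (η-add v w)) (σ-+ _ _)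
    ; η-scale = λ c v → trans (σ-cong (η-scale c v)) (trans (σ-* _ _) (*-congʳ (σ-C c))) }
    where open LinearMap linear

  ι-zero : ι zeroV ≈ R.0#
  ι-zero = LinearMap.η-zero ι-linear

  σ-0 : ∀ {α p nz} → σ α p nz R.0# ≈ R.0#
  σ-0 = trans (σ-cong (sym C-0)) (trans (σ-C 0#) C-0)

  σ-self : ∀ {α p nz} → σ α p nz (ι α) ≈ R.0#
  σ-self {α} {p} {nz} = trans (σ-ι α) (trans (reflexive (cong ι (reduce-self α p nz))) ι-zero)

  σ-multiple : ∀ {α p nz f} → ι α ∣ f → σ α p nz f ≈ R.0#
  σ-multiple (g , e) = trans (σ-cong e) (trans (σ-* _ _) (trans (*-congʳ σ-self) (zeroˡ _)))

  -- Together with `σ-multiple` this identifies the kernel of σ with the ideal generated by α, so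
  -- that divisibility by α can be tested by an equation.
  σ-kernel : ∀ {α p nz f} → σ α p nz f ≈ R.0# → ι α ∣ f
  σ-kernel {f = f} e with σ-residue f
  ... | g , e′ = g , trans e′ (trans (+-congʳ e) (+-identityˡ _))

  -- Modulo w the form v becomes its reduction, which is nonzero because v is not a multiple of w.
  -- Nonzero linear forms are regular, so σ f = 0. This is the coprimality of two linear forms.
  ∣-cancel : ∀ {v w f} → w ≢ zeroV → ¬ v ∈⟨ w ⟩ → ι w ∣ ι v * f → ι w ∣ f
  ∣-cancel {v} {w} {f} w≢0 v∉w w∣vf with nonzero-coordinate w w≢0
  ... | p , nz = σ-kernel (ι-regular (reduce w p nz v) (σ w p nz f) (λ e → v∉w (reduce≡0 w p nz v e))
    (trans (*-congʳ (sym (σ-ι v))) (trans (sym (σ-* _ _)) (σ-multiple w∣vf))))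

  -- After division by the first form the quotient is still divisible by each later one, by
  -- `∣-cancel`.
  ∏-divides : ∀ {vs} f → All (_≢ zeroV) vs → AllPairs (λ v w → ¬ v ∈⟨ w ⟩) vs →
    All (λ v → ι v ∣ f) vs → ∏ vs ι ∣ f
  ∏-divides f [] [] [] = f , sym (*-identityˡ f)
  ∏-divides f (_ ∷ ≢0) (v∉ ∷ pairs) ((g , e) ∷ divs)
    with ∏-divides g ≢0 pairs (All.zipWith (λ { ((w≢0 , v∉w) , w∣f) → ∣-cancel w≢0 v∉w (∣-resp e w∣f) }) (All.zip (≢0 , v∉) , divs))
  ... | h , e′ = h , trans e (trans (*-congˡ e′) (sym (*-assoc _ _ _)))

  ∏-regular : ∀ {vs} f → All (_≢ zeroV) vs → ∏ vs ι * f ≈ R.0# → f ≈ R.0#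
  ∏-regular f [] e = trans (sym (*-identityˡ f)) e
  ∏-regular f (v≢0 ∷ ≢0) e = ∏-regular f ≢0 (ι-regular _ _ v≢0 (trans (sym (*-assoc _ _ _)) e))

  ∏-zero : ∀ {B : Set} (xs : List B) (f : B → R.Carrier) {x} → x ∈ xs → f x ≈ R.0# → ∏ xs f ≈ R.0#
  ∏-zero (x ∷ xs) f (here ≡.refl) e = trans (*-congʳ e) (zeroˡ _)
  ∏-zero (x ∷ xs) f (there x∈) e = trans (*-congˡ (∏-zero xs f x∈ e)) (zeroʳ _)

  -- In the inductive step ∏_x (P(T) - x P(u)) = P(T)^q - P(T) P(u)^(q-1), with P the polynomial of the tail.
  subspacePolynomial : ∀ k {E : Vect k → Vect ℓ} → Linear E →
    Σ[ a ∈ Vec R.Carrier k ] (∀ v → ∏ (allVecs k) (λ c → ι (v -ᵛ E c)) ≈ ev (R.1# ∷ a) (ι v))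
  subspacePolynomial zero {E} linear = [] , λ v → begin
    ι (v -ᵛ E []) * R.1# ≈⟨ *-identityʳ _ ⟩
    ι (v -ᵛ E []) ≈⟨ LinearMap.η-sub ι-linear v (E []) ⟩
    ι v - ι (E []) ≈⟨ +-congˡ (-‿cong (trans (reflexive (cong ι (Linear.E-zero linear))) ι-zero)) ⟩
    ι v - R.0# ≈⟨ solve 1 (λ x → x :- con (+ 0) := con (+ 1) :* (x :* con (+ 1)) :+ con (+ 0)) refl (ι v) ⟩
    R.1# * (ι v * R.1#) + R.0# ∎
  subspacePolynomial (suc k) {E} linear with subspacePolynomial k (tail-linear linear)
  ... | a , P-∏ with ev-frobenius a
  ... | a′ , ev-a′ = zipWith _+_ a′ (V.map (b *_) (R.1# ∷ a)) , λ v → begin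
    ∏ (allVecs (suc k)) (λ c → ι (v -ᵛ E c))
      ≈⟨ Prod.⨁-concatMap _ elems _ ⟩
    ∏ elems (λ x → ∏ (map (x ∷_) (allVecs k)) (λ c → ι (v -ᵛ E c)))
      ≈⟨ Prod.⨁-cong elems (λ x → begin
           ∏ (map (x ∷_) (allVecs k)) (λ c → ι (v -ᵛ E c))
             ≡⟨ Prod.⨁-map (x ∷_) (allVecs k) _ ⟩
           ∏ (allVecs k) (λ c → ι (v -ᵛ E (x ∷ c)))
             ≈⟨ Prod.⨁-cong (allVecs k) (λ c → reflexive (cong ι (≡.trans (cong (v -ᵛ_) (E-∷ linear x c)) (sub-addV v _ _)))) ⟩
           ∏ (allVecs k) (λ c → ι (v -ᵛ scaleV x u -ᵛ E (0# ∷ c)))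
             ≈⟨ P-∏ _ ⟩
           P (v -ᵛ scaleV x u)
             ≈⟨ trans (LinearMap.η-sub P-linear v _) (+-congˡ (-‿cong (LinearMap.η-scale P-linear x u))) ⟩
           P v - C x * P u ∎) ⟩
    ∏ elems (λ x → P v - C x * P u)
      ≈⟨ ∏-elems (P v) (P u) ⟩
    P v ^ q - P v * P u ^ (q ∸ 1)
      ≈⟨ +-cong (P^q v) (solve 2 (λ x y → :- (x :* y) := (:- y) :* x) refl (P v) (P u ^ (q ∸ 1))) ⟩
    R.1# * ι v ^ (q ℕ.^ suc k) + ev a′ (ι v) + b * P v
      ≈⟨ trans (+-assoc _ _ _) (+-congˡ (trans (+-congˡ (sym (ev-map-* b (R.1# ∷ a) (ι v)))) (sym (ev-zipWith-+ a′ _ (ι v))))) ⟩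
    ev (R.1# ∷ zipWith _+_ a′ (V.map (b *_) (R.1# ∷ a))) (ι v) ∎
    where
      u = E (1# ∷ zeroV)
      P : Vect ℓ → R.Carrier
      P v = ev (R.1# ∷ a) (ι v)
      P-linear : LinearMap P
      P-linear = ev-linear (R.1# ∷ a) ι-linear
      b = - (P u ^ (q ∸ 1))
      P^q : ∀ v → P v ^ q ≈ R.1# * ι v ^ (q ℕ.^ suc k) + ev a′ (ι v)
      P^q v = begin
        (R.1# * ι v ^ (q ℕ.^ k) + ev a (ι v)) ^ q ≈⟨ frobenius-+ _ _ ⟩
        (R.1# * ι v ^ (q ℕ.^ k)) ^ q + ev a (ι v) ^ q ≈⟨ +-cong (trans (^-congˡ q (*-identityˡ _)) (trans (^-assocʳ (ι v) (q ℕ.^ k) q)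
                                                                 (trans (^-congʳ (ι v) (ℕₚ.*-comm _ q)) (sym (*-identityˡ _))))) (sym (ev-a′ (ι v))) ⟩
        R.1# * ι v ^ (q ℕ.^ suc k) + ev a′ (ι v) ∎

  module Newton {k} {E : Vect (suc k) → Vect ℓ} (linear : Linear E) (inj : HasZeroKernel E) where
    open Linear linear
    E′ : Vect k → Vect ℓ
    E′ c = E (0# ∷ c)
    u = E (1# ∷ zeroV)
    a = proj₁ (subspacePolynomial k (tail-linear linear))

    P : Vect ℓ → R.Carrier
    P v = ev (R.1# ∷ a) (ι v)

    P-linear : LinearMap P
    P-linear = ev-linear (R.1# ∷ a) ι-linear

    P-∏ : ∀ v → ∏ (allVecs k) (λ c → ι (v -ᵛ E′ c)) ≈ P v
    P-∏ = proj₂ (subspacePolynomial k (tail-linear linear))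

    P-vanishes : ∀ c → P (E′ c) ≈ R.0#
    P-vanishes c = trans (sym (P-∏ (E′ c))) (∏-zero (allVecs k) _ (F.allVecs-complete c)
      (trans (reflexive (cong ι (sub-self (E′ c)))) ι-zero))

    P-∷ : ∀ x c → P (E (x ∷ c)) ≈ C x * P u
    P-∷ x c = trans (reflexive (cong P (E-∷ linear x c))) (trans (LinearMap.η-add P-linear _ _)
      (trans (+-cong (LinearMap.η-scale P-linear x u) (P-vanishes c)) (+-identityʳ _)))

    factors : List (Vect ℓ)
    factors = map (λ c → u -ᵛ E′ c) (allVecs k)

    ∏-factors : ∏ factors ι ≈ P u
    ∏-factors = trans (reflexive (Prod.⨁-map _ (allVecs k) ι)) (P-∏ u)

    factor : ∀ c → u -ᵛ E′ c ≡ E (1# ∷ scaleV (F.- 1#) c)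
    factor c = ≡.trans (≡.sym (E-sub _ _)) (cong E (cong₂ _∷_
      (S.solve 1 (λ m → S.con (+ 1) S.:+ m S.:* S.con (+ 0) S.:= S.con (+ 1)) ≡.refl (F.- 1#)) (addV-zeroˡ _)))

    factors-nonzero : All (_≢ zeroV) factors
    factors-nonzero = Allₚ.map⁺ (All.tabulate λ {c} _ e →
      F.0≢1 (≡.sym (Vₚ.∷-injectiveˡ (inj _ (≡.trans (≡.sym (factor c)) e)))))

    -- In the coordinates given by `E` each factor begins with 1, so two proportional factors have
    -- ratio 1 and coincide.
    factors-independent : AllPairs (λ v w → ¬ v ∈⟨ w ⟩) factors
    factors-independent = AllPairsₚ.map⁺ (AllPairs.map distinct (F.allVecs-unique k))
      where
        distinct : ∀ {c d} → c ≢ d → ¬ (u -ᵛ E′ c) ∈⟨ u -ᵛ E′ d ⟩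
        distinct {c} {d} c≢d (t , e) = c≢d (sub-cancel (Vₚ.∷-injectiveʳ same))
          where
            eq : E (1# ∷ scaleV (F.- 1#) c) ≡ E (scaleV t (1# ∷ scaleV (F.- 1#) d))
            eq = ≡.trans (≡.sym (factor c)) (≡.trans e (≡.trans (cong (scaleV t) (factor d)) (≡.sym (E-scale t _))))
            same′ : 1# ∷ scaleV (F.- 1#) c ≡ scaleV t (1# ∷ scaleV (F.- 1#) d)
            same′ = sub≡0 (inj _ (≡.trans (E-sub _ _) (≡.trans (cong (_-ᵛ E (scaleV t (1# ∷ scaleV (F.- 1#) d))) eq) (sub-self _))))
            t≡1 : t ≡ 1#
            t≡1 = ≡.sym (≡.trans (Vₚ.∷-injectiveˡ same′) (F.*-identityʳ t))
            same : 1# ∷ scaleV (F.- 1#) c ≡ 1# ∷ scaleV (F.- 1#) d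
            same = ≡.trans same′ (≡.trans (cong (λ z → scaleV z (1# ∷ scaleV (F.- 1#) d)) t≡1) (scaleV-1# _))
            sub-cancel : ∀ {c d : Vect k} → scaleV (F.- 1#) c ≡ scaleV (F.- 1#) d → c ≡ d
            sub-cancel {c} {d} e = ≡.trans (≡.sym (neg-neg c)) (≡.trans (cong (scaleV (F.- 1#)) e) (neg-neg d))
              where
                neg-neg : ∀ (c : Vect k) → scaleV (F.- 1#) (scaleV (F.- 1#) c) ≡ c
                neg-neg c = ≡.trans (scaleV-assoc _ _ c) (≡.trans (cong (λ z → scaleV z c)
                  (S.solve 0 ((S.:- S.con (+ 1)) S.:* (S.:- S.con (+ 1)) S.:= S.con (+ 1)) ≡.refl)) (scaleV-1# c))

  -- To the interpolant `cs` on the span of all but the first basis vector a multiple g P is added.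
  -- P vanishes on that span W, so only the value at u, the image of the first basis vector, has to
  -- be corrected: g is the error there divided by P(u), the product of all u - w with w ∈ W.
  interpolate : ∀ k {E : Vect k → Vect ℓ} → Linear E → HasZeroKernel E → ∀ {η} → LinearMap η →
    (∀ c → ι (E c) ∣ η (E c)) → Σ[ cs ∈ Vec R.Carrier k ] (∀ c → η (E c) ≈ ev cs (ι (E c)))
  interpolate zero {E} linear inj {η} η-linear div = [] , λ { [] → trans (reflexive (cong η (Linear.E-zero linear))) (LinearMap.η-zero η-linear) }
  interpolate (suc k) {E} linear inj {η} η-linear div
    with interpolate k (tail-linear linear) (tail-kernel linear inj) η-linear (λ c → div (0# ∷ c))
  ... | cs , agrees = g ∷ zipWith _+_ cs (V.map (g *_) a) , values
    where
      open Newton linear inj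
      η′ : Vect ℓ → R.Carrier
      η′ v = η v - ev cs (ι v)
      η′-linear : LinearMap η′
      η′-linear = -‿linear η-linear (ev-linear cs ι-linear)
      module η′ = LinearMap η′-linear
      η′-vanishes : ∀ c → η′ (E′ c) ≈ R.0#
      η′-vanishes c = trans (+-congʳ (agrees c)) (-‿inverseʳ _)
      -- η′ vanishes on the span of the E′ c, hence η′ u = η′ (u - E′ c).
      div′ : ∀ c → ι (u -ᵛ E′ c) ∣ η′ u
      div′ c = ∣-resp (trans (η′.η-sub u (E′ c)) (trans (+-congˡ (-‿cong (η′-vanishes c))) (solve 1 (λ x → x :- con (+ 0) := x) refl (η′ u))))
        (subst (λ z → ι z ∣ η′ z) (≡.sym (factor c)) (∣-+ (div _) (∣-neg (∣-ev cs _))))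
        where
          ∣-neg : ∀ {a b} → a ∣ b → a ∣ - b
          ∣-neg {a} (g , e) = - g , trans (-‿cong e) (solve 2 (λ a g → :- (a :* g) := a :* (:- g)) refl a g)
      divides : ∏ factors ι ∣ η′ u
      divides = ∏-divides (η′ u) factors-nonzero factors-independent (Allₚ.map⁺ (All.tabulate λ {c} _ → div′ c))
      g = proj₁ divides
      η′u : η′ u ≈ P u * g
      η′u = trans (proj₂ divides) (*-congʳ ∏-factors)
      values : ∀ c → η (E c) ≈ ev (g ∷ zipWith _+_ cs (V.map (g *_) a)) (ι (E c))
      values (x ∷ c) = begin
        η w ≈⟨ solve 2 (λ a b → a := (a :- b) :+ b) refl (η w) (ev cs (ι w)) ⟩
        η′ w + ev cs (ι w) ≈⟨ +-congʳ (trans (reflexive (cong η′ (E-∷ linear x c))) (trans (η′.η-add _ _) (+-cong (η′.η-scale x u) (η′-vanishes c)))) ⟩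
        C x * η′ u + R.0# + ev cs (ι w) ≈⟨ +-congʳ (+-congʳ (*-congˡ η′u)) ⟩
        C x * (P u * g) + R.0# + ev cs (ι w) ≈⟨ solve 4 (λ x p g e → x :* (p :* g) :+ con (+ 0) :+ e := g :* (x :* p) :+ e) refl (C x) (P u) g _ ⟩
        g * (C x * P u) + ev cs (ι w) ≈⟨ +-congʳ (*-congˡ (P-∷ x c)) ⟨
        g * P w + ev cs (ι w) ≈⟨ solve 4 (λ g y e f → g :* (con (+ 1) :* y :+ e) :+ f := g :* y :+ (f :+ g :* e)) refl g (ι w ^ (q ℕ.^ k)) (ev a (ι w)) _ ⟩
        g * ι w ^ (q ℕ.^ k) + (ev cs (ι w) + g * ev a (ι w)) ≈⟨ +-congˡ (trans (+-congˡ (sym (ev-map-* g a _))) (sym (ev-zipWith-+ cs _ _))) ⟩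
        ev (g ∷ zipWith _+_ cs (V.map (g *_) a)) (ι w) ∎
        where w = E (x ∷ c)

  -- Subtracting t P, with t the leading coefficient and P the subspace polynomial, leaves a
  -- polynomial `ds` of lower degree that vanishes on the smaller subspace, hence is 0 by induction.
  -- What remains is t P(u) = 0, where P(u) is a product of nonzero linear forms.
  interpolation-unique : ∀ k {E : Vect k → Vect ℓ} → Linear E → HasZeroKernel E → (cs : Vec R.Carrier k) →
    (∀ c → ev cs (ι (E c)) ≈ R.0#) → ∀ j → lookup cs j ≈ R.0#
  interpolation-unique (suc k) {E} linear inj (t ∷ ts) zeros = λ { zero → t≈0 ; (suc j) → ts≈0 j }
    where
      open Newton linear inj
      ds = zipWith _+_ ts (V.map ((- t) *_) a)
      split : ∀ y → ev (t ∷ ts) y ≈ t * ev (R.1# ∷ a) y + ev ds y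
      split y = sym (trans (+-congˡ (trans (ev-zipWith-+ ts _ y) (+-congˡ (ev-map-* (- t) a y))))
        (solve 4 (λ t z e f → t :* (con (+ 1) :* z :+ e) :+ (f :+ (:- t) :* e) := t :* z :+ f) refl t (y ^ (q ℕ.^ k)) (ev a y) (ev ts y)))
      ds≈0 : ∀ j → lookup ds j ≈ R.0#
      ds≈0 = interpolation-unique k (tail-linear linear) (tail-kernel linear inj) ds λ c → begin
        ev ds (ι (E′ c)) ≈⟨ solve 2 (λ a b → b := con (+ 0) :* a :+ b) refl t _ ⟩
        R.0# * t + ev ds (ι (E′ c)) ≈⟨ +-congʳ (trans (*-congʳ (sym (P-vanishes c))) (*-comm _ _)) ⟩
        t * P (E′ c) + ev ds (ι (E′ c)) ≈⟨ split _ ⟨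
        ev (t ∷ ts) (ι (E′ c)) ≈⟨ zeros (0# ∷ c) ⟩
        R.0# ∎
      t≈0 : t ≈ R.0#
      t≈0 = ∏-regular t factors-nonzero (begin
        ∏ factors ι * t ≈⟨ trans (*-congʳ ∏-factors) (*-comm _ _) ⟩
        t * P u ≈⟨ +-identityʳ _ ⟨
        t * P u + R.0# ≈⟨ +-congˡ (ev-zeros ds ds≈0 _) ⟨
        t * P u + ev ds (ι u) ≈⟨ split _ ⟨
        ev (t ∷ ts) (ι u) ≈⟨ zeros _ ⟩
        R.0# ∎)
      ts≈0 : ∀ j → lookup ts j ≈ R.0#
      ts≈0 j = begin
        lookup ts j ≈⟨ solve 2 (λ t b → t := t :+ (:- con (+ 0)) :* b) refl (lookup ts j) (lookup a j) ⟩
        lookup ts j + (- R.0#) * lookup a j ≈⟨ +-congˡ (*-congʳ (-‿cong t≈0)) ⟨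
        lookup ts j + (- t) * lookup a j ≡⟨ ≡.trans (Vₚ.lookup-zipWith _+_ j ts _) (cong (λ z → lookup ts j + z) (Vₚ.lookup-map j _ a)) ⟨
        lookup ds j ≈⟨ ds≈0 j ⟩
        R.0# ∎

-- The basis for the arrangement of all hyperplanes, and its change under deletion.

module Deletion {q : ℕ} (𝔽 : FiniteField q) {l : ℕ} (R : CommutativeRing 0ℓ 0ℓ) (scalars : Scalars 𝔽 R)
    (forms : LinearForms 𝔽 (suc l) R scalars) where
  private module F = Field 𝔽
  open F using (Vect; addV; scaleV; zeroV; 0#; 1#; geometric)
  open CommutativeRing R hiding (zero; 0#; 1#; Carrier)
  private module R = CommutativeRing R
  open Scalars scalars
  open LinearCombinations 𝔽 {suc l} R scalars
  open LinearForms forms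
  open Interpolation 𝔽 R scalars forms
  open IntegerSolver R
  open Algebra.Properties.Semiring.Exp semiring
  open Relation.Binary.Reasoning.Setoid setoid
  open BigSum R using (⨁; ⨁-cong; ⨁-kronecker; ⨁-suc; ⨁-∙; ⨁-distribˡ)
  private module S = F.F-Solver

  e : Fin (suc l) → Vect (suc l)
  e i = tabulate (λ j → if does (j ≟F i) then 1# else 0#)

  lin-e : ∀ i δ → lin (e i) δ ≈ δ i
  lin-e i δ = trans (⨁-cong fins pick) (⨁-kronecker _≟F_ (Uₚ.allFin⁺ (suc l)) (∈ₚ.∈-allFin i) δ)
    where
      pick : ∀ j → C (lookup (e i) j) * δ j ≈ (if does (j ≟F i) then δ j else R.0#)
      pick j = trans (*-congʳ (reflexive (cong C (Vₚ.lookup∘tabulate (λ k → if does (k ≟F i) then 1# else 0#) j)))) (cases (does (j ≟F i)))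
        where
          cases : ∀ b → C (if b then 1# else 0#) * δ j ≈ (if b then δ j else R.0#)
          cases true = trans (*-congʳ C-1) (*-identityˡ _)
          cases false = trans (*-congʳ C-0) (zeroˡ _)

  ι-e : ∀ i → ι (e i) ≈ X i
  ι-e i = trans (ι-lin (e i)) (lin-e i X)

  Derivation : Set
  Derivation = Fin (suc l) → R.Carrier

  InD : List (Vect (suc l)) → Derivation → Set
  InD Hs δ = ∀ {h} → h ∈ Hs → ι h ∣ lin h δ

  -- A homogeneous basis of D made of θⱼ for j < l and one further element `δ`. The θⱼ are common to
  -- all arrangements and enter only through `ev`; `degree` equates the sum of the exponents with
  -- the number of hyperplanes.
  record Basis (Hs : List (Vect (suc l))) : Set where
    field
      d : ℕ
      δ : Derivation
      homogeneous : ∀ i → π d (δ i) ≈ δ i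
      inD : InD Hs δ
      generates : ∀ η → InD Hs η → Σ[ cs ∈ Vec R.Carrier l ] Σ[ h ∈ R.Carrier ] (∀ i → η i ≈ ev cs (X i) + h * δ i)
      independent : ∀ (cs : Vec R.Carrier l) h → (∀ i → ev cs (X i) + h * δ i ≈ R.0#) → (∀ j → lookup cs j ≈ R.0#) × h ≈ R.0#
      degree : d ℕ.+ geometric l ≡ length Hs

  π-0 : ∀ d → π d R.0# ≈ R.0#
  π-0 d = x+x≈x⇒x≈0 (π d R.0#) (trans (sym (π-+ d R.0# R.0#)) (π-cong (+-identityˡ R.0#)))
    where open Algebra.Properties.Ring (CommutativeRing.ring R) using () renaming (x+x≈x⇒x≈0 to x+x≈x⇒x≈0)

  π-^ : ∀ v n → π n (ι v ^ n) ≈ ι v ^ n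
  π-^ v zero = π-1
  π-^ v (suc n) = trans (π-ι-suc n v _) (*-congˡ (π-^ v n))

  -- The component of degree d - n, which is 0 if n > d.
  shiftedπ : ℕ → ℕ → R.Carrier → R.Carrier
  shiftedπ zero d f = π d f
  shiftedπ (suc n) zero f = R.0#
  shiftedπ (suc n) (suc d) f = shiftedπ n d f

  π-^-* : ∀ v n d f → π d (ι v ^ n * f) ≈ ι v ^ n * shiftedπ n d f
  π-^-* v zero d f = trans (π-cong (*-identityˡ f)) (sym (*-identityˡ _))
  π-^-* v (suc n) zero f = trans (π-cong (*-assoc _ _ _)) (trans (π-ι-zero v _) (sym (zeroʳ _)))
  π-^-* v (suc n) (suc d) f = trans (π-cong (*-assoc _ _ _)) (trans (π-ι-suc d v _)
    (trans (*-congˡ (π-^-* v n d f)) (sym (*-assoc _ _ _))))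

  -- Since θⱼ(v) is the power v^(q^j), passing to the part of degree d replaces the coefficient of
  -- θⱼ by its part of degree d - q^j. The new coefficients do not depend on v, so the result is
  -- again a combination of the θⱼ.
  π-ev : ∀ d {k} (cs : Vec R.Carrier k) → Σ[ cs′ ∈ Vec R.Carrier k ] (∀ v → π d (ev cs (ι v)) ≈ ev cs′ (ι v))
  π-ev d [] = [] , λ v → π-0 d
  π-ev d {suc k} (c ∷ cs) with π-ev d cs
  ... | cs′ , eq = shiftedπ (q ℕ.^ k) d c ∷ cs′ , λ v → trans (π-+ d _ _) (+-cong
    (trans (π-cong (*-comm _ _)) (trans (π-^-* v (q ℕ.^ k) d c) (*-comm _ _))) (eq v))

  π-multiple : ∀ v {f} → ι v ∣ f → π 0 f ≈ R.0#
  π-multiple v (g , eq) = trans (π-cong eq) (π-ι-zero v g)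

  -- If every form is a multiple of some member of `Hs`, then membership in D means that v divides
  -- η(v) for all v. Interpolation on the whole dual space then gives generation, its uniqueness
  -- gives independence, and the further element is θ_l of degree q^l.
  full-basis : ∀ Hs → (∀ v → v ≢ zeroV → Σ[ h ∈ Vect (suc l) ] h ∈ Hs × v ∈⟨ h ⟩) → length Hs ≡ geometric (suc l) → Basis Hs
  full-basis Hs covers len = record
    { d = q ℕ.^ l
    ; δ = θ
    ; homogeneous = λ i → trans (π-cong (^-congˡ (q ℕ.^ l) (sym (ι-e i)))) (trans (π-^ (e i) (q ℕ.^ l)) (^-congˡ (q ℕ.^ l) (ι-e i)))
    ; inD = λ {h} _ → ∣-resp (trans (sym (ev-lin top h)) (⨁-cong fins λ i → *-congˡ (ev-top (X i)))) (∣-ev top (ι h))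
    ; generates = gen
    ; independent = ind
    ; degree = ≡.trans (ℕₚ.+-comm (q ℕ.^ l) _) (≡.sym len) }
    where
      θ : Derivation
      θ i = X i ^ (q ℕ.^ l)
      top : Vec R.Carrier (suc l)
      top = R.1# ∷ V.replicate l R.0#
      ev-top : ∀ x → ev top x ≈ x ^ (q ℕ.^ l)
      ev-top x = trans (+-cong (*-identityˡ _) (ev-zeros (V.replicate l R.0#) (λ j → reflexive (Vₚ.lookup-replicate j R.0#)) x)) (+-identityʳ _)
      gen : ∀ η → InD Hs η → Σ[ cs ∈ Vec R.Carrier l ] Σ[ h ∈ R.Carrier ] (∀ i → η i ≈ ev cs (X i) + h * θ i)
      gen η η∈ = split (interpolate (suc l) id-linear (λ _ eq → eq) (lin-linear η) divides)
        where
          divides : ∀ c → ι c ∣ lin c η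
          divides c with Vₚ.≡-dec F._≟_ c zeroV
          ... | yes ≡.refl = R.0# , trans (LinearMap.η-zero (lin-linear η)) (sym (zeroʳ _))
          ... | no c≢0 with covers c c≢0
          ...   | h , h∈ , a , ≡.refl = proj₁ (η∈ h∈) , trans (lin-scale a h η) (trans (*-congˡ (proj₂ (η∈ h∈)))
                  (trans (sym (*-assoc _ _ _)) (*-congʳ (sym (ι-scale a h)))))
          split : Σ[ cs ∈ Vec R.Carrier (suc l) ] (∀ c → lin c η ≈ ev cs (ι c)) →
            Σ[ cs ∈ Vec R.Carrier l ] Σ[ h ∈ R.Carrier ] (∀ i → η i ≈ ev cs (X i) + h * θ i)
          split (c ∷ cs , eq) = cs , c , λ i → trans (sym (lin-e i η)) (trans (eq (e i)) (trans (ev-cong (c ∷ cs) (ι-e i)) (+-comm _ _)))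
      ind : ∀ (cs : Vec R.Carrier l) h → (∀ i → ev cs (X i) + h * θ i ≈ R.0#) → (∀ j → lookup cs j ≈ R.0#) × h ≈ R.0#
      ind cs h zeros = (λ j → unique (suc j)) , unique zero
        where
          unique : ∀ j → lookup (h ∷ cs) j ≈ R.0#
          unique = interpolation-unique (suc l) id-linear (λ _ eq → eq) (h ∷ cs) λ v → begin
            ev (h ∷ cs) (ι v) ≈⟨ ev-lin (h ∷ cs) v ⟨
            lin v (λ i → ev (h ∷ cs) (X i)) ≈⟨ lin-cong v (λ i → trans (+-comm _ _) (zeros i)) ⟩
            lin v (λ i → R.0#) ≈⟨ lin-cong v (λ i → sym (zeroˡ R.0#)) ⟩
            lin v (λ i → R.0# * R.0#) ≈⟨ lin-* v R.0# _ ⟩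
            R.0# * lin v (λ i → R.0#) ≈⟨ zeroˡ _ ⟩
            R.0# ∎

  module Hyperplane (p : Fin (suc l)) where
    -- Forms without x_p. When α_p ≠ 0 they are a complement of the line of α, hence a copy of the
    -- dual space of ker α.
    insert : Vect l → Vect (suc l)
    insert c = V.insertAt c p 0#

    insert-linear : Linear insert
    insert-linear = record { E-add = add p ; E-scale = scale p }
      where
        add : ∀ {k} (p : Fin (suc k)) (v w : Vect k) → V.insertAt (addV v w) p 0# ≡ addV (V.insertAt v p 0#) (V.insertAt w p 0#)
        add zero v w = cong (_∷ addV v w) (≡.sym (F.+-identityˡ 0#))
        add (suc p) (x ∷ v) (y ∷ w) = cong (_ ∷_) (add p v w)
        scale : ∀ {k} (p : Fin (suc k)) c (v : Vect k) → V.insertAt (scaleV c v) p 0# ≡ scaleV c (V.insertAt v p 0#)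
        scale zero c v = cong (_∷ scaleV c v) (≡.sym (F.zeroʳ c))
        scale (suc p) c (x ∷ v) = cong (_ ∷_) (scale p c v)

    insert-kernel : HasZeroKernel insert
    insert-kernel c eq = vec-ext λ j → ≡.trans (≡.sym (Vₚ.insertAt-punchIn c p 0# j))
      (≡.trans (cong (λ z → lookup z (punchIn p j)) eq) (≡.trans (lookup-zeroV (punchIn p j)) (≡.sym (lookup-zeroV j))))

    insert-at : ∀ c → lookup (insert c) p ≡ 0#
    insert-at c = Vₚ.insertAt-lookup c p 0#

    insert-remove : ∀ v → lookup v p ≡ 0# → insert (V.removeAt v p) ≡ v
    insert-remove v eq = ≡.trans (cong (V.insertAt (V.removeAt v p) p) (≡.sym eq)) (Vₚ.insertAt-removeAt v p)

  -- The dual formulation of the condition that the subspace α = w = 0 of codimension two lies in a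
  -- hyperplane from `As`: some member of `As` is in the span of α and w.
  Blocking : List (Vect (suc l)) → Set
  Blocking As = ∀ α w → α ≢ zeroV → ¬ w ∈⟨ α ⟩ →
    Σ[ h ∈ Vect (suc l) ] h ∈ As × Σ[ a ∈ F.Carrier ] Σ[ b ∈ F.Carrier ] h ≡ addV (scaleV a w) (scaleV b α)

  -- Deleting ker α: on ker α every hyperplane is still cut out by the remaining arrangement, so
  -- modulo α the derivation δ is a combination Σ gⱼ θⱼ, and δ - Σ gⱼ θⱼ = α δ′.
  delete : ∀ α Hs → Blocking Hs → All (_≢ zeroV) (α ∷ Hs) → AllPairs (λ v w → ¬ v ∈⟨ w ⟩) (α ∷ Hs) → Basis (α ∷ Hs) → Basis Hs
  delete α Hs blocking (α≢0 ∷ Hs≢0) (α∉ ∷ _) basis = new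
    where
      open Basis basis
      p = proj₁ (nonzero-coordinate α α≢0)
      nz = proj₂ (nonzero-coordinate α α≢0)
      open Hyperplane p
      σα = σ α p nz
      η̄ : Vect (suc l) → R.Carrier
      η̄ v = σα (lin v δ)
      η̄-linear : LinearMap η̄
      η̄-linear = σ-linear (lin-linear δ)
      module η̄ = LinearMap η̄-linear

      η̄-α : η̄ α ≈ R.0#
      η̄-α = σ-multiple (inD (here ≡.refl))

      σ-ι-fixed : ∀ w → lookup w p ≡ 0# → σα (ι w) ≈ ι w
      σ-ι-fixed w eq = trans (σ-ι w) (reflexive (cong ι (reduce-fixed α p nz w eq)))

      w∉α : ∀ w → w ≢ zeroV → lookup w p ≡ 0# → ¬ w ∈⟨ α ⟩
      w∉α w w≢0 w-p (a , ≡.refl) = w≢0 (≡.trans (cong (λ z → scaleV z α) a≡0) (scaleV-0# α))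
        where
          a≡0 : a ≡ 0#
          a≡0 = F.*-cancel-0 nz (≡.trans (F.*-comm _ _) (≡.trans (≡.sym (lookup-scaleV a α p)) w-p))

      -- The blocking condition gives h = a w + b α among the remaining forms. Modulo α both h and
      -- δ(h) are the a-fold of w and δ(w), so h ∣ δ(h) becomes w ∣ δ(w) modulo α.
      divides : ∀ c → ι (insert c) ∣ η̄ (insert c)
      divides c with Vₚ.≡-dec F._≟_ (insert c) zeroV
      ... | yes w≡0 = R.0# , trans (reflexive (cong η̄ w≡0)) (trans η̄.η-zero (sym (zeroʳ _)))
      ... | no w≢0 with blocking α (insert c) α≢0 (w∉α (insert c) w≢0 (insert-at c))
      ...   | h , h∈ , a , b , h≡ = σα g * C a⁻¹ * C a , (begin
        η̄ w ≈⟨ *-identityˡ _ ⟨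
        R.1# * η̄ w ≈⟨ *-congʳ a⁻¹a ⟨
        C a⁻¹ * C a * η̄ w ≈⟨ *-assoc _ _ _ ⟩
        C a⁻¹ * (C a * η̄ w) ≈⟨ *-congˡ (expand η̄-linear η̄-α) ⟨
        C a⁻¹ * η̄ h ≈⟨ *-congˡ (trans (σ-cong (proj₂ (inD (there h∈)))) (σ-* _ _)) ⟩
        C a⁻¹ * (σα (ι h) * σα g) ≈⟨ *-congˡ (*-congʳ (trans (expand (σ-linear ι-linear) σ-self) (*-congˡ (σ-ι-fixed w (insert-at c))))) ⟩
        C a⁻¹ * (C a * ι w * σα g) ≈⟨ solve 4 (λ i a w g → i :* (a :* w :* g) := w :* (g :* i :* a)) refl (C a⁻¹) (C a) (ι w) (σα g) ⟩
        ι w * (σα g * C a⁻¹ * C a) ∎)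
        where
          w = insert c
          g = proj₁ (inD (there h∈))
          -- Otherwise h would be a multiple of α, but ker α is not among the remaining hyperplanes.
          a≢0 : a ≢ 0#
          a≢0 a≡0 = All.lookup α∉ h∈ (∈⟨⟩-sym (All.lookup Hs≢0 h∈) (b , ≡.trans h≡
            (≡.trans (cong (λ z → addV (scaleV z w) (scaleV b α)) a≡0) (≡.trans (cong (λ z → addV z (scaleV b α)) (scaleV-0# w)) (addV-zeroˡ _)))))
          a⁻¹ = F.inv a a≢0
          a⁻¹a : C a⁻¹ * C a ≈ R.1#
          a⁻¹a = trans (sym (C-* _ _)) (trans (reflexive (cong C (≡.trans (F.*-comm _ _) (F.x*inv a a≢0)))) C-1)
          expand : ∀ {ζ} → LinearMap ζ → ζ α ≈ R.0# → ζ h ≈ C a * ζ w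
          expand {ζ} linear ζα = trans (reflexive (cong ζ h≡)) (trans (η-add _ _) (trans (+-cong (η-scale a w)
            (trans (η-scale b α) (trans (*-congˡ ζα) (zeroʳ _)))) (+-identityʳ _)))
            where open LinearMap linear

      interpolant = interpolate l insert-linear insert-kernel η̄-linear divides
      gs = proj₁ interpolant

      -- Here v = w + b α with w free of x_p. On w the interpolant agrees with δ modulo α, and on b
      -- α both values are multiples of α.
      residue : ∀ v → ι α ∣ lin v δ - ev gs (ι v)
      residue v = proj₁ (σ-residue (lin v δ)) - C b * proj₁ α∣evα , (begin
        lin v δ - ev gs (ι v)
          ≈⟨ +-cong (proj₂ (σ-residue (lin v δ))) (-‿cong (trans (reflexive (cong (ev gs ∘ ι) v≡)) (trans (LinearMap.η-add (ev-linear gs ι-linear) w _) (+-congˡ (LinearMap.η-scale (ev-linear gs ι-linear) b α))))) ⟩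
        η̄ v + ι α * g₀ - (ev gs (ι w) + C b * ev gs (ι α))
          ≈⟨ +-cong (+-congʳ η̄v) (-‿cong (+-congˡ (*-congˡ (proj₂ α∣evα)))) ⟩
        ev gs (ι w) + ι α * g₀ - (ev gs (ι w) + C b * (ι α * proj₁ α∣evα))
          ≈⟨ solve 5 (λ x a g b k → x :+ a :* g :- (x :+ b :* (a :* k)) := a :* (g :- b :* k)) refl (ev gs (ι w)) (ι α) g₀ (C b) (proj₁ α∣evα) ⟩
        ι α * (g₀ - C b * proj₁ α∣evα) ∎)
        where
          g₀ = proj₁ (σ-residue {α} {p} {nz} (lin v δ))
          α∣evα = ∣-ev gs (ι α)
          w = reduce α p nz v
          b = lookup v p F.* F.inv (lookup α p) nz
          v≡ : v ≡ addV w (scaleV b α)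
          v≡ = vec-ext λ i → ≡.sym (≡.trans (lookup-addV w _ i) (≡.trans (cong₂ F._+_ (lookup-reduce α p nz v i) (lookup-scaleV b α i))
            (S.solve 3 (λ v b a → v S.:+ (S.:- b) S.:* a S.:+ b S.:* a S.:= v) ≡.refl (lookup v i) b (lookup α i))))
          c = V.removeAt w p
          w≡ : insert c ≡ w
          w≡ = insert-remove w (reduce-at α p nz v)
          η̄v : η̄ v ≈ ev gs (ι w)
          η̄v = begin
            η̄ v ≡⟨ cong η̄ v≡ ⟩
            η̄ (addV w (scaleV b α)) ≈⟨ trans (η̄.η-add w _) (+-congˡ (trans (η̄.η-scale b α) (trans (*-congˡ η̄-α) (zeroʳ _)))) ⟩
            η̄ w + R.0# ≈⟨ +-identityʳ _ ⟩
            η̄ w ≡⟨ cong η̄ w≡ ⟨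
            η̄ (insert c) ≈⟨ proj₂ interpolant c ⟩
            ev gs (ι (insert c)) ≡⟨ cong (ev gs ∘ ι) w≡ ⟩
            ev gs (ι w) ∎

      quotients : Fin (suc l) → R.Carrier
      quotients i = proj₁ (residue (e i))

      δ≈ : ∀ i → δ i ≈ ev gs (ι (e i)) + ι α * quotients i
      δ≈ i = begin
        δ i ≈⟨ lin-e i δ ⟨
        lin (e i) δ ≈⟨ solve 2 (λ a b → a := b :+ (a :- b)) refl _ (ev gs (ι (e i))) ⟩
        ev gs (ι (e i)) + (lin (e i) δ - ev gs (ι (e i))) ≈⟨ +-congˡ (proj₂ (residue (e i))) ⟩
        ev gs (ι (e i)) + ι α * quotients i ∎

      -- The interpolant is replaced by its part in degree d, so that the quotient by α becomes
      -- homogeneous of degree d - 1.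
      πgs = π-ev d gs
      gs′ = proj₁ πgs

      δ≈π : ∀ i → δ i ≈ ev gs′ (X i) + π d (ι α * quotients i)
      δ≈π i = begin
        δ i ≈⟨ homogeneous i ⟨
        π d (δ i) ≈⟨ trans (π-cong (δ≈ i)) (π-+ d _ _) ⟩
        π d (ev gs (ι (e i))) + π d (ι α * quotients i) ≈⟨ +-congʳ (trans (proj₂ πgs (e i)) (ev-cong gs′ (ι-e i))) ⟩
        ev gs′ (X i) + π d (ι α * quotients i) ∎

      δ≉0 : (∀ i → δ i ≈ R.0#) → ⊥
      δ≉0 zeros = 1≉0 (proj₂ (independent (V.replicate l R.0#) R.1# λ i → trans
        (+-cong (ev-zeros (V.replicate l R.0#) (λ j → reflexive (Vₚ.lookup-replicate j R.0#)) (X i)) (trans (*-identityˡ _) (zeros i))) (+-identityˡ _)))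

      new : Basis Hs
      new = with-degree d ≡.refl
        where
          with-degree : ∀ d₀ → d ≡ d₀ → Basis Hs
          -- In degree 0 this would force δ = 0: values of the θⱼ and multiples of α have no
          -- constant term. A member of a basis is nonzero, since 1 ≠ 0.
          with-degree zero d≡ = ⊥-elim (δ≉0 λ i → begin
            δ i ≈⟨ homogeneous i ⟨
            π d (δ i) ≡⟨ cong (λ z → π z (δ i)) d≡ ⟩
            π 0 (δ i) ≈⟨ trans (π-cong (δ≈ i)) (π-+ 0 _ _) ⟩
            π 0 (ev gs (ι (e i))) + π 0 (ι α * quotients i) ≈⟨ +-cong (π-multiple (e i) (∣-ev gs (ι (e i)))) (π-ι-zero α _) ⟩
            R.0# + R.0# ≈⟨ +-identityˡ _ ⟩
            R.0# ∎)
          with-degree (suc d′) d≡ = record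
            { d = d′ ; δ = δ′ ; homogeneous = λ i → π-idem d′ _ ; inD = inD′ ; generates = generates′ ; independent = independent′
            ; degree = ℕₚ.suc-injective (≡.trans (cong (ℕ._+ geometric l) (≡.sym d≡)) degree) }
            where
              δ′ : Derivation
              δ′ i = π d′ (quotients i)

              δ≈δ′ : ∀ i → δ i ≈ ev gs′ (X i) + ι α * δ′ i
              δ≈δ′ i = trans (δ≈π i) (+-congˡ (trans (reflexive (cong (λ z → π z (ι α * quotients i)) d≡)) (π-ι-suc d′ α _)))

              lin-δ′ : ∀ v → ι α * lin v δ′ ≈ lin v δ - ev gs′ (ι v)
              lin-δ′ v = begin
                ι α * lin v δ′ ≈⟨ solve 2 (λ a b → a := (b :+ a) :- b) refl _ (ev gs′ (ι v)) ⟩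
                ev gs′ (ι v) + ι α * lin v δ′ - ev gs′ (ι v) ≈⟨ +-congʳ (+-cong (ev-lin gs′ v) (lin-* v _ δ′)) ⟨
                lin v (λ i → ev gs′ (X i)) + lin v (λ i → ι α * δ′ i) - ev gs′ (ι v) ≈⟨ +-congʳ (lin-+ v _ _) ⟨
                lin v (λ i → ev gs′ (X i) + ι α * δ′ i) - ev gs′ (ι v) ≈⟨ +-congʳ (lin-cong v δ≈δ′) ⟨
                lin v δ - ev gs′ (ι v) ∎

              -- α δ′(h) = δ(h) - Σ gⱼ θⱼ(h) is divisible by h, and h is coprime to α.
              inD′ : InD Hs δ′
              inD′ {h} h∈ = ∣-cancel (All.lookup Hs≢0 h∈) (All.lookup α∉ h∈) (∣-resp (sym (lin-δ′ h))
                (∣-+ (inD (there h∈)) (∣-resp (solve 1 (λ x → (:- con (+ 1)) :* x := :- x) refl _) (∣-* (- R.1#) (∣-ev gs′ (ι h))))))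

              -- α η lies in D of the larger arrangement. In its expansion there, δ is replaced by Σ
              -- gⱼ θⱼ + α δ′; the part that remains, Σ kⱼ θⱼ, is a multiple of α. Once every kⱼ is
              -- known to be a multiple of α, the factor α cancels.
              generates′ : ∀ η → InD Hs η → Σ[ cs ∈ Vec R.Carrier l ] Σ[ h ∈ R.Carrier ] (∀ i → η i ≈ ev cs (X i) + h * δ′ i)
              generates′ η η∈ = ms , h , λ i → a-b≈0 (ι-regular α _ α≢0 (begin
                ι α * (η i - (ev ms (X i) + h * δ′ i))
                  ≈⟨ solve 5 (λ a η m h d → a :* (η :- (m :+ h :* d)) := (a :* η :- h :* (a :* d)) :- a :* m) refl (ι α) (η i) (ev ms (X i)) h (δ′ i) ⟩
                (ι α * η i - h * (ι α * δ′ i)) - ι α * ev ms (X i)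
                  ≈⟨ +-cong (ev-ks i) (-‿cong (trans (sym (ev-map-* (ι α) ms (X i))) (sym (ev-cong₂ ks (V.map (ι α *_) ms) ks≈ (X i))))) ⟩
                ev ks (X i) - ev ks (X i)
                  ≈⟨ -‿inverseʳ _ ⟩
                R.0# ∎))
                where
                  a-b≈0 : ∀ {a b} → a - b ≈ R.0# → a ≈ b
                  a-b≈0 {a} {b} eq = trans (solve 2 (λ a b → a := (a :- b) :+ b) refl a b) (trans (+-congʳ eq) (+-identityˡ b))
                  ev-cong₂ : ∀ {k} (cs ds : Vec R.Carrier k) → (∀ j → lookup cs j ≈ lookup ds j) → ∀ x → ev cs x ≈ ev ds x
                  ev-cong₂ [] [] h x = refl
                  ev-cong₂ (c ∷ cs) (d ∷ ds) h x = +-cong (*-congʳ (h zero)) (ev-cong₂ cs ds (h ∘ suc) x)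
                  αη∈ : InD (α ∷ Hs) (λ i → ι α * η i)
                  αη∈ (here ≡.refl) = lin α η , lin-* α _ η
                  αη∈ {h} (there h∈) = ∣-resp (sym (lin-* h (ι α) η)) (∣-* (ι α) (η∈ h∈))
                  combination = generates (λ i → ι α * η i) αη∈
                  hs = proj₁ combination
                  h = proj₁ (proj₂ combination)
                  ks = zipWith _+_ hs (V.map (h *_) gs′)
                  ev-ks : ∀ i → ι α * η i - h * (ι α * δ′ i) ≈ ev ks (X i)
                  ev-ks i = begin
                    ι α * η i - h * (ι α * δ′ i)
                      ≈⟨ +-congʳ (trans (proj₂ (proj₂ combination) i) (+-congˡ (*-congˡ (δ≈δ′ i)))) ⟩
                    ev hs (X i) + h * (ev gs′ (X i) + ι α * δ′ i) - h * (ι α * δ′ i)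
                      ≈⟨ solve 4 (λ x h g d → x :+ h :* (g :+ d) :- h :* d := x :+ h :* g) refl (ev hs (X i)) h (ev gs′ (X i)) (ι α * δ′ i) ⟩
                    ev hs (X i) + h * ev gs′ (X i)
                      ≈⟨ sym (trans (ev-zipWith-+ hs (V.map (h *_) gs′) (X i)) (+-congˡ (ev-map-* h gs′ (X i)))) ⟩
                    ev ks (X i) ∎
                  α∣ev-ks : ∀ v → ι α ∣ ev ks (ι v)
                  α∣ev-ks v = lin v η - h * lin v δ′ , (begin
                    ev ks (ι v) ≈⟨ ev-lin ks v ⟨
                    lin v (λ i → ev ks (X i)) ≈⟨ lin-cong v (λ i → trans (sym (ev-ks i))
                                                                                 (solve 4 (λ a η h d → a :* η :- h :* (a :* d) := a :* (η :+ (:- h) :* d)) refl (ι α) (η i) h (δ′ i))) ⟩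
                    lin v (λ i → ι α * (η i + (- h) * δ′ i)) ≈⟨ lin-* v (ι α) _ ⟩
                    ι α * lin v (λ i → η i + (- h) * δ′ i) ≈⟨ *-congˡ (trans (lin-+ v η _) (+-congˡ (lin-* v (- h) δ′))) ⟩
                    ι α * (lin v η + (- h) * lin v δ′) ≈⟨ *-congˡ (+-congˡ (solve 2 (λ h d → (:- h) :* d := :- (h :* d)) refl h _)) ⟩
                    ι α * (lin v η - h * lin v δ′) ∎)
                  σ-^ : ∀ x n → σα (x ^ n) ≈ σα x ^ n
                  σ-^ x zero = trans (σ-cong (sym C-1)) (trans (σ-C 1#) C-1)
                  σ-^ x (suc n) = trans (σ-* _ _) (*-congˡ (σ-^ x n))
                  σ-ev : ∀ {k} (cs : Vec R.Carrier k) x → σα (ev cs x) ≈ ev (V.map σα cs) (σα x)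
                  σ-ev [] x = σ-0
                  σ-ev {suc k} (c ∷ cs) x = trans (σ-+ _ _) (+-cong (trans (σ-* _ _) (*-congˡ (σ-^ x (q ℕ.^ k)))) (σ-ev cs x))
                  -- σ fixes the forms without x_p, so the additive polynomial with coefficients σ
                  -- kⱼ vanishes on all of them, and uniqueness of interpolation on this subspace
                  -- applies.
                  σ-ks≈0 : ∀ j → lookup (V.map σα ks) j ≈ R.0#
                  σ-ks≈0 = interpolation-unique l insert-linear insert-kernel (V.map σα ks) λ c → begin
                    ev (V.map σα ks) (ι (insert c)) ≈⟨ ev-cong (V.map σα ks) (σ-ι-fixed (insert c) (insert-at c)) ⟨
                    ev (V.map σα ks) (σα (ι (insert c))) ≈⟨ σ-ev ks (ι (insert c)) ⟨
                    σα (ev ks (ι (insert c))) ≈⟨ σ-multiple (α∣ev-ks (insert c)) ⟩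
                    R.0# ∎
                  α∣ks : ∀ j → ι α ∣ lookup ks j
                  α∣ks j = σ-kernel (trans (reflexive (≡.sym (Vₚ.lookup-map j σα ks))) (σ-ks≈0 j))
                  ms = tabulate (λ j → proj₁ (α∣ks j))
                  ks≈ : ∀ j → lookup ks j ≈ lookup (V.map (ι α *_) ms) j
                  ks≈ j = trans (proj₂ (α∣ks j)) (reflexive (≡.sym (≡.trans (Vₚ.lookup-map j (ι α *_) ms) (cong (ι α *_) (Vₚ.lookup∘tabulate (λ j → proj₁ (α∣ks j)) j)))))

              -- Multiplied by α, a relation with δ′ turns into one with δ, because α δ′ = δ - Σ gⱼ
              -- θⱼ. This gives h = 0 first, and then α times each entry of `cs` is 0.
              independent′ : ∀ (cs : Vec R.Carrier l) h → (∀ i → ev cs (X i) + h * δ′ i ≈ R.0#) → (∀ j → lookup cs j ≈ R.0#) × h ≈ R.0#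
              independent′ cs h zeros = (λ j → ι-regular α _ α≢0 (begin
                ι α * lookup cs j ≈⟨ solve 3 (λ a b c → a := a :+ (:- con (+ 0)) :* c) refl _ h (lookup gs′ j) ⟩
                ι α * lookup cs j + (- R.0#) * lookup gs′ j ≈⟨ +-congˡ (*-congʳ (-‿cong h≈0)) ⟨
                ι α * lookup cs j + (- h) * lookup gs′ j ≡⟨ ≡.trans (Vₚ.lookup-zipWith _+_ j αcs hgs) (cong₂ _+_ (Vₚ.lookup-map j (ι α *_) cs) (Vₚ.lookup-map j ((- h) *_) gs′)) ⟨
                lookup ks j ≈⟨ proj₁ zero-combination j ⟩
                R.0# ∎)) , h≈0
                where
                  αcs = V.map (ι α *_) cs
                  hgs = V.map ((- h) *_) gs′
                  ks = zipWith _+_ αcs hgs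
                  zero-combination = independent ks h λ i → begin
                    ev ks (X i) + h * δ i
                      ≈⟨ +-cong (trans (ev-zipWith-+ αcs hgs (X i)) (+-cong (ev-map-* (ι α) cs (X i)) (ev-map-* (- h) gs′ (X i)))) (*-congˡ (δ≈δ′ i)) ⟩
                    ι α * ev cs (X i) + (- h) * ev gs′ (X i) + h * (ev gs′ (X i) + ι α * δ′ i)
                      ≈⟨ solve 5 (λ a c h g d → a :* c :+ (:- h) :* g :+ h :* (g :+ a :* d) := a :* (c :+ h :* d)) refl (ι α) (ev cs (X i)) h (ev gs′ (X i)) (δ′ i) ⟩
                    ι α * (ev cs (X i) + h * δ′ i)
                      ≈⟨ trans (*-congˡ (zeros i)) (zeroʳ _) ⟩
                    R.0# ∎
                  h≈0 = proj₂ zero-combination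

  delete-all : ∀ Bs As → Blocking As → All (_≢ zeroV) (Bs ++ As) → AllPairs (λ v w → ¬ v ∈⟨ w ⟩) (Bs ++ As) → Basis (Bs ++ As) → Basis As
  delete-all [] As blocking ≢0 pairs basis = basis
  delete-all (α ∷ Bs) As blocking ≢0@(_ ∷ ≢0′) pairs@(_ ∷ pairs′) basis = delete-all Bs As blocking ≢0′ pairs′
    (delete α (Bs ++ As) (λ α w α≢0 w∉ → let (h , h∈ , r) = blocking α w α≢0 w∉ in h , ∈ₚ.∈-++⁺ʳ Bs h∈ , r) ≢0 pairs basis)

  -- Index j has exponent k - 1 - j, because `ev` takes the leading coefficient first.
  exponent : ∀ {k} → Fin k → ℕ
  exponent {suc k} zero = k
  exponent {suc k} (suc j) = exponent j

  ev-⨁ : ∀ {k} (f : Fin k → R.Carrier) x → ev (tabulate f) x ≈ ⨁ (allFin k) (λ j → f j * x ^ (q ℕ.^ exponent j))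
  ev-⨁ {zero} f x = refl
  ev-⨁ {suc k} f x = +-congˡ (trans (ev-⨁ (f ∘ suc) x) (sym (⨁-suc (λ j → f j * x ^ (q ℕ.^ exponent j)))))

  module FreeBasis {Hs} (basis : Basis Hs) where
    open Basis basis

    θ : Fin (suc l) → Derivation
    θ zero = δ
    θ (suc j) i = X i ^ (q ℕ.^ exponent j)

    degreeθ : Fin (suc l) → ℕ
    degreeθ zero = d
    degreeθ (suc j) = q ℕ.^ exponent j

    θ-homogeneous : ∀ j i → π (degreeθ j) (θ j i) ≈ θ j i
    θ-homogeneous zero i = homogeneous i
    θ-homogeneous (suc j) i = trans (π-cong (^-congˡ (q ℕ.^ exponent j) (sym (ι-e i))))
      (trans (π-^ (e i) (q ℕ.^ exponent j)) (^-congˡ (q ℕ.^ exponent j) (ι-e i)))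

    θ-inD : ∀ j → InD Hs (θ j)
    θ-inD zero = inD
    θ-inD (suc j) {h} _ = ∣-resp (trans (sym (ev-lin cs h)) (lin-cong h λ i → monomial j (X i))) (∣-ev cs (ι h))
      where
        unit : ∀ {k} → Fin k → Vec R.Carrier k
        unit {suc k} zero = R.1# ∷ V.replicate k R.0#
        unit {suc k} (suc j) = R.0# ∷ unit j
        monomial : ∀ {k} (j : Fin k) x → ev (unit j) x ≈ x ^ (q ℕ.^ exponent j)
        monomial {suc k} zero x = trans (+-cong (*-identityˡ _) (ev-zeros (V.replicate k R.0#) (λ j → reflexive (Vₚ.lookup-replicate j R.0#)) x)) (+-identityʳ _)
        monomial {suc k} (suc j) x = trans (+-cong (zeroˡ _) (monomial j x)) (+-identityˡ _)
        cs = unit j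

    combination : (Fin (suc l) → R.Carrier) → Derivation
    combination f i = ⨁ (allFin (suc l)) (λ j → f j * θ j i)

    combination-ev : ∀ f i → combination f i ≈ ev (tabulate (f ∘ suc)) (X i) + f zero * δ i
    combination-ev f i = trans (+-congˡ (trans (⨁-suc (λ j → f j * θ j i)) (sym (ev-⨁ (f ∘ suc) (X i))))) (+-comm _ _)

    θ-generates : ∀ η → InD Hs η → Σ[ f ∈ (Fin (suc l) → R.Carrier) ] (∀ i → η i ≈ combination f i)
    θ-generates η η∈ with generates η η∈
    ... | cs , h , eq = f , λ i → trans (eq i) (sym (trans (combination-ev f i)
        (+-congʳ (reflexive (cong (λ z → ev z (X i)) (Vₚ.tabulate∘lookup cs))))))
      where
        f : Fin (suc l) → R.Carrier
        f zero = h
        f (suc j) = lookup cs j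

    θ-independent : ∀ f g → (∀ i → combination f i ≈ combination g i) → ∀ j → f j ≈ g j
    θ-independent f g eq = λ { zero → a-b≈0 (proj₂ zeros) ; (suc j) → a-b≈0 (trans (reflexive (≡.sym (Vₚ.lookup∘tabulate (λ j → f (suc j) - g (suc j)) j))) (proj₁ zeros j)) }
      where
        a-b≈0 : ∀ {a b} → a - b ≈ R.0# → a ≈ b
        a-b≈0 {a} {b} eq = trans (solve 2 (λ a b → a := (a :- b) :+ b) refl a b) (trans (+-congʳ eq) (+-identityˡ b))
        zeros = independent (tabulate λ j → f (suc j) - g (suc j)) (f zero - g zero) λ i → begin
          ev (tabulate λ j → f (suc j) - g (suc j)) (X i) + (f zero - g zero) * δ i
            ≈⟨ combination-ev (λ j → f j - g j) i ⟨
          combination (λ j → f j - g j) i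
            ≈⟨ ⨁-cong (allFin (suc l)) (λ j → solve 3 (λ f g t → (f :- g) :* t := f :* t :+ (:- con (+ 1)) :* (g :* t)) refl (f j) (g j) (θ j i)) ⟩
          ⨁ (allFin (suc l)) (λ j → f j * θ j i + (- R.1#) * (g j * θ j i))
            ≈⟨ trans (⨁-∙ (allFin (suc l)) _ _) (+-congˡ (sym (⨁-distribˡ (allFin (suc l)) (- R.1#) _))) ⟩
          combination f i + (- R.1#) * combination g i
            ≈⟨ +-congʳ (eq i) ⟩
          combination g i + (- R.1#) * combination g i
            ≈⟨ solve 1 (λ x → x :+ (:- con (+ 1)) :* x := con (+ 0)) refl (combination g i) ⟩
          R.0# ∎

-- Reflection of Boolean tests, evaluation of forms, dimension of subspaces.

module Booleans where
  ∧-true : ∀ {a b} → a ∧ b ≡ true → a ≡ true × b ≡ true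
  ∧-true {true} {true} e = ≡.refl , ≡.refl

  true-∧ : ∀ {a b} → a ≡ true → b ≡ true → a ∧ b ≡ true
  true-∧ ≡.refl ≡.refl = ≡.refl

  not-true : ∀ {a} → not a ≡ true → a ≡ false
  not-true {false} e = ≡.refl

  ≢true : ∀ {a} → a ≢ true → a ≡ false
  ≢true {true} h = ⊥-elim (h ≡.refl)
  ≢true {false} h = ≡.refl

  does-true : ∀ {P : Set} (d : Dec P) → does d ≡ true → P
  does-true (yes p) e = p

  true-does : ∀ {P : Set} (d : Dec P) → P → does d ≡ true
  true-does (yes p) _ = ≡.refl
  true-does (no ¬p) p = ⊥-elim (¬p p)

  bool-ext : ∀ {a b} → (a ≡ true → b ≡ true) → (b ≡ true → a ≡ true) → a ≡ b
  bool-ext {true} {b} f g = ≡.sym (f ≡.refl)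
  bool-ext {false} {true} f g = g ≡.refl
  bool-ext {false} {false} f g = ≡.refl

module ListBooleans {q : ℕ} (𝔽 : FiniteField q) where
  open Field 𝔽 using (allB; anyB; filterB)
  open Booleans

  module _ {A : Set} (p : A → Bool) where
    allB-elim : ∀ xs → allB p xs ≡ true → ∀ {x} → x ∈ xs → p x ≡ true
    allB-elim (x ∷ xs) e (here ≡.refl) = proj₁ (∧-true e)
    allB-elim (x ∷ xs) e (there x∈) = allB-elim xs (proj₂ (∧-true e)) x∈

    allB-intro : ∀ xs → (∀ {x} → x ∈ xs → p x ≡ true) → allB p xs ≡ true
    allB-intro [] h = ≡.refl
    allB-intro (x ∷ xs) h = true-∧ (h (here ≡.refl)) (allB-intro xs (h ∘ there))

    allB-false : ∀ xs → allB p xs ≡ false → Σ[ x ∈ A ] x ∈ xs × p x ≡ false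
    allB-false (x ∷ xs) e with p x in px
    ... | false = x , here ≡.refl , px
    ... | true with allB-false xs e
    ...   | y , y∈ , py = y , there y∈ , py

    anyB-elim : ∀ xs → anyB p xs ≡ true → Σ[ x ∈ A ] x ∈ xs × p x ≡ true
    anyB-elim (x ∷ xs) e with p x in px
    ... | true = x , here ≡.refl , px
    ... | false with anyB-elim xs e
    ...   | y , y∈ , py = y , there y∈ , py

    anyB-intro : ∀ {xs x} → x ∈ xs → p x ≡ true → anyB p xs ≡ true
    anyB-intro {x ∷ xs} (here ≡.refl) px rewrite px = ≡.refl
    anyB-intro {x ∷ xs} (there x∈) px with p x
    ... | true = ≡.refl
    ... | false = anyB-intro x∈ px

    anyB-false : ∀ {xs} → anyB p xs ≡ false → ∀ {x} → x ∈ xs → p x ≡ false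
    anyB-false e x∈ = ≢true λ px → true≢false (≡.trans (≡.sym (anyB-intro x∈ px)) e)
      where
        true≢false : true ≢ false
        true≢false ()

    ∈-filterB : ∀ xs {x} → x ∈ filterB p xs → x ∈ xs × p x ≡ true
    ∈-filterB (y ∷ xs) x∈ with p y in py
    ∈-filterB (y ∷ xs) (here ≡.refl) | true = here ≡.refl , py
    ∈-filterB (y ∷ xs) (there x∈) | true = let (a , b) = ∈-filterB xs x∈ in there a , b
    ∈-filterB (y ∷ xs) x∈ | false = let (a , b) = ∈-filterB xs x∈ in there a , b

    filterB-∈ : ∀ {xs x} → x ∈ xs → p x ≡ true → x ∈ filterB p xs
    filterB-∈ {y ∷ xs} (here ≡.refl) px rewrite px = here ≡.refl
    filterB-∈ {y ∷ xs} (there x∈) px with p y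
    ... | true = there (filterB-∈ x∈ px)
    ... | false = filterB-∈ x∈ px

    filterB-all : ∀ {P : A → Set} {xs} → All P xs → All P (filterB p xs)
    filterB-all [] = []
    filterB-all {xs = x ∷ xs} (px ∷ pxs) with p x
    ... | true = px ∷ filterB-all pxs
    ... | false = filterB-all pxs

    filterB-unique : ∀ {xs} → Unique xs → Unique (filterB p xs)
    filterB-unique [] = []
    filterB-unique {x ∷ xs} (x∉ ∷ u) with p x
    ... | true = filterB-all x∉ ∷ filterB-unique u
    ... | false = filterB-unique u

  module _ {A : Set} where
    length-filterB : ∀ (p : A → Bool) xs → length (filterB p xs) ≤ length xs
    length-filterB p [] = z≤n
    length-filterB p (x ∷ xs) with p x
    ... | true = s≤s (length-filterB p xs)
    ... | false = ℕₚ.m≤n⇒m≤1+n (length-filterB p xs)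

    filterB-mono : ∀ (p p′ : A → Bool) → (∀ x → p x ≡ true → p′ x ≡ true) → ∀ xs → length (filterB p xs) ≤ length (filterB p′ xs)
    filterB-mono p p′ h [] = z≤n
    filterB-mono p p′ h (x ∷ xs) with p x in px | p′ x in p′x
    ... | true | true = s≤s (filterB-mono p p′ h xs)
    ... | false | true = ℕₚ.m≤n⇒m≤1+n (filterB-mono p p′ h xs)
    ... | false | false = filterB-mono p p′ h xs
    ... | true | false with ≡.trans (≡.sym (h x px)) p′x
    ...   | ()

    filterB-strict : ∀ (p p′ : A → Bool) → (∀ x → p x ≡ true → p′ x ≡ true) → ∀ {xs y} → y ∈ xs → p y ≡ false → p′ y ≡ true →
      length (filterB p xs) < length (filterB p′ xs)
    filterB-strict p p′ h {y ∷ xs} (here ≡.refl) py p′y rewrite py | p′y = s≤s (filterB-mono p p′ h xs)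
    filterB-strict p p′ h {x ∷ xs} (there y∈) py p′y with p x in px | p′ x in p′x
    ... | true | true = s≤s (filterB-strict p p′ h y∈ py p′y)
    ... | false | true = ℕₚ.m≤n⇒m≤1+n (filterB-strict p p′ h y∈ py p′y)
    ... | false | false = filterB-strict p p′ h y∈ py p′y
    ... | true | false with ≡.trans (≡.sym (h x px)) p′x
    ...   | ()

module Evaluation {q : ℕ} (𝔽 : FiniteField q) where
  open Field 𝔽 hiding (_^_)
  open Vectors 𝔽
  open Booleans
  open ListBooleans 𝔽
  open F-Solver

  eval-comm : ∀ {k} (α v : Vect k) → eval α v ≡ eval v α
  eval-comm α v = cong (V.foldr _ _+_ 0#) (Vₚ.zipWith-comm *-comm α v)

  eval-addʳ : ∀ {k} (α v w : Vect k) → eval α (addV v w) ≡ eval α v + eval α w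
  eval-addʳ [] [] [] = ≡.sym (+-identityˡ 0#)
  eval-addʳ (a ∷ α) (x ∷ v) (y ∷ w) = ≡.trans (cong (λ z → a * (x + y) + z) (eval-addʳ α v w))
    (solve 5 (λ a x y e f → a :* (x :+ y) :+ (e :+ f) := (a :* x :+ e) :+ (a :* y :+ f)) ≡.refl a x y _ _)

  eval-scaleʳ : ∀ {k} c (α v : Vect k) → eval α (scaleV c v) ≡ c * eval α v
  eval-scaleʳ c [] [] = ≡.sym (zeroʳ c)
  eval-scaleʳ c (a ∷ α) (x ∷ v) = ≡.trans (cong (λ z → a * (c * x) + z) (eval-scaleʳ c α v))
    (solve 4 (λ a c x e → a :* (c :* x) :+ c :* e := c :* (a :* x :+ e)) ≡.refl a c x _)

  eval-addˡ : ∀ {k} (α β v : Vect k) → eval (addV α β) v ≡ eval α v + eval β v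
  eval-addˡ α β v = ≡.trans (eval-comm _ v) (≡.trans (eval-addʳ v α β) (cong₂ _+_ (eval-comm v α) (eval-comm v β)))

  eval-scaleˡ : ∀ {k} c (α v : Vect k) → eval (scaleV c α) v ≡ c * eval α v
  eval-scaleˡ c α v = ≡.trans (eval-comm _ v) (≡.trans (eval-scaleʳ c v α) (cong (c *_) (eval-comm v α)))

  eval-zeroʳ : ∀ {k} (α : Vect k) → eval α zeroV ≡ 0#
  eval-zeroʳ α = ≡.trans (cong (eval α) (≡.sym (scaleV-0# zeroV))) (≡.trans (eval-scaleʳ 0# α zeroV) (zeroˡ _))

  basisV : ∀ {k} → Fin k → Vect k
  basisV zero = 1# ∷ zeroV
  basisV (suc i) = 0# ∷ basisV i

  eval-basisV : ∀ {k} (α : Vect k) i → eval α (basisV i) ≡ lookup α i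
  eval-basisV (a ∷ α) zero = ≡.trans (cong₂ _+_ (*-identityʳ a) (eval-zeroʳ α)) (+-identityʳ a)
  eval-basisV (a ∷ α) (suc i) = ≡.trans (cong₂ _+_ (zeroʳ a) (eval-basisV α i)) (+-identityˡ _)

  isZeroV-true : ∀ {k} (v : Vect k) → isZeroV v ≡ true → v ≡ zeroV
  isZeroV-true [] e = ≡.refl
  isZeroV-true (x ∷ v) e = cong₂ _∷_ (does-true (x ≟ 0#) (proj₁ (∧-true e))) (isZeroV-true v (proj₂ (∧-true {isZero x} e)))

  true-isZeroV : ∀ k → isZeroV (zeroV {k}) ≡ true
  true-isZeroV zero = ≡.refl
  true-isZeroV (suc k) = true-∧ (true-does (0# ≟ 0#) ≡.refl) (true-isZeroV k)

  isZeroV-false : ∀ {k} (v : Vect k) → isZeroV v ≡ false → v ≢ zeroV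
  isZeroV-false {k} v e ≡.refl with ≡.trans (≡.sym (true-isZeroV k)) e
  ... | ()

  length-vecsOver : ∀ {A : Set} (xs : List A) k → length (vecsOver xs k) ≡ length xs ℕ.^ k
  length-vecsOver xs zero = ≡.refl
  length-vecsOver xs (suc k) = ≡.trans (go xs) (cong (length xs ℕ.*_) (length-vecsOver xs k))
    where
      go : ∀ ys → length (concatMap (λ x → map (x ∷_) (vecsOver xs k)) ys) ≡ length ys ℕ.* length (vecsOver xs k)
      go [] = ≡.refl
      go (y ∷ ys) = ≡.trans (Lₚ.length-++ (map (y ∷_) (vecsOver xs k))) (cong₂ ℕ._+_ (Lₚ.length-map (y ∷_) (vecsOver xs k)) (go ys))

  length-allVecs : ∀ k → length (allVecs k) ≡ q ℕ.^ k
  length-allVecs k = ≡.trans (length-vecsOver elems k) (cong (ℕ._^ k) length-elems)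

  lincomb-linear : ∀ {l k} (ws : Vec (Vect l) k) → Linear (λ c → lincomb c ws)
  lincomb-linear {l} ws = record { E-add = add ws ; E-scale = scale ws }
    where
      open ≡.≡-Reasoning
      lookup-∷ : ∀ x (w v : Vect l) i → lookup (addV (scaleV x w) v) i ≡ x * lookup w i + lookup v i
      lookup-∷ x w v i = ≡.trans (lookup-addV (scaleV x w) v i) (cong (λ z → z + lookup v i) (lookup-scaleV x w i))

      add : ∀ {k} (ws : Vec (Vect l) k) c d → lincomb (addV c d) ws ≡ addV (lincomb c ws) (lincomb d ws)
      add [] [] [] = ≡.sym (addV-zeroˡ zeroV)
      add (w ∷ ws) (x ∷ c) (y ∷ d) = vec-ext λ i → begin
        lookup (addV (scaleV (x + y) w) (lincomb (addV c d) ws)) i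
          ≡⟨ lookup-∷ (x + y) w (lincomb (addV c d) ws) i ⟩
        (x + y) * lookup w i + lookup (lincomb (addV c d) ws) i
          ≡⟨ cong (λ z → (x + y) * lookup w i + z) (≡.trans (cong (λ z → lookup z i) (add ws c d)) (lookup-addV (lincomb c ws) (lincomb d ws) i)) ⟩
        (x + y) * lookup w i + (lookup (lincomb c ws) i + lookup (lincomb d ws) i)
          ≡⟨ solve 5 (λ x y w c d → (x :+ y) :* w :+ (c :+ d) := (x :* w :+ c) :+ (y :* w :+ d)) ≡.refl x y (lookup w i) (lookup (lincomb c ws) i) (lookup (lincomb d ws) i) ⟩
        (x * lookup w i + lookup (lincomb c ws) i) + (y * lookup w i + lookup (lincomb d ws) i)
          ≡⟨ cong₂ _+_ (lookup-∷ x w (lincomb c ws) i) (lookup-∷ y w (lincomb d ws) i) ⟨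
        lookup (lincomb (x ∷ c) (w ∷ ws)) i + lookup (lincomb (y ∷ d) (w ∷ ws)) i
          ≡⟨ lookup-addV (lincomb (x ∷ c) (w ∷ ws)) (lincomb (y ∷ d) (w ∷ ws)) i ⟨
        lookup (addV (lincomb (x ∷ c) (w ∷ ws)) (lincomb (y ∷ d) (w ∷ ws))) i ∎

      scale : ∀ {k} (ws : Vec (Vect l) k) a c → lincomb (scaleV a c) ws ≡ scaleV a (lincomb c ws)
      scale [] a [] = ≡.sym (scaleV-zeroV a)
      scale (w ∷ ws) a (x ∷ c) = vec-ext λ i → begin
        lookup (addV (scaleV (a * x) w) (lincomb (scaleV a c) ws)) i
          ≡⟨ lookup-∷ (a * x) w (lincomb (scaleV a c) ws) i ⟩
        a * x * lookup w i + lookup (lincomb (scaleV a c) ws) i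
          ≡⟨ cong (λ z → a * x * lookup w i + z) (≡.trans (cong (λ z → lookup z i) (scale ws a c)) (lookup-scaleV a (lincomb c ws) i)) ⟩
        a * x * lookup w i + a * lookup (lincomb c ws) i
          ≡⟨ solve 4 (λ a x w c → a :* x :* w :+ a :* c := a :* (x :* w :+ c)) ≡.refl a x (lookup w i) (lookup (lincomb c ws) i) ⟩
        a * (x * lookup w i + lookup (lincomb c ws) i)
          ≡⟨ cong (a *_) (lookup-∷ x w (lincomb c ws) i) ⟨
        a * lookup (lincomb (x ∷ c) (w ∷ ws)) i
          ≡⟨ lookup-scaleV a (lincomb (x ∷ c) (w ∷ ws)) i ⟨
        lookup (scaleV a (lincomb (x ∷ c) (w ∷ ws))) i ∎

  independent-elim : ∀ {l k} (ws : Vec (Vect l) k) → independent ws ≡ true → HasZeroKernel (λ c → lincomb c ws)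
  independent-elim {l} {k} ws ind c e with isZeroV c in zc | allB-elim _ (allVecs k) ind (allVecs-complete c)
  ... | true | _ = isZeroV-true c zc
  ... | false | nz = ⊥-elim (isZeroV-false _ (not-true nz) e)

  independent-false : ∀ {l k} (ws : Vec (Vect l) k) → independent ws ≡ false → Σ[ c ∈ Vect k ] c ≢ zeroV × lincomb c ws ≡ zeroV
  independent-false {l} {k} ws dep with allB-false _ (allVecs k) dep
  ... | c , _ , e with isZeroV c in zc | isZeroV (lincomb c ws) in zl
  ...   | false | true = c , isZeroV-false c zc , isZeroV-true _ zl

  -- dimOf is the size of a maximal independent tuple in W, and such a tuple is a basis.
  module Subspace {l} (W : List (Vect l)) (unique : Unique W)
      (closed-add : ∀ {v w} → v ∈ W → w ∈ W → addV v w ∈ W)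
      (closed-scale : ∀ {v} c → v ∈ W → scaleV c v ∈ W)
      (contains-0 : zeroV ∈ W) where

    dims : ℕ → ℕ
    dims k = if anyB independent (vecsOver W k) then k else 0

    lincomb-∈ : ∀ {k} {ws : Vec (Vect l) k} → ws ∈ vecsOver W k → ∀ c → lincomb c ws ∈ W
    lincomb-∈ {zero} {[]} _ [] = contains-0
    lincomb-∈ {suc k} {w ∷ ws} ws∈ (x ∷ c) = closed-add (closed-scale x (proj₁ split)) (lincomb-∈ (proj₂ split) c)
      where
        split : w ∈ W × ws ∈ vecsOver W k
        split with ∈ₚ.∈-cartesianProductWith⁻ _∷_ W (vecsOver W k) (subst (w ∷ ws ∈_) (vecsOver-product W k) ws∈)
        ... | _ , _ , w∈ , ws∈′ , ≡.refl = w∈ , ws∈′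

    lincomb-injective : ∀ {k} (ws : Vec (Vect l) k) → independent ws ≡ true → ∀ {c c′} → lincomb c ws ≡ lincomb c′ ws → c ≡ c′
    lincomb-injective ws ind {c} {c′} e = sub≡0 (independent-elim ws ind (c -ᵛ c′)
      (≡.trans (Linear.E-sub (lincomb-linear ws) c c′) (≡.trans (cong (_-ᵛ lincomb c′ ws) e) (sub-self _))))

    combinations : ∀ {k} → Vec (Vect l) k → List (Vect l)
    combinations {k} ws = map (λ c → lincomb c ws) (allVecs k)

    combinations-unique : ∀ {k} (ws : Vec (Vect l) k) → independent ws ≡ true → Unique (combinations ws)
    combinations-unique {k} ws ind = Uₚ.map⁺ (lincomb-injective ws ind) (allVecs-unique k)

    length-combinations : ∀ {k} (ws : Vec (Vect l) k) → length (combinations ws) ≡ q ℕ.^ k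
    length-combinations {k} ws = ≡.trans (Lₚ.length-map _ (allVecs k)) (length-allVecs k)

    -- By counting: independent vectors have q^k distinct combinations among q^l vectors. The bound
    -- matters because `dimOf` searches only sizes up to l.
    independent-≤ : ∀ {k} (ws : Vec (Vect l) k) → independent ws ≡ true → k ≤ l
    independent-≤ {k} ws ind = ℕₚ.≮⇒≥ λ l<k → ℕₚ.<⇒≱ (ℕₚ.^-monoʳ-< q 1<q l<k)
      (subst₂ _≤_ (length-combinations ws) (length-allVecs l)
        (unique-⊆-length (Vₚ.≡-dec _≟_) (combinations-unique ws ind) (allVecs-unique l) (λ _ → allVecs-complete _)))
      where
        1<q : 1 < q
        1<q = subst (1 <_) (≡.sym (proj₂ 2≤q)) (s≤s (s≤s z≤n))

    module _ {d} (ws : Vec (Vect l) d) (ws∈ : ws ∈ vecsOver W d) (ind : independent ws ≡ true)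
        (maximal : ∀ v → v ∈ W → independent (v ∷ ws) ≡ false) where
      -- In a nontrivial relation between `v` and `ws` the coefficient of `v` is nonzero, as `ws` is
      -- independent, so the relation can be solved for `v`.
      spans : ∀ {v} → v ∈ W → v ∈ combinations ws
      spans {v} v∈ = solution (independent-false (v ∷ ws) (maximal v v∈))
        where
          solution : Σ[ c ∈ Vect (suc d) ] c ≢ zeroV × lincomb c (v ∷ ws) ≡ zeroV → v ∈ combinations ws
          solution (x ∷ c , xc≢0 , e) with x ≟ 0#
          ... | yes ≡.refl = ⊥-elim (xc≢0 (cong (0# ∷_) (independent-elim ws ind c
                (≡.trans (≡.sym (≡.trans (cong (λ z → addV z (lincomb c ws)) (scaleV-0# v)) (addV-zeroˡ _))) e))))
          ... | no x≢0 = subst (_∈ combinations ws) v≡ (∈ₚ.∈-map⁺ (λ c → lincomb c ws) (allVecs-complete (scaleV j c)))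
            where
              j = - inv x x≢0
              v≡ : lincomb (scaleV j c) ws ≡ v
              v≡ = ≡.trans (Linear.E-scale (lincomb-linear ws) j c) (vec-ext λ i → ≡.trans (lookup-scaleV j (lincomb c ws) i) (≡.trans
                (cong (λ z → j * z) (≡.trans (solve 2 (λ a b → b := (a :+ b) :+ :- a) ≡.refl (x * lookup v i) (lookup (lincomb c ws) i))
                  (cong (λ z → z + - (x * lookup v i)) (≡.trans (cong (λ z → z + lookup (lincomb c ws) i) (≡.sym (lookup-scaleV x v i)))
                    (≡.trans (≡.sym (lookup-addV (scaleV x v) (lincomb c ws) i)) (≡.trans (cong (λ z → lookup z i) e) (lookup-zeroV i)))))))
                (≡.trans (solve 3 (λ j x v → (:- j) :* (con (+ 0) :+ :- (x :* v)) := (x :* j) :* v) ≡.refl (inv x x≢0) x (lookup v i))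
                  (≡.trans (cong (_* lookup v i) (x*inv x x≢0)) (*-identityˡ _)))))

      length≡q^ : length W ≡ q ℕ.^ d
      length≡q^ = ≡.trans (↭ₚ.↭-length (unique-↭ unique (combinations-unique ws ind) spans contained)) (length-combinations ws)
        where
          contained : ∀ {v} → v ∈ combinations ws → v ∈ W
          contained v∈ with ∈ₚ.∈-map⁻ (λ c → lincomb c ws) v∈
          ... | c , _ , ≡.refl = lincomb-∈ ws∈ c

    d : ℕ
    d = dimOf W

    private
      ≤-max : ∀ ks {k} → k ∈ ks → dims k ≤ foldr _⊔_ 0 (map dims ks)
      ≤-max (x ∷ ks) (here ≡.refl) = ℕₚ.m≤m⊔n _ _
      ≤-max (x ∷ ks) (there k∈) = ℕₚ.≤-trans (≤-max ks k∈) (ℕₚ.m≤n⊔m (dims x) _)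

      attained : ∀ ks → foldr _⊔_ 0 (map dims ks) ≡ 0 ⊎ Σ[ k ∈ ℕ ] dims k ≡ foldr _⊔_ 0 (map dims ks)
      attained [] = inj₁ ≡.refl
      attained (k ∷ ks) with ℕₚ.⊔-sel (dims k) (foldr _⊔_ 0 (map dims ks))
      ... | inj₁ e = inj₂ (k , ≡.sym e)
      ... | inj₂ e with attained ks
      ...   | inj₁ e′ = inj₁ (≡.trans e e′)
      ...   | inj₂ (k′ , e′) = inj₂ (k′ , ≡.trans e′ (≡.sym e))

    HasIndependent : ℕ → Set
    HasIndependent k = anyB independent (vecsOver W k) ≡ true

    -- The maximum in `dimOf` is either the size of some independent tuple or the default value 0,
    -- and the empty tuple is independent.
    basis-exists : HasIndependent d
    basis-exists with attained (upTo (suc l))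
    ... | inj₁ e = subst HasIndependent (≡.sym e) ≡.refl
    ... | inj₂ (k , e) with anyB independent (vecsOver W k) in any
    ...   | true = subst HasIndependent e any
    ...   | false = subst HasIndependent e ≡.refl

    maximal : ∀ (ws : Vec (Vect l) (suc d)) → ws ∈ vecsOver W (suc d) → independent ws ≡ false
    maximal ws ws∈ = ≢true λ ind → ℕₚ.<-irrefl ≡.refl (subst (_≤ d) (cong (λ b → if b then suc d else 0) (anyB-intro independent ws∈ ind))
      (≤-max (upTo (suc l)) (∈ₚ.∈-upTo⁺ (s≤s (independent-≤ ws ind)))))

    length≡ : length W ≡ q ℕ.^ d
    length≡ = from-basis (anyB-elim independent (vecsOver W d) basis-exists)
      where
        from-basis : Σ[ ws ∈ Vec (Vect l) d ] ws ∈ vecsOver W d × independent ws ≡ true → length W ≡ q ℕ.^ d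
        from-basis (ws , ws∈ , ind) = length≡q^ ws ws∈ ind λ v v∈ → maximal (v ∷ ws)
          (subst (v ∷ ws ∈_) (≡.sym (vecsOver-product W d)) (∈ₚ.∈-cartesianProductWith⁺ _∷_ v∈ ws∈))

-- The Möbius function and the critical problem.

module CriticalProblem {q : ℕ} (𝔽 : FiniteField q) {ℓ n : ℕ} (A : Fin n → Over.Vect 𝔽 ℓ) where
  open Field 𝔽 hiding (_^_; _+_; _*_; -_)
  private module F = FiniteField 𝔽
  open Vectors 𝔽
  open Arrangement A
  open Booleans
  open ListBooleans 𝔽
  open Evaluation 𝔽
  private
    module Z = BigSum ℤₚ.+-*-commutativeRing

  inFlat-elim : ∀ S {v} → inFlat S v ≡ true → ∀ i → lookup S i ≡ true → eval (A i) v ≡ 0#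
  inFlat-elim S {v} e i si = does-true (eval (A i) v ≟ 0#) (≡.trans
    (cong (λ b → if b then isZero (eval (A i) v) else true) (≡.sym si)) (allB-elim _ (allFin n) e (∈ₚ.∈-allFin i)))

  inFlat-intro : ∀ S {v} → (∀ i → lookup S i ≡ true → eval (A i) v ≡ 0#) → inFlat S v ≡ true
  inFlat-intro S {v} h = allB-intro _ (allFin n) λ {i} _ → each i
    where
      each : ∀ i → (if lookup S i then isZero (eval (A i) v) else true) ≡ true
      each i with lookup S i in si
      ... | true = true-does (eval (A i) v ≟ 0#) (h i si)
      ... | false = ≡.refl

  -- This converts the exponent `dim S` in χ into a number of points, which is what makes values of
  -- χ at powers of q countable.
  card-points : ∀ S → length (points S) ≡ q ℕ.^ dim S
  card-points S = Subspace.length≡ (points S) (filterB-unique (inFlat S) (allVecs-unique ℓ)) closed-add closed-scale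
      (∈-points (inFlat-intro S λ i _ → eval-zeroʳ (A i)))
    where
      ∈-points : ∀ {v} → inFlat S v ≡ true → v ∈ points S
      ∈-points = filterB-∈ (inFlat S) (allVecs-complete _)
      points-∈ : ∀ {v} → v ∈ points S → inFlat S v ≡ true
      points-∈ v∈ = proj₂ (∈-filterB (inFlat S) (allVecs ℓ) v∈)
      closed-add : ∀ {v w} → v ∈ points S → w ∈ points S → addV v w ∈ points S
      closed-add {v} {w} v∈ w∈ = ∈-points (inFlat-intro S λ i si → ≡.trans (eval-addʳ (A i) v w)
        (≡.trans (cong₂ F._+_ (inFlat-elim S (points-∈ v∈) i si) (inFlat-elim S (points-∈ w∈) i si)) (+-identityˡ 0#)))
      closed-scale : ∀ {v} c → v ∈ points S → scaleV c v ∈ points S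
      closed-scale {v} c v∈ = ∈-points (inFlat-intro S λ i si → ≡.trans (eval-scaleʳ c (A i) v)
        (≡.trans (cong (c F.*_) (inFlat-elim S (points-∈ v∈) i si)) (zeroʳ c)))

  module _ {S T : Subset} where
    sameFlat-elim : sameFlat S T ≡ true → ∀ v → inFlat S v ≡ inFlat T v
    sameFlat-elim e v = does-true (inFlat S v B≟ inFlat T v) (allB-elim _ (allVecs ℓ) e (allVecs-complete v))

    sameFlat-intro : (∀ v → inFlat S v ≡ inFlat T v) → sameFlat S T ≡ true
    sameFlat-intro h = allB-intro _ (allVecs ℓ) λ {v} _ → true-does (inFlat S v B≟ inFlat T v) (h v)

    flatSub-elim : flatSub S T ≡ true → ∀ v → inFlat S v ≡ true → inFlat T v ≡ true
    flatSub-elim e v Sv = ≡.trans (cong (λ b → not b ∨ inFlat T v) (≡.sym Sv)) (allB-elim _ (allVecs ℓ) e (allVecs-complete v))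

    flatSub-intro : (∀ v → inFlat S v ≡ true → inFlat T v ≡ true) → flatSub S T ≡ true
    flatSub-intro h = allB-intro _ (allVecs ℓ) λ {v} _ → each v
      where
        each : ∀ v → not (inFlat S v) ∨ inFlat T v ≡ true
        each v with inFlat S v in Sv
        ... | true = h v Sv
        ... | false = ≡.refl

  sameFlat-sym : ∀ {S T} → sameFlat S T ≡ true → sameFlat T S ≡ true
  sameFlat-sym {S} {T} e = sameFlat-intro {T} {S} λ v → ≡.sym (sameFlat-elim {S} {T} e v)

  sameFlat-refl : ∀ S → sameFlat S S ≡ true
  sameFlat-refl S = sameFlat-intro {S} {S} λ v → ≡.refl

  sameFlat⇒flatSub : ∀ {S T} → sameFlat S T ≡ true → flatSub S T ≡ true
  sameFlat⇒flatSub {S} {T} e = flatSub-intro {S} {T} λ v Sv → ≡.trans (≡.sym (sameFlat-elim {S} {T} e v)) Sv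

  flatSub-trans : ∀ {S T U} → flatSub S T ≡ true → flatSub T U ≡ true → flatSub S U ≡ true
  flatSub-trans {S} {T} {U} e e′ = flatSub-intro {S} {U} λ v Sv → flatSub-elim {T} {U} e′ v (flatSub-elim {S} {T} e v Sv)

  flatSub-antisym : ∀ {S T} → flatSub S T ≡ true → flatSub T S ≡ true → sameFlat S T ≡ true
  flatSub-antisym {S} {T} e e′ = sameFlat-intro {S} {T} λ v → bool-ext (flatSub-elim {S} {T} e v) (flatSub-elim {T} {S} e′ v)

  private
    true≢false : true ≢ false
    true≢false ()

  below-trans : ∀ {Z Y X} → below Z Y ≡ true → below Y X ≡ true → below Z X ≡ true
  below-trans {Z} {Y} {X} zy yx = true-∧ (flatSub-trans {X} {Y} {Z} X⊆Y Y⊆Z) (cong not (≢true λ X≈Z →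
      true≢false (≡.trans (≡.sym (flatSub-antisym {X} {Y} X⊆Y
        (flatSub-trans {Y} {Z} {X} Y⊆Z (sameFlat⇒flatSub {Z} {X} (sameFlat-sym {X} {Z} X≈Z))))) (not-true (proj₂ (∧-true {flatSub X Y} yx))))))
    where
      X⊆Y = proj₁ (∧-true yx)
      Y⊆Z = proj₁ (∧-true zy)

  below-irrefl : ∀ X → below X X ≡ false
  below-irrefl X = ≢true λ e → true≢false (≡.trans (≡.sym (sameFlat-refl X)) (not-true (proj₂ (∧-true {flatSub X X} e))))

  -- A bound on the recursion depth of `μ-fuel` at `X`, itself at most the length of `latticeL`.
  height : Subset → ℕ
  height X = length (filterB (λ Y → below Y X) latticeL)

  height-< : ∀ {X Y} → Y ∈ latticeL → below Y X ≡ true → height Y < height X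
  height-< {X} {Y} Y∈ yx = filterB-strict (λ Z → below Z Y) (λ Z → below Z X) (λ Z zy → below-trans {Z} {Y} {X} zy yx) Y∈ (below-irrefl Y) yx

  sumℤ-map : ∀ (f : Subset → ℤ) Xs → sumℤ (map f Xs) ≡ Z.⨁ Xs f
  sumℤ-map f [] = ≡.refl
  sumℤ-map f (X ∷ Xs) = cong (λ z → f X ℤ.+ z) (sumℤ-map f Xs)

  lower : Subset → List Subset
  lower X = filterB (λ Y → below Y X) latticeL

  -- Each recursive call moves to an element of smaller height, so fuel beyond the height does not
  -- affect the value.
  μ-stable : ∀ k k′ X → height X < k → height X < k′ → μ-fuel k X ≡ μ-fuel k′ X
  μ-stable (suc k) (suc k′) X (s≤s h) (s≤s h′) = cong (λ z → if isWhole X then + 1 else ℤ.- z)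
    (≡.trans (sumℤ-map (μ-fuel k) (lower X)) (≡.trans (Z.⨁-cong-∈ (lower X) λ Y Y∈ →
        let (Y∈L , yx) = ∈-filterB (λ Y → below Y X) latticeL Y∈
            lt = height-< {X} {Y} Y∈L yx
        in μ-stable k k′ Y (ℕₚ.<-≤-trans lt h) (ℕₚ.<-≤-trans lt h′))
      (≡.sym (sumℤ-map (μ-fuel k′) (lower X)))))

  μ-recursion : ∀ X → isWhole X ≡ false → μ X ≡ ℤ.- Z.⨁ (lower X) μ
  μ-recursion X nw = ≡.trans (cong (λ b → if b then + 1 else ℤ.- sumℤ (map (μ-fuel N) (lower X))) nw)
    (cong ℤ.-_ (≡.trans (sumℤ-map (μ-fuel N) (lower X)) (Z.⨁-cong-∈ (lower X) λ Y Y∈ →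
      let (Y∈L , yx) = ∈-filterB (λ Y → below Y X) latticeL Y∈
          lt = height-< {X} {Y} Y∈L yx
          hX = length-filterB (λ Y → below Y X) latticeL
      in μ-stable N (suc N) Y (ℕₚ.<-≤-trans lt hX) (ℕₚ.<-≤-trans lt (ℕₚ.m≤n⇒m≤1+n hX)))))
    where N = length latticeL

  μ-whole : ∀ X → isWhole X ≡ true → μ X ≡ + 1
  μ-whole X w = cong (λ b → if b then + 1 else ℤ.- sumℤ (map (μ-fuel (length latticeL)) (lower X))) w

  Distinct : List Subset → Set
  Distinct = AllPairs (λ X Y → sameFlat X Y ≡ false)

  dedup-distinct : ∀ acc Ss → Distinct acc → Distinct (dedup acc Ss)
  dedup-distinct acc [] u = u
  dedup-distinct acc (S ∷ Ss) u with anyB (sameFlat S) acc in e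
  ... | true = dedup-distinct acc Ss u
  ... | false = dedup-distinct (S ∷ acc) Ss (All.tabulate (anyB-false (sameFlat S) e) ∷ u)

  dedup-⊇ : ∀ acc Ss {X} → X ∈ acc → X ∈ dedup acc Ss
  dedup-⊇ acc [] X∈ = X∈
  dedup-⊇ acc (S ∷ Ss) X∈ with anyB (sameFlat S) acc
  ... | true = dedup-⊇ acc Ss X∈
  ... | false = dedup-⊇ (S ∷ acc) Ss (there X∈)

  dedup-complete : ∀ acc Ss {S} → S ∈ Ss → Σ[ X ∈ Subset ] X ∈ dedup acc Ss × sameFlat S X ≡ true
  dedup-complete acc (S ∷ Ss) (here ≡.refl) with anyB (sameFlat S) acc in e
  ... | true = let (X , X∈ , same) = anyB-elim (sameFlat S) acc e in X , dedup-⊇ acc Ss X∈ , same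
  ... | false = S , dedup-⊇ (S ∷ acc) Ss (here ≡.refl) , sameFlat-refl S
  dedup-complete acc (S ∷ Ss) (there S∈) with anyB (sameFlat S) acc
  ... | true = dedup-complete acc Ss S∈
  ... | false = dedup-complete (S ∷ acc) Ss S∈

  lattice-distinct : Distinct latticeL
  lattice-distinct = dedup-distinct [] allSubsets []

  -- The subset of hyperplanes through a tuple need not be the one chosen for its flat in
  -- `latticeL`, whereas Möbius sums run over the chosen ones.
  representative : ∀ S → Σ[ X ∈ Subset ] X ∈ latticeL × sameFlat S X ≡ true
  representative S = dedup-complete [] allSubsets (vecsOver-complete S λ i → bool (lookup S i))
    where
      bool : ∀ b → b ∈ true ∷ false ∷ []
      bool true = here ≡.refl
      bool false = there (here ≡.refl)

  sum-same : ∀ {Xs Z} → Distinct Xs → Z ∈ Xs → (f : Subset → ℤ) → Z.⨁ Xs (λ X → if sameFlat Z X then f X else + 0) ≡ f Z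
  sum-same {X ∷ Xs} (≢X ∷ u) (here ≡.refl) f = ≡.trans (cong₂ ℤ._+_ (cong (λ b → if b then f X else + 0) (sameFlat-refl X))
      (≡.trans (Z.⨁-cong-∈ Xs λ Y Y∈ → cong (λ b → if b then f Y else + 0) (All.lookup ≢X Y∈)) (Z.⨁-ε Xs))) (ℤₚ.+-identityʳ (f X))
  sum-same {X ∷ Xs} {Z} (≢X ∷ u) (there Z∈) f = ≡.trans (cong₂ ℤ._+_ (cong (λ b → if b then f X else + 0)
      (≢true λ Z≈X → true≢false (≡.trans (≡.sym (sameFlat-sym {Z} {X} Z≈X)) (All.lookup ≢X Z∈)))) (sum-same u Z∈ f)) (ℤₚ.+-identityˡ (f Z))

  sum-filterB : ∀ {B : Set} (p : B → Bool) xs (f : B → ℤ) → Z.⨁ (filterB p xs) f ≡ Z.⨁ xs (λ x → if p x then f x else + 0)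
  sum-filterB p [] f = ≡.refl
  sum-filterB p (x ∷ xs) f with p x
  ... | true = cong (λ z → f x ℤ.+ z) (sum-filterB p xs f)
  ... | false = ≡.trans (sum-filterB p xs f) (≡.sym (ℤₚ.+-identityˡ _))

  ⟦_⟧ : Bool → ℤ
  ⟦ b ⟧ = if b then + 1 else + 0

  -- The flats that contain Z are Z itself and those below it in the lattice, so the recursion for
  -- μ(Z) makes the sum 0, unless Z is the whole space, where only μ(V) = 1 remains.
  sum-μ : ∀ Z → Z ∈ latticeL → Z.⨁ latticeL (λ X → if flatSub Z X then μ X else + 0) ≡ ⟦ isWhole Z ⟧
  sum-μ Z Z∈ = ≡.trans (Z.⨁-cong latticeL split) (≡.trans (Z.⨁-∙ latticeL (λ X → if below X Z then μ X else + 0) (λ X → if sameFlat Z X then μ X else + 0))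
      (≡.trans (cong₂ ℤ._+_ (≡.sym (sum-filterB (λ X → below X Z) latticeL μ)) (sum-same lattice-distinct Z∈ μ)) (total (isWhole Z) ≡.refl)))
    where
      split : ∀ X → (if flatSub Z X then μ X else + 0) ≡
        (if below X Z then μ X else + 0) ℤ.+ (if sameFlat Z X then μ X else + 0)
      split X with flatSub Z X in sub | sameFlat Z X in same
      ... | true | true = ≡.sym (ℤₚ.+-identityˡ (μ X))
      ... | true | false = ≡.sym (ℤₚ.+-identityʳ (μ X))
      ... | false | false = ≡.refl
      ... | false | true = ⊥-elim (true≢false (≡.trans (≡.sym (sameFlat⇒flatSub {Z} {X} same)) sub))

      total : ∀ b → isWhole Z ≡ b → Z.⨁ (lower Z) μ ℤ.+ μ Z ≡ ⟦ b ⟧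
      total false nw = ≡.trans (cong (λ z → Z.⨁ (lower Z) μ ℤ.+ z) (μ-recursion Z nw)) (ℤₚ.+-inverseʳ (Z.⨁ (lower Z) μ))
      total true w = cong₂ ℤ._+_ (≡.trans (sum-filterB (λ X → below X Z) latticeL μ)
          (≡.trans (Z.⨁-cong latticeL λ X → cong (λ b → if b then μ X else + 0) (none X)) (Z.⨁-ε latticeL))) (μ-whole Z w)
        where
          none : ∀ X → below X Z ≡ false
          none X = ≢true λ b → true≢false (≡.trans (≡.sym (flatSub-antisym {Z} {X} (proj₁ (∧-true b))
            (flatSub-intro {X} {Z} λ v _ → ≡.trans (sameFlat-elim {Z} {emptySubset} w v)
              (inFlat-intro emptySubset λ i ei → ⊥-elim (true≢false (≡.trans (≡.sym ei) (Vₚ.lookup-replicate i false)))))))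
            (not-true (proj₂ (∧-true {flatSub Z X} b))))

  count : ∀ {B : Set} (p : B → Bool) xs → Z.⨁ xs (λ x → ⟦ p x ⟧) ≡ + length (filterB p xs)
  count p [] = ≡.refl
  count p (x ∷ xs) with p x
  ... | true = cong (λ z → + 1 ℤ.+ z) (count p xs)
  ... | false = ≡.trans (ℤₚ.+-identityˡ _) (count p xs)

  allᵛ : ∀ {B : Set} {k} → (B → Bool) → Vec B k → Bool
  allᵛ p τ = allB p (V.toList τ)

  count-tuples : ∀ {B : Set} (p : B → Bool) xs k → Z.⨁ (vecsOver xs k) (λ τ → ⟦ allᵛ p τ ⟧) ≡ + (length (filterB p xs) ℕ.^ k)
  count-tuples p xs zero = ≡.refl
  count-tuples {B} p xs (suc k) = begin
    Z.⨁ (concatMap (λ x → map (x ∷_) (vecsOver xs k)) xs) (λ τ → ⟦ allᵛ p τ ⟧)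
      ≡⟨ Z.⨁-concatMap (λ x → map (x ∷_) (vecsOver xs k)) xs (λ τ → ⟦ allᵛ p τ ⟧) ⟩
    Z.⨁ xs (λ x → Z.⨁ (map (x ∷_) (vecsOver xs k)) (λ τ → ⟦ allᵛ p τ ⟧))
      ≡⟨ Z.⨁-cong xs (λ x → ≡.trans (Z.⨁-map (x ∷_) (vecsOver xs k) (λ τ → ⟦ allᵛ p τ ⟧)) (≡.trans (Z.⨁-cong (vecsOver xs k) λ τ → ⟦∧⟧ (p x) (allᵛ p τ))
            (≡.sym (Z.⨁-distribˡ (vecsOver xs k) ⟦ p x ⟧ (λ τ → ⟦ allᵛ p τ ⟧))))) ⟩
    Z.⨁ xs (λ x → ⟦ p x ⟧ ℤ.* Z.⨁ (vecsOver xs k) (λ τ → ⟦ allᵛ p τ ⟧))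
      ≡⟨ Z.⨁-distribʳ xs (Z.⨁ (vecsOver xs k) (λ τ → ⟦ allᵛ p τ ⟧)) (λ x → ⟦ p x ⟧) ⟨
    Z.⨁ xs (λ x → ⟦ p x ⟧) ℤ.* Z.⨁ (vecsOver xs k) (λ τ → ⟦ allᵛ p τ ⟧)
      ≡⟨ cong₂ ℤ._*_ (count p xs) (count-tuples p xs k) ⟩
    + length (filterB p xs) ℤ.* + (length (filterB p xs) ℕ.^ k)
      ≡⟨ ℤₚ.pos-* (length (filterB p xs)) _ ⟨
    + (length (filterB p xs) ℕ.^ suc k) ∎
    where
      open ≡.≡-Reasoning
      ⟦∧⟧ : ∀ a b → ⟦ a ∧ b ⟧ ≡ ⟦ a ⟧ ℤ.* ⟦ b ⟧
      ⟦∧⟧ true b = ≡.sym (ℤₚ.*-identityˡ ⟦ b ⟧)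
      ⟦∧⟧ false b = ≡.refl

  powQ-integral : ∀ m d → powQ (mkℚᵘ (+ m) 0) d ≡ mkℚᵘ (+ (m ℕ.^ d)) 0
  powQ-integral m zero = ≡.refl
  powQ-integral m (suc d) = ≡.trans (cong (mkℚᵘ (+ m) 0 Q.*_) (powQ-integral m d)) (cong (λ z → mkℚᵘ z 0) (≡.sym (ℤₚ.pos-* m (m ℕ.^ d))))

  χ-integral : ∀ m → χ (mkℚᵘ (+ m) 0) ≡ mkℚᵘ (Z.⨁ latticeL (λ X → μ X ℤ.* + (m ℕ.^ dim X))) 0
  χ-integral m = go latticeL
    where
      go : ∀ Xs → foldr Q._+_ Q.0ℚᵘ (map (λ X → mkℚᵘ (μ X) 0 Q.* powQ (mkℚᵘ (+ m) 0) (dim X)) Xs) ≡ mkℚᵘ (Z.⨁ Xs (λ X → μ X ℤ.* + (m ℕ.^ dim X))) 0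
      go [] = ≡.refl
      go (X ∷ Xs) = ≡.trans (cong₂ Q._+_ (cong (mkℚᵘ (μ X) 0 Q.*_) (powQ-integral m (dim X))) (go Xs))
        (cong (λ z → mkℚᵘ z 0) (cong₂ ℤ._+_ (ℤₚ.*-identityʳ (μ X ℤ.* + (m ℕ.^ dim X))) (ℤₚ.*-identityʳ (Z.⨁ Xs (λ X → μ X ℤ.* + (m ℕ.^ dim X))))))

  -- All hyperplanes that contain the tuple. Their intersection is the smallest flat containing it,
  -- which `tuple-in-flat` expresses.
  annihilator : ∀ {k} → Vec (Vect ℓ) k → Subset
  annihilator τ = tabulate (λ i → allᵛ (λ v → isZero (eval (A i) v)) τ)

  allᵛ-elim : ∀ {B : Set} {k} (p : B → Bool) (τ : Vec B k) → allᵛ p τ ≡ true → ∀ j → p (lookup τ j) ≡ true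
  allᵛ-elim p (x ∷ τ) e zero = proj₁ (∧-true e)
  allᵛ-elim p (x ∷ τ) e (suc j) = allᵛ-elim p τ (proj₂ (∧-true {p x} e)) j

  allᵛ-intro : ∀ {B : Set} {k} (p : B → Bool) (τ : Vec B k) → (∀ j → p (lookup τ j) ≡ true) → allᵛ p τ ≡ true
  allᵛ-intro p [] h = ≡.refl
  allᵛ-intro p (x ∷ τ) h = true-∧ (h zero) (allᵛ-intro p τ (h ∘ suc))

  annihilates : ∀ {k} (τ : Vec (Vect ℓ) k) i → lookup (annihilator τ) i ≡ true → ∀ j → eval (A i) (lookup τ j) ≡ 0#
  annihilates τ i e j = does-true (eval (A i) (lookup τ j) ≟ 0#)
    (allᵛ-elim (λ v → isZero (eval (A i) v)) τ (≡.trans (≡.sym (Vₚ.lookup∘tabulate (λ i → allᵛ (λ v → isZero (eval (A i) v)) τ) i)) e) j)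

  tuple-in-flat : ∀ {k} (τ : Vec (Vect ℓ) k) X → allᵛ (inFlat X) τ ≡ flatSub (annihilator τ) X
  tuple-in-flat τ X = bool-ext to′ from′
    where
      to′ : allᵛ (inFlat X) τ ≡ true → flatSub (annihilator τ) X ≡ true
      to′ e = flatSub-intro {annihilator τ} {X} λ v Sv → inFlat-intro X λ i Xi → inFlat-elim (annihilator τ) Sv i
        (≡.trans (Vₚ.lookup∘tabulate _ i) (allᵛ-intro _ τ λ j → true-does (eval (A i) (lookup τ j) ≟ 0#) (inFlat-elim X (allᵛ-elim (inFlat X) τ e j) i Xi)))
      from′ : flatSub (annihilator τ) X ≡ true → allᵛ (inFlat X) τ ≡ true
      from′ e = allᵛ-intro (inFlat X) τ λ j → flatSub-elim {annihilator τ} {X} e (lookup τ j)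
        (inFlat-intro (annihilator τ) λ i Si → annihilates τ i Si j)

  -- The critical problem of Crapo and Rota: χ(q^k) counts the k-tuples that lie in no hyperplane.
  critical-count : ∀ k → Z.⨁ latticeL (λ X → μ X ℤ.* + ((q ℕ.^ k) ℕ.^ dim X)) ≡
    + length (filterB (λ τ → isWhole (proj₁ (representative (annihilator τ)))) (vecsOver (allVecs ℓ) k))
  critical-count k = begin
    Z.⨁ latticeL (λ X → μ X ℤ.* + ((q ℕ.^ k) ℕ.^ dim X))
      -- (q^k)^(dim X) is the number of k-tuples of points of X.
      ≡⟨ Z.⨁-cong latticeL (λ X → ≡.trans (cong (μ X ℤ.*_) (≡.trans (cong +_ (powers X)) (≡.sym (count-tuples (inFlat X) (allVecs ℓ) k))))
            (Z.⨁-distribˡ tuples (μ X) (λ τ → ⟦ allᵛ (inFlat X) τ ⟧))) ⟩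
    Z.⨁ latticeL (λ X → Z.⨁ tuples (λ τ → μ X ℤ.* ⟦ allᵛ (inFlat X) τ ⟧))
      ≡⟨ Z.⨁-swap latticeL tuples (λ X τ → μ X ℤ.* ⟦ allᵛ (inFlat X) τ ⟧) ⟩
    Z.⨁ tuples (λ τ → Z.⨁ latticeL (λ X → μ X ℤ.* ⟦ allᵛ (inFlat X) τ ⟧))
      -- For fixed τ the sum runs over the flats that contain the smallest flat of τ, so by `sum-μ`
      -- it is 1 or 0 according to whether that flat is the whole space.
      ≡⟨ Z.⨁-cong tuples (λ τ → ≡.trans (Z.⨁-cong latticeL λ X → ≡.trans (select (allᵛ (inFlat X) τ) (μ X)) (cong (λ b → if b then μ X else + 0) (contains τ X)))
            (sum-μ (rep τ) (proj₁ (proj₂ (representative (annihilator τ)))))) ⟩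
    Z.⨁ tuples (λ τ → ⟦ isWhole (rep τ) ⟧)
      ≡⟨ count (λ τ → isWhole (rep τ)) tuples ⟩
    + length (filterB (λ τ → isWhole (rep τ)) tuples) ∎
    where
      open ≡.≡-Reasoning
      tuples = vecsOver (allVecs ℓ) k
      rep : Vec (Vect ℓ) k → Subset
      rep τ = proj₁ (representative (annihilator τ))
      powers : ∀ X → (q ℕ.^ k) ℕ.^ dim X ≡ length (points X) ℕ.^ k
      powers X = ≡.trans (ℕₚ.^-*-assoc q k (dim X)) (≡.trans (cong (q ℕ.^_) (ℕₚ.*-comm k (dim X)))
        (≡.trans (≡.sym (ℕₚ.^-*-assoc q (dim X) k)) (cong (ℕ._^ k) (≡.sym (card-points X)))))
      select : ∀ b x → x ℤ.* ⟦ b ⟧ ≡ (if b then x else + 0)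
      select true x = ℤₚ.*-identityʳ x
      select false x = ℤₚ.*-zeroʳ x
      contains : ∀ τ X → allᵛ (inFlat X) τ ≡ flatSub (rep τ) X
      contains τ X = ≡.trans (tuple-in-flat τ X) (bool-ext
          (flatSub-trans {rep τ} {annihilator τ} {X} (sameFlat⇒flatSub {rep τ} {annihilator τ} (sameFlat-sym {annihilator τ} {rep τ} same)))
          (flatSub-trans {annihilator τ} {rep τ} {X} (sameFlat⇒flatSub {annihilator τ} {rep τ} same)))
        where same = proj₂ (proj₂ (representative (annihilator τ)))

  -- A tuple in no hyperplane has an empty annihilator, so its smallest flat is the whole space and
  -- it belongs to the set whose size is the value of χ.
  tuples-covered : ∀ k → χ (mkℚᵘ (+ (q ℕ.^ k)) 0) ≃ Q.0ℚᵘ →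
    ∀ (τ : Vec (Vect ℓ) k) → Σ[ i ∈ Fin n ] (∀ j → eval (A i) (lookup τ j) ≡ 0#)
  tuples-covered k χ≃0 τ with Finₚ.any? (λ i → lookup (annihilator τ) i B≟ true)
  ... | yes (i , e) = i , annihilates τ i e
  ... | no none = ⊥-elim (nonempty (filterB-∈ _ (vecsOver-complete τ λ i → allVecs-complete _) whole) no-tuples)
    where
      S = annihilator τ
      rep = proj₁ (representative S)
      whole : isWhole rep ≡ true
      whole = sameFlat-intro {rep} {emptySubset} λ v → ≡.trans (≡.sym (sameFlat-elim {S} {rep} (proj₂ (proj₂ (representative S))) v))
        (≡.trans (inFlat-intro S {v} λ i Si → ⊥-elim (none (i , Si))) (≡.sym (inFlat-intro emptySubset {v} λ i ei →
          ⊥-elim (true≢false (≡.trans (≡.sym ei) (Vₚ.lookup-replicate i false))))))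
      vanishes : ∀ {z} → χ (mkℚᵘ (+ (q ℕ.^ k)) 0) ≡ mkℚᵘ z 0 → z ≡ + 0
      vanishes {z} e with subst (_≃ Q.0ℚᵘ) e χ≃0
      ... | *≡* e′ = ≡.trans (≡.sym (ℤₚ.*-identityʳ z)) e′
      no-tuples : length (filterB (λ τ → isWhole (proj₁ (representative (annihilator τ)))) (vecsOver (allVecs ℓ) k)) ≡ 0
      no-tuples = ℤₚ.+-injective (≡.trans (≡.sym (critical-count k)) (vanishes (χ-integral (q ℕ.^ k))))
      nonempty : ∀ {B : Set} {x : B} {xs} → x ∈ xs → length xs ≢ 0
      nonempty (here _) ()
      nonempty (there _) ()

-- Normalised forms, and completion to the arrangement of all hyperplanes.

module NormalForms {q : ℕ} (𝔽 : FiniteField q) where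
  open Field 𝔽 hiding (_^_)
  open Vectors 𝔽

  ∈⟨⟩-trans : ∀ {k} {u v w : Vect k} → u ∈⟨ v ⟩ → v ∈⟨ w ⟩ → u ∈⟨ w ⟩
  ∈⟨⟩-trans (a , ≡.refl) (b , ≡.refl) = a * b , scaleV-assoc a b _

  -- One form for each hyperplane, with first nonzero coefficient 1.
  normalForms : ∀ k → List (Vect k)
  normalForms zero = []
  normalForms (suc k) = map (1# ∷_) (allVecs k) ++ map (0# ∷_) (normalForms k)

  data Normal : ∀ {k} → Vect k → Set where
    leading : ∀ {k} (v : Vect k) → Normal (1# ∷ v)
    later : ∀ {k} {v : Vect k} → Normal v → Normal (0# ∷ v)

  normal : ∀ {k} {v : Vect k} → v ∈ normalForms k → Normal v
  normal {suc k} v∈ with ∈ₚ.∈-++⁻ (map (1# ∷_) (allVecs k)) v∈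
  ... | inj₁ v∈₁ with ∈ₚ.∈-map⁻ (1# ∷_) v∈₁
  ...   | w , _ , ≡.refl = leading w
  normal {suc k} v∈ | inj₂ v∈₂ with ∈ₚ.∈-map⁻ (0# ∷_) v∈₂
  ...   | w , w∈ , ≡.refl = later (normal w∈)

  normal-nonzero : ∀ {k} {v : Vect k} → Normal v → v ≢ zeroV
  normal-nonzero (leading v) e = 0≢1 (≡.sym (Vₚ.∷-injectiveˡ e))
  normal-nonzero (later n) e = normal-nonzero n (Vₚ.∷-injectiveʳ e)

  normal-unique : ∀ {k} {v w : Vect k} → Normal v → Normal w → v ∈⟨ w ⟩ → v ≡ w
  normal-unique (leading v) (leading w) (c , e) = ≡.trans e (≡.trans
    (cong (λ z → scaleV z (1# ∷ w)) (≡.sym (≡.trans (Vₚ.∷-injectiveˡ e) (*-identityʳ c)))) (scaleV-1# (1# ∷ w)))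
  normal-unique (leading v) (later nw) (c , e) = ⊥-elim (0≢1 (≡.sym (≡.trans (Vₚ.∷-injectiveˡ e) (zeroʳ c))))
  normal-unique (later nv) (leading w) (c , e) = ⊥-elim (normal-nonzero nv (≡.trans (Vₚ.∷-injectiveʳ e)
    (≡.trans (cong (λ z → scaleV z w) (≡.sym (≡.trans (Vₚ.∷-injectiveˡ e) (*-identityʳ c)))) (scaleV-0# w))))
  normal-unique (later nv) (later nw) (c , e) = cong (0# ∷_) (normal-unique nv nw (c , Vₚ.∷-injectiveʳ e))

  normalize : ∀ {k} (v : Vect k) → v ≢ zeroV → Σ[ u ∈ Vect k ] u ∈ normalForms k × v ∈⟨ u ⟩
  normalize [] v≢0 = ⊥-elim (v≢0 ≡.refl)
  normalize {suc k} (x ∷ v) v≢0 with x ≟ 0#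
  ... | no x≢0 = 1# ∷ scaleV (inv x x≢0) v , ∈ₚ.∈-++⁺ˡ (∈ₚ.∈-map⁺ (1# ∷_) (allVecs-complete _)) , x ,
        cong₂ _∷_ (≡.sym (*-identityʳ x)) (≡.sym (≡.trans (scaleV-assoc x (inv x x≢0) v) (≡.trans (cong (λ z → scaleV z v) (x*inv x x≢0)) (scaleV-1# v))))
  ... | yes ≡.refl with normalize v (λ e → v≢0 (cong (0# ∷_) e))
  ...   | u , u∈ , c , e = 0# ∷ u , ∈ₚ.∈-++⁺ʳ (map (1# ∷_) (allVecs k)) (∈ₚ.∈-map⁺ (0# ∷_) u∈) , c , cong₂ _∷_ (≡.sym (zeroʳ c)) e

  normalForms-unique : ∀ k → Unique (normalForms k)
  normalForms-unique zero = []
  normalForms-unique (suc k) = Uₚ.++⁺ (Uₚ.map⁺ Vₚ.∷-injectiveʳ (allVecs-unique k)) (Uₚ.map⁺ Vₚ.∷-injectiveʳ (normalForms-unique k)) disjoint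
    where
      disjoint : ∀ {v} → ¬ (v ∈ map (1# ∷_) (allVecs k) × v ∈ map (0# ∷_) (normalForms k))
      disjoint (v∈ , v∈′) with ∈ₚ.∈-map⁻ (1# ∷_) v∈ | ∈ₚ.∈-map⁻ (0# ∷_) v∈′
      ... | _ , _ , ≡.refl | _ , _ , e = 0≢1 (≡.sym (Vₚ.∷-injectiveˡ e))

  length-normalForms : ∀ k → length (normalForms k) ≡ geometric k
  length-normalForms zero = ≡.refl
  length-normalForms (suc k) = ≡.trans (Lₚ.length-++ (map (1# ∷_) (allVecs k))) (≡.trans
    (cong₂ ℕ._+_ (≡.trans (Lₚ.length-map (1# ∷_) (allVecs k)) (Evaluation.length-allVecs 𝔽 k))
      (≡.trans (Lₚ.length-map (0# ∷_) (normalForms k)) (length-normalForms k))) (ℕₚ.+-comm (q ℕ.^ k) _))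

module HyperplaneArrangement {q : ℕ} (𝔽 : FiniteField q) {ℓ n : ℕ} (A : Fin n → Over.Vect 𝔽 ℓ)
    (isArrangement : Over.Arrangement.IsArrangement 𝔽 A) where
  open Field 𝔽 hiding (_^_)
  open Vectors 𝔽
  open Evaluation 𝔽
  open NormalForms 𝔽

  As : List (Vect ℓ)
  As = map A (allFin n)

  A≢0 : ∀ i → A i ≢ zeroV
  A≢0 i e = proj₁ isArrangement i λ j → ≡.trans (cong (λ z → lookup z j) e) (lookup-zeroV j)

  A-independent : ∀ {i j} → i ≢ j → ¬ A i ∈⟨ A j ⟩
  A-independent {i} {j} i≢j Ai∈ = proj₂ isArrangement i j i≢j λ v → vanish v (∈⟨⟩-sym (A≢0 i) Ai∈) , vanish v Ai∈
    where
      vanish : ∀ v {α β} → α ∈⟨ β ⟩ → eval β v ≡ 0# → eval α v ≡ 0#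
      vanish v {β = β} (c , ≡.refl) e = ≡.trans (eval-scaleˡ c β v) (≡.trans (cong (c *_) e) (zeroʳ c))

  normalized : Fin n → Vect ℓ
  normalized i = proj₁ (normalize (A i) (A≢0 i))

  A∈normalized : ∀ i → A i ∈⟨ normalized i ⟩
  A∈normalized i = proj₂ (proj₂ (normalize (A i) (A≢0 i)))

  normalized∈A : ∀ i → normalized i ∈⟨ A i ⟩
  normalized∈A i = ∈⟨⟩-sym (A≢0 i) (A∈normalized i)

  normalized∈ : ∀ i → normalized i ∈ normalForms ℓ
  normalized∈ i = proj₁ (proj₂ (normalize (A i) (A≢0 i)))

  normalized-injective : ∀ {i j} → normalized i ≡ normalized j → i ≡ j
  normalized-injective {i} {j} e with i ≟F j
  ... | yes i≡j = i≡j
  ... | no i≢j = ⊥-elim (A-independent i≢j (∈⟨⟩-trans (A∈normalized i) (subst (_∈⟨ A j ⟩) (≡.sym e) (normalized∈A j))))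

  Ns : List (Vect ℓ)
  Ns = map normalized (allFin n)

  open import Data.List.Membership.DecPropositional (Vₚ.≡-dec {n = ℓ} _≟_) using (_∈?_)

  -- The missing hyperplanes, found by comparing normalised forms. Deletion nevertheless starts from
  -- `Bs ++ As` with the given forms in `As`, so that it ends at the given arrangement itself.
  Bs : List (Vect ℓ)
  Bs = filter (λ v → ¬? (v ∈? Ns)) (normalForms ℓ)

  ∈Bs : ∀ {v} → v ∈ Bs → v ∈ normalForms ℓ × v ∉ Ns
  ∈Bs v∈ = ∈ₚ.∈-filter⁻ (λ v → ¬? (v ∈? Ns)) {xs = normalForms ℓ} v∈

  normalForms-↭ : normalForms ℓ ↭ Bs ++ Ns
  normalForms-↭ = unique-↭ (normalForms-unique ℓ)
      (Uₚ.++⁺ (Uₚ.filter⁺ _ (normalForms-unique ℓ)) (Uₚ.map⁺ normalized-injective (Uₚ.allFin⁺ n)) (λ (v∈ , v∈′) → proj₂ (∈Bs v∈) v∈′))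
      into outof
    where
      into : ∀ {v} → v ∈ normalForms ℓ → v ∈ Bs ++ Ns
      into {v} v∈ with v ∈? Ns
      ... | yes v∈N = ∈ₚ.∈-++⁺ʳ Bs v∈N
      ... | no v∉N = ∈ₚ.∈-++⁺ˡ (∈ₚ.∈-filter⁺ (λ v → ¬? (v ∈? Ns)) v∈ v∉N)
      outof : ∀ {v} → v ∈ Bs ++ Ns → v ∈ normalForms ℓ
      outof v∈ with ∈ₚ.∈-++⁻ Bs v∈
      ... | inj₁ v∈B = proj₁ (∈Bs v∈B)
      ... | inj₂ v∈N with ∈ₚ.∈-map⁻ normalized v∈N
      ...   | i , _ , ≡.refl = normalized∈ i

  length-As : length As ≡ n
  length-As = ≡.trans (Lₚ.length-map A (allFin n)) (Lₚ.length-tabulate id)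

  length-all : length (Bs ++ As) ≡ geometric ℓ
  length-all = ≡.trans (Lₚ.length-++ Bs) (≡.trans (cong (length Bs ℕ.+_) (≡.trans (Lₚ.length-map A (allFin n)) (≡.sym (Lₚ.length-map normalized (allFin n)))))
    (≡.trans (≡.sym (Lₚ.length-++ Bs)) (≡.trans (≡.sym (↭ₚ.↭-length normalForms-↭)) (length-normalForms ℓ))))

  all-nonzero : All (_≢ zeroV) (Bs ++ As)
  all-nonzero = Allₚ.++⁺ (All.tabulate λ v∈ → normal-nonzero (normal (proj₁ (∈Bs v∈)))) (Allₚ.map⁺ (All.tabulate λ {i} _ → A≢0 i))

  all-independent : AllPairs (λ v w → ¬ v ∈⟨ w ⟩) (Bs ++ As)
  all-independent = AllPairsₚ.++⁺ (pairs Bs (Uₚ.filter⁺ _ (normalForms-unique ℓ)) (λ v∈ → normal (proj₁ (∈Bs v∈))))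
      (AllPairsₚ.map⁺ (AllPairs.map A-independent (Uₚ.allFin⁺ n)))
      (All.tabulate λ v∈ → Allₚ.map⁺ (All.tabulate λ {i} _ v∈Ai → proj₂ (∈Bs v∈) (subst (_∈ Ns)
        (≡.sym (normal-unique (normal (proj₁ (∈Bs v∈))) (normal (normalized∈ i)) (∈⟨⟩-trans v∈Ai (A∈normalized i))))
        (∈ₚ.∈-map⁺ normalized (∈ₚ.∈-allFin i)))))
    where
      pairs : ∀ vs → Unique vs → (∀ {v} → v ∈ vs → Normal v) → AllPairs (λ v w → ¬ v ∈⟨ w ⟩) vs
      pairs [] [] h = []
      pairs (v ∷ vs) (v∉ ∷ u) h = All.tabulate (λ w∈ v∈w → All.lookup v∉ w∈ (normal-unique (h (here ≡.refl)) (h (there w∈)) v∈w)) ∷ pairs vs u (h ∘ there)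

  all-cover : ∀ v → v ≢ zeroV → Σ[ h ∈ Vect ℓ ] h ∈ Bs ++ As × v ∈⟨ h ⟩
  all-cover v v≢0 with normalize v v≢0
  ... | u , u∈ , v∈u with ∈ₚ.∈-++⁻ Bs (↭ₚ.∈-resp-↭ normalForms-↭ u∈)
  ...   | inj₁ u∈B = u , ∈ₚ.∈-++⁺ˡ u∈B , v∈u
  ...   | inj₂ u∈N with ∈ₚ.∈-map⁻ normalized u∈N
  ...     | i , _ , ≡.refl = A i , ∈ₚ.∈-++⁺ʳ Bs (∈ₚ.∈-map⁺ A (∈ₚ.∈-allFin i)) , ∈⟨⟩-trans v∈u (normalized∈A i)

-- Subspaces of codimension two and the blocking condition.

-- Changing only the coordinates r and p moves any vector into the subspace α = w′ = 0, so the k vectors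
-- obtained from the other basis vectors detect the forms that vanish on it.
module CodimensionTwo {q : ℕ} (𝔽 : FiniteField q) {k : ℕ} (α w′ : Over.Vect 𝔽 (suc (suc k)))
    (p r : Fin (suc (suc k))) (nz : lookup α p ≢ FiniteField.0# 𝔽) (nzr : lookup w′ r ≢ FiniteField.0# 𝔽)
    (w′p : lookup w′ p ≡ FiniteField.0# 𝔽) where
  open Field 𝔽 hiding (_^_)
  open Vectors 𝔽
  open Evaluation 𝔽
  open F-Solver

  p≢r : p ≢ r
  p≢r e = nzr (≡.trans (cong (lookup w′) (≡.sym e)) w′p)

  r′ = punchOut p≢r

  index : Fin k → Fin (suc (suc k))
  index j = punchIn p (punchIn r′ j)

  index-cover : ∀ i → i ≡ p ⊎ i ≡ r ⊎ Σ[ j ∈ Fin k ] i ≡ index j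
  index-cover i with p ≟F i
  ... | yes p≡i = inj₁ (≡.sym p≡i)
  ... | no p≢i with r′ ≟F punchOut p≢i
  ...   | yes e = inj₂ (inj₁ (≡.trans (≡.sym (Finₚ.punchIn-punchOut p≢i)) (≡.trans (cong (punchIn p) (≡.sym e)) (Finₚ.punchIn-punchOut p≢r))))
  ...   | no ne = inj₂ (inj₂ (punchOut ne , ≡.trans (≡.sym (Finₚ.punchIn-punchOut p≢i)) (cong (punchIn p) (≡.sym (Finₚ.punchIn-punchOut ne)))))

  shift : Carrier → Fin (suc (suc k)) → Vect (suc (suc k)) → Vect (suc (suc k))
  shift x i v = addV v (scaleV (- x) (basisV i))

  eval-shift : ∀ β x i v → eval β (shift x i v) ≡ eval β v + - (x * lookup β i)
  eval-shift β x i v = ≡.trans (eval-addʳ β v _) (cong (λ z → eval β v + z) (≡.trans (eval-scaleʳ (- x) β (basisV i))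
    (≡.trans (cong ((- x) *_) (eval-basisV β i)) (solve 2 (λ x b → (:- x) :* b := :- (x :* b)) ≡.refl x (lookup β i)))))

  x₁ : Vect (suc (suc k)) → Carrier
  x₁ v = eval w′ v * inv (lookup w′ r) nzr

  v₁ : Vect (suc (suc k)) → Vect (suc (suc k))
  v₁ v = shift (x₁ v) r v

  x₂ : Vect (suc (suc k)) → Carrier
  x₂ v = eval α (v₁ v) * inv (lookup α p) nz

  -- The shift in coordinate r makes `w′` vanish; the later shift in coordinate p makes `α` vanish
  -- and does not disturb `w′`, whose p-th coefficient is 0.
  project : Vect (suc (suc k)) → Vect (suc (suc k))
  project v = shift (x₂ v) p (v₁ v)

  cancel : ∀ a b (b≢0 : b ≢ 0#) → a + - (a * inv b b≢0 * b) ≡ 0#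
  cancel a b b≢0 = ≡.trans (solve 3 (λ a i b → a :+ :- (a :* i :* b) := a :+ :- (a :* (b :* i))) ≡.refl a (inv b b≢0) b)
    (≡.trans (cong (λ z → a + - (a * z)) (x*inv b b≢0)) (solve 1 (λ a → a :+ :- (a :* con (+ 1)) := con (+ 0)) ≡.refl a))

  eval-α : ∀ v → eval α (project v) ≡ 0#
  eval-α v = ≡.trans (eval-shift α (x₂ v) p (v₁ v)) (cancel (eval α (v₁ v)) (lookup α p) nz)

  eval-w′ : ∀ v → eval w′ (project v) ≡ 0#
  eval-w′ v = ≡.trans (eval-shift w′ (x₂ v) p (v₁ v)) (≡.trans (cong₂ (λ a b → a + - (x₂ v * b))
    (≡.trans (eval-shift w′ (x₁ v) r v) (cancel (eval w′ v) (lookup w′ r) nzr)) w′p)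
    (solve 1 (λ x → con (+ 0) :+ :- (x :* con (+ 0)) := con (+ 0)) ≡.refl (x₂ v)))

  tuple : Vec (Vect (suc (suc k))) k
  tuple = tabulate (λ j → project (basisV (index j)))

  -- Reducing β by α and then by w′ gives β₂ with no coefficient at p and r. Hence β₂ takes the same
  -- value on a basis vector and on its projection, and there it agrees with β since α and w′
  -- vanish. So β₂ = 0.
  forms-on-tuple : ∀ β → (∀ j → eval β (lookup tuple j) ≡ 0#) → reduce α p nz β ∈⟨ w′ ⟩
  forms-on-tuple β kills = reduce≡0 w′ r nzr β₁ β₂≡0
    where
      open ≡.≡-Reasoning
      β₁ = reduce α p nz β
      β₂ = reduce w′ r nzr β₁
      eval-reduce : ∀ α p nz β v → eval α v ≡ 0# → eval (reduce α p nz β) v ≡ eval β v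
      eval-reduce α p nz β v e = ≡.trans (eval-addˡ β _ v) (≡.trans (cong (λ z → eval β v + z)
        (≡.trans (eval-scaleˡ _ α v) (≡.trans (cong (λ z → (- (lookup β p * inv (lookup α p) nz)) * z) e) (zeroʳ _)))) (+-identityʳ _))
      β₂p : lookup β₂ p ≡ 0#
      β₂p = ≡.trans (lookup-reduce w′ r nzr β₁ p) (≡.trans (cong₂ (λ x y → x + (- (lookup β₁ r * inv (lookup w′ r) nzr)) * y) (reduce-at α p nz β) w′p)
        (solve 1 (λ x → con (+ 0) :+ x :* con (+ 0) := con (+ 0)) ≡.refl _))
      β₂r : lookup β₂ r ≡ 0#
      β₂r = reduce-at w′ r nzr β₁
      β₂-project : ∀ v → eval β₂ (project v) ≡ eval β₂ v
      β₂-project v = ≡.trans (eval-shift β₂ (x₂ v) p (v₁ v)) (≡.trans (cong₂ (λ a b → a + - (x₂ v * b))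
        (≡.trans (eval-shift β₂ (x₁ v) r v) (cong (λ z → eval β₂ v + - (x₁ v * z)) β₂r)) β₂p)
        (solve 3 (λ e x y → (e :+ :- (x :* con (+ 0))) :+ :- (y :* con (+ 0)) := e) ≡.refl (eval β₂ v) (x₁ v) (x₂ v)))
      β₂-index : ∀ j → lookup β₂ (index j) ≡ 0#
      β₂-index j = begin
        lookup β₂ (index j) ≡⟨ eval-basisV β₂ (index j) ⟨
        eval β₂ v ≡⟨ β₂-project v ⟨
        eval β₂ (project v) ≡⟨ eval-reduce w′ r nzr β₁ (project v) (eval-w′ v) ⟩
        eval β₁ (project v) ≡⟨ eval-reduce α p nz β (project v) (eval-α v) ⟩
        eval β (project v) ≡⟨ cong (eval β) (Vₚ.lookup∘tabulate (λ j → project (basisV (index j))) j) ⟨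
        eval β (lookup tuple j) ≡⟨ kills j ⟩
        0# ∎
        where v = basisV (index j)
      β₂≡0 : β₂ ≡ zeroV
      β₂≡0 = vec-ext λ i → ≡.trans (coordinate i (index-cover i)) (≡.sym (lookup-zeroV i))
        where
          coordinate : ∀ i → i ≡ p ⊎ i ≡ r ⊎ Σ[ j ∈ Fin k ] i ≡ index j → lookup β₂ i ≡ 0#
          coordinate i (inj₁ e) = ≡.trans (cong (lookup β₂) e) β₂p
          coordinate i (inj₂ (inj₁ e)) = ≡.trans (cong (lookup β₂) e) β₂r
          coordinate i (inj₂ (inj₂ (j , e))) = ≡.trans (cong (lookup β₂) e) (β₂-index j)

module Blocking {q : ℕ} (𝔽 : FiniteField q) where
  open Field 𝔽 hiding (_^_)
  open Vectors 𝔽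
  open Evaluation 𝔽
  open F-Solver

  reduce-∈ : ∀ {k} (α : Vect k) p nz w β → reduce α p nz β ∈⟨ reduce α p nz w ⟩ →
    Σ[ a ∈ Carrier ] Σ[ b ∈ Carrier ] β ≡ addV (scaleV a w) (scaleV b α)
  reduce-∈ α p nz w β (c , e) = c , b + - (c * b′) , vec-ext λ i → begin
    lookup β i
      ≡⟨ solve 3 (λ β b a → β := (β :+ (:- b) :* a) :+ b :* a) ≡.refl (lookup β i) b (lookup α i) ⟩
    (lookup β i + (- b) * lookup α i) + b * lookup α i
      ≡⟨ cong (λ z → z + b * lookup α i) (≡.trans (≡.sym (lookup-reduce α p nz β i)) (≡.trans (cong (λ z → lookup z i) e)
            (≡.trans (lookup-scaleV c (reduce α p nz w) i) (cong (c *_) (lookup-reduce α p nz w i))))) ⟩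
    c * (lookup w i + (- b′) * lookup α i) + b * lookup α i
      ≡⟨ solve 5 (λ c w b′ a b → c :* (w :+ (:- b′) :* a) :+ b :* a := c :* w :+ (b :+ :- (c :* b′)) :* a) ≡.refl c (lookup w i) b′ (lookup α i) b ⟩
    c * lookup w i + (b + - (c * b′)) * lookup α i
      ≡⟨ ≡.trans (lookup-addV (scaleV c w) (scaleV (b + - (c * b′)) α) i) (cong₂ _+_ (lookup-scaleV c w i) (lookup-scaleV (b + - (c * b′)) α i)) ⟨
    lookup (addV (scaleV c w) (scaleV (b + - (c * b′)) α)) i ∎
    where
      open ≡.≡-Reasoning
      b = lookup β p * inv (lookup α p) nz
      b′ = lookup w p * inv (lookup α p) nz

  -- A subspace of codimension two in F_q^(k+2) is spanned by k vectors, which is the origin of the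
  -- exponent ℓ-2 in q^(ℓ-2). Replacing w by its reduction modulo α leaves the subspace unchanged
  -- and clears the p-th coefficient.
  blocks : ∀ {k n} (A : Fin n → Vect (suc (suc k))) →
    (∀ (τ : Vec (Vect (suc (suc k))) k) → Σ[ i ∈ Fin n ] (∀ j → eval (A i) (lookup τ j) ≡ 0#)) →
    ∀ α w → α ≢ zeroV → ¬ w ∈⟨ α ⟩ → Σ[ i ∈ Fin n ] Σ[ a ∈ Carrier ] Σ[ b ∈ Carrier ] A i ≡ addV (scaleV a w) (scaleV b α)
  blocks A covered α w α≢0 w∉α = hyperplane (nonzero-coordinate α α≢0)
    where
      hyperplane : (Σ[ p ∈ Fin _ ] lookup α p ≢ 0#) → Σ[ i ∈ Fin _ ] Σ[ a ∈ Carrier ] Σ[ b ∈ Carrier ] A i ≡ addV (scaleV a w) (scaleV b α)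
      hyperplane (p , nz) = second (nonzero-coordinate (reduce α p nz w) (λ e → w∉α (reduce≡0 α p nz w e)))
        where
          second : (Σ[ r ∈ Fin _ ] lookup (reduce α p nz w) r ≢ 0#) → Σ[ i ∈ Fin _ ] Σ[ a ∈ Carrier ] Σ[ b ∈ Carrier ] A i ≡ addV (scaleV a w) (scaleV b α)
          second (r , nzr) = proj₁ hit , reduce-∈ α p nz w (A (proj₁ hit)) (C.forms-on-tuple (A (proj₁ hit)) (proj₂ hit))
            where
              module C = CodimensionTwo 𝔽 α (reduce α p nz w) p r nz nzr (reduce-at α p nz w)
              hit = covered C.tuple

  line : ∀ (α w : Vect 1) → α ≢ zeroV → w ∈⟨ α ⟩
  line α w α≢0 = on-line (nonzero-coordinate α α≢0)
    where
      on-line : (Σ[ p ∈ Fin 1 ] lookup α p ≢ 0#) → w ∈⟨ α ⟩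
      on-line (zero , nz) = reduce≡0 α zero nz w (vec-ext λ { zero → reduce-at α zero nz w })

-- The list of exponents and the conclusion.

module ExponentList {q : ℕ} (𝔽 : FiniteField q) where
  open Field 𝔽 using (geometric)
  private module Z = BigSum ℤₚ.+-*-commutativeRing

  power : ℕ → ℤ
  power i = + (q ℕ.^ i)

  -- `expList` lists the powers upwards, while `exponent` and `geometric` recurse from the highest
  -- power as `downFrom` does.
  upTo↭downFrom : ∀ k → upTo k ↭ L.downFrom k
  upTo↭downFrom k = ↭.↭-sym (subst (_↭ upTo k) (Lₚ.reverse-upTo k) (↭ₚ.↭-reverse (upTo k)))

  sum-powers : ∀ k → foldr ℤ._+_ (+ 0) (map power (upTo k)) ≡ + geometric k
  sum-powers k = ≡.trans (foldr-⨁ (upTo k)) (≡.trans (Z.⨁-↭ (upTo↭downFrom k) power) (down k))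
    where
      foldr-⨁ : ∀ is → foldr ℤ._+_ (+ 0) (map power is) ≡ Z.⨁ is power
      foldr-⨁ [] = ≡.refl
      foldr-⨁ (i ∷ is) = cong (λ z → power i ℤ.+ z) (foldr-⨁ is)
      down : ∀ k → Z.⨁ (L.downFrom k) power ≡ + geometric k
      down zero = ≡.refl
      down (suc k) = ≡.trans (cong (λ z → power k ℤ.+ z) (down k)) (≡.trans (≡.sym (ℤₚ.pos-+ (q ℕ.^ k) (geometric k)))
        (cong +_ (ℕₚ.+-comm (q ℕ.^ k) (geometric k))))

  expList-↭ : ∀ l n d → d ℕ.+ geometric l ≡ n → + d ∷ map power (L.downFrom l) ↭ expList q (suc l) n
  expList-↭ l n d eq = ↭.trans (↭.prep (+ d) (↭ₚ.map⁺ power (↭.↭-sym (upTo↭downFrom l))))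
      (↭.trans (↭ₚ.∷↭∷ʳ (+ d) (map power (upTo l))) (↭.↭-reflexive (cong (λ z → map power (upTo l) ++ z ∷ []) last)))
    where
      open ≡.≡-Reasoning
      last : + d ≡ + n ℤ.- foldr ℤ._+_ (+ 0) (map power (upTo l))
      last = begin
        + d ≡⟨ ℤₚ.+-identityʳ (+ d) ⟨
        + d ℤ.+ + 0 ≡⟨ cong (λ z → + d ℤ.+ z) (ℤₚ.+-inverseʳ (+ geometric l)) ⟨
        + d ℤ.+ (+ geometric l ℤ.- + geometric l) ≡⟨ ℤₚ.+-assoc (+ d) (+ geometric l) (ℤ.- + geometric l) ⟨
        + d ℤ.+ + geometric l ℤ.- + geometric l ≡⟨ cong (ℤ._- + geometric l) (≡.trans (≡.sym (ℤₚ.pos-+ d (geometric l))) (cong +_ eq)) ⟩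
        + n ℤ.- + geometric l ≡⟨ cong (λ z → + n ℤ.- z) (sum-powers l) ⟨
        + n ℤ.- foldr ℤ._+_ (+ 0) (map power (upTo l)) ∎

module Freeness {q : ℕ} (𝔽 : FiniteField q) {l n : ℕ} (A : Fin n → Over.Vect 𝔽 (suc l))
    (isArrangement : Over.Arrangement.IsArrangement 𝔽 A) where
  open Field 𝔽 hiding (_^_; _+_; _*_; -_)
  open Arrangement A
  open Polynomials 𝔽 A
  open PolynomialForms 𝔽 A using (linearForms; homogeneous; module LC)
  open HyperplaneArrangement 𝔽 A isArrangement
  private
    module P = CommutativeRing polyRing
    module D = Deletion 𝔽 polyRing polyScalars linearForms
    module PB = BigSum polyRing
  open ExponentList 𝔽

  sumₚ-⨁ : ∀ {k} (f : Fin k → Poly) → sumₚ f ≡ PB.⨁ (allFin k) f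
  sumₚ-⨁ {k} f = go (allFin k)
    where
      go : ∀ js → concatMap f js ≡ PB.⨁ js f
      go [] = ≡.refl
      go (j ∷ js) = ≡.trans (cong (f j ++_) (go js)) (≡.sym (⊞-def (f j) (PB.⨁ js f)))

  sumₚ-products : ∀ {k} (f g : Fin k → Poly) → sumₚ (λ j → f j *ₚ g j) ≋ PB.⨁ (allFin k) (λ j → f j ⊠ g j)
  sumₚ-products {k} f g = P.trans (P.reflexive (sumₚ-⨁ (λ j → f j *ₚ g j))) (PB.⨁-cong (allFin k) λ j → P.reflexive (≡.sym (⊠-def (f j) (g j))))

  applyDer-lin : ∀ δ α → applyDer δ α ≋ LC.lin α δ
  applyDer-lin δ α = sumₚ-products (λ i → constₚ (lookup α i)) δ

  InD⇒ : ∀ {δ} → InD δ → D.InD As δ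
  InD⇒ {δ} δ∈ {h} h∈ with ∈ₚ.∈-map⁻ A h∈
  ... | i , _ , ≡.refl = proj₁ (δ∈ i) , P.trans (P.sym (applyDer-lin δ (A i)))
    (P.trans (P.sym (wrap (proj₂ (δ∈ i)))) (P.reflexive (≡.sym (⊠-def (linPoly (A i)) (proj₁ (δ∈ i))))))

  InD⇐ : ∀ {δ} → D.InD As δ → InD δ
  InD⇐ {δ} δ∈ i = proj₁ divides , unwrap (P.trans (P.reflexive (≡.sym (⊠-def (linPoly (A i)) (proj₁ divides))))
      (P.trans (P.sym (proj₂ divides)) (P.sym (applyDer-lin δ (A i)))))
    where divides = δ∈ (∈ₚ.∈-map⁺ A (∈ₚ.∈-allFin i))

  free : D.Basis As → FreeWithExponents (expList q (suc l) n)
  free basis = suc l , θ , degreeθ , (λ j → InD⇐ (θ-inD j)) , (λ j i → homogeneous (θ-homogeneous j i)) ,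
      (λ δ δ∈ → generated δ (θ-generates δ (InD⇒ δ∈))) ,
      (λ f f′ eq j → unwrap (θ-independent f f′ (λ i → P.trans (P.sym (combo-combination f i)) (P.trans (wrap (eq i)) (combo-combination f′ i))) j)) ,
      subst (_↭ expList q (suc l) n) (≡.sym exponents) (expList-↭ l n (D.Basis.d basis) (≡.trans (D.Basis.degree basis) length-As))
    where
      open D.FreeBasis basis
      combo-combination : ∀ f i → combo f θ i ≋ combination f i
      combo-combination f i = sumₚ-products f (λ j → θ j i)
      generated : ∀ δ → Σ[ f ∈ (Fin (suc l) → Poly) ] (∀ i → δ i ≋ combination f i) → Σ[ f ∈ (Fin (suc l) → Poly) ] (∀ i → δ i ≈ₚ combo f θ i)
      generated δ (f , eq) = f , λ i → unwrap (P.trans (eq i) (P.sym (combo-combination f i)))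
      exponent-downFrom : ∀ k → map D.exponent (allFin k) ≡ L.downFrom k
      exponent-downFrom zero = ≡.refl
      exponent-downFrom (suc k) = cong (k ∷_) (≡.trans (Lₚ.map-tabulate suc D.exponent) (≡.trans (≡.sym (Lₚ.map-tabulate id D.exponent)) (exponent-downFrom k)))
      exponents : map (λ j → + degreeθ j) (allFin (suc l)) ≡ + D.Basis.d basis ∷ map power (L.downFrom l)
      exponents = cong (+ D.Basis.d basis ∷_) (≡.trans (Lₚ.map-tabulate suc (λ j → + degreeθ j)) (≡.trans (≡.sym (Lₚ.map-tabulate id (λ j → power (D.exponent j))))
        (≡.trans (Lₚ.map-∘ (allFin l)) (cong (map power) (exponent-downFrom l)))))

  free-if-blocking : D.Blocking As → FreeWithExponents (expList q (suc l) n)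
  free-if-blocking blocking = free (D.delete-all Bs As blocking all-nonzero all-independent
    (D.full-basis (Bs ++ As) all-cover length-all))

mainTheorem6 : (q : ℕ) (𝔽 : FiniteField q) (ℓ : ℕ) → 1 ≤ ℓ →
    (n : ℕ) (A : Fin n → Vec (FiniteField.Carrier 𝔽) ℓ) →
    Over.Arrangement.IsArrangement 𝔽 A →
    Over.Arrangement.χ 𝔽 A (tval q ℓ) ≃ 0ℚᵘ →
    Over.Arrangement.FreeWithExponents 𝔽 A (expList q ℓ n)
mainTheorem6 q 𝔽 (suc zero) _ n A isArrangement χ≃0 = Freeness.free-if-blocking 𝔽 A isArrangement
  -- In dimension one every form is a multiple of a given nonzero one, so there is no pair α, w to
  -- block.
  λ α w α≢0 w∉α → ⊥-elim (w∉α (Blocking.line 𝔽 α w α≢0))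
mainTheorem6 q 𝔽 (suc (suc k)) _ n A isArrangement χ≃0 = Freeness.free-if-blocking 𝔽 A isArrangement blocking
  where
    blocking : Deletion.Blocking 𝔽 (Polynomials.polyRing 𝔽 A) (Polynomials.polyScalars 𝔽 A) (PolynomialForms.linearForms 𝔽 A) (map A (allFin n))
    blocking α w α≢0 w∉α = A (proj₁ hit) , ∈ₚ.∈-map⁺ A (∈ₚ.∈-allFin (proj₁ hit)) , proj₂ hit
      -- `tval q (suc (suc k))` is q^k with denominator 1 by computation, so the vanishing of χ
      -- applies to k-tuples as it stands.
      where hit = Blocking.blocks 𝔽 A (CriticalProblem.tuples-covered 𝔽 A k χ≃0) α w α≢0 w∉α
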